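{- Let $K\subseteq L\subseteq\mathcal A$ be differential fields of characteristic $0$, where $\mathcal A$ is a saturated differentially closed field with $|L|<|\mathcal A|$, and let $L/K$ be a strongly normal extension. Then $Gal(L/K)$ is isomorphic to a group interpretable in the field $C_{\mathcal A}$, where the interpretation is given by quantifier-free formulas of the language of rings with parameters from $C_K$; that is, there are $d\ge 1$, a subset $S\subseteq C_{\mathcal A}^d$, an equivalence relation $\sim$ on $S$ and a ternary relation $R$ on $S$, all defined in $C_{\mathcal A}$ by quantifier-free ring formulas with parameters from $C_K$, such that $R$ induces the graph of a group law on $S/\!\sim$ and $(S/\!\sim,R/\!\sim)$ is isomorphic to $(Gal(L/K),\circ)$.
   Context: For a differential field $F$, $C_F$ is its field of constants. $\langle A,B\rangle$ denotes the differential field generated by $A\cup B$ inside $\mathcal A$. $Hom_K(L,\mathcal A)$ is the set of differential field embeddings of $L$ into $\mathcal A$ fixing $K$ pointwise. An element $\tau\in Hom_K(L,\mathcal A)$ is strong if $\tau$ is the identity on $C_L$ and $\langle L,C_{\mathcal A}\rangle=\langle\tau(L),C_{\mathcal A}\rangle$. $L/K$ is strongly normal if $L$ is finitely generated as a differential field over $K$ and every $\tau\in Hom_K(L,\mathcal A)$ is strong. $Gal(L/K)$ is the group of differential field automorphisms of $\langle L,C_{\mathcal A}\rangle$ fixing $\langle K,C_{\mathcal A}\rangle$ pointwise. The field $C_K$ is not assumed algebraically closed. -}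

module Defs where

open import Level using (_⊔_) renaming (suc to lsuc)
open import Algebra.Bundles using (CommutativeRing; RawRing; Group; RawGroup)
open import Algebra.Structures using (IsGroup)
open import Algebra.Morphism.Structures using (IsRingMonomorphism; IsRingIsomorphism; IsGroupIsomorphism)
import Algebra.Definitions.RawMonoid as RawMonoidDefs
import Algebra.Morphism.Construct.Composition as Compose
import Algebra.Morphism.Construct.Identity as Identity
import Algebra.Morphism.RingMonomorphism as RingMono
import Algebra.Properties.AbelianGroup as AbelianGroupProperties
open import Data.Fin.Base using (Fin)
open import Data.List.Base using (List; foldr; drop)
open import Data.List.Relation.Unary.All using (All)
open import Data.List.Relation.Unary.Any using (Any)
open import Data.Nat.Base using (ℕ; zero; suc; _≤_) renaming (_+_ to _+ℕ_)
open import Data.Product.Base using (Σ; ∃; _×_; _,_; proj₁; proj₂)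
open import Data.Sum.Base using (_⊎_)
open import Data.Unit.Polymorphic using (⊤; tt)
open import Data.Vec.Functional using (Vector; _∷_; _++_)
open import Function.Base using (id; _∘_)
open import Function.Bundles using (Injection; _⇔_)
open import Relation.Binary.Bundles using (Setoid)
open import Relation.Binary.Core using (Rel)
open import Relation.Binary.Definitions using (_Respects_)
open import Relation.Nullary.Negation.Core using (¬_)
open import Relation.Unary using (Pred; _∪_; _≐_)
import Relation.Binary.Reasoning.Setoid as SetoidReasoning

infix 4 _≺_

_≺_ : ∀ {a b ℓ₁ ℓ₂} → Setoid a ℓ₁ → Setoid b ℓ₂ → Set (a ⊔ b ⊔ ℓ₁ ⊔ ℓ₂)
S ≺ T = Injection S T × ¬ Injection T S

record DifferentialField ℓ : Set (lsuc ℓ) where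
  field
    commutativeRing : CommutativeRing ℓ ℓ

  open CommutativeRing commutativeRing public

  field
    1≉0     : ¬ (1# ≈ 0#)
    inverse : ∀ x → ¬ (x ≈ 0#) → ∃ λ y → x * y ≈ 1#
    δ       : Carrier → Carrier
    δ-cong  : ∀ {x y} → x ≈ y → δ x ≈ δ y
    δ-+     : ∀ x y → δ (x + y) ≈ δ x + δ y
    δ-*     : ∀ x y → δ (x * y) ≈ δ x * y + x * δ y

record Embedding {ℓ} (E F : DifferentialField ℓ) : Set ℓ where
  private
    module E = DifferentialField E
    module F = DifferentialField F
  field
    ⟦_⟧                : E.Carrier → F.Carrier
    isRingMonomorphism : IsRingMonomorphism E.rawRing F.rawRing ⟦_⟧
    δ-homo             : ∀ x → ⟦ E.δ x ⟧ F.≈ F.δ ⟦ x ⟧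

record Automorphism {ℓ} (E : DifferentialField ℓ) : Set ℓ where
  open DifferentialField E
  field
    ⟦_⟧               : Carrier → Carrier
    isRingIsomorphism : IsRingIsomorphism rawRing rawRing ⟦_⟧
    δ-homo            : ∀ x → ⟦ δ x ⟧ ≈ δ ⟦ x ⟧

  open IsRingIsomorphism isRingIsomorphism public
    using (⟦⟧-cong; injective; surjective; +-homo; *-homo; 0#-homo; 1#-homo; -‿homo)

module _ {ℓ} (E : DifferentialField ℓ) where
  open DifferentialField E

  private
    idAut : Automorphism E
    idAut = record
      { ⟦_⟧               = id
      ; isRingIsomorphism = Identity.isRingIsomorphism rawRing refl
      ; δ-homo            = λ _ → refl
      }

    compAut : Automorphism E → Automorphism E → Automorphism E
    compAut σ τ = record
      { ⟦_⟧               = σ.⟦_⟧ ∘ τ.⟦_⟧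
      ; isRingIsomorphism = Compose.isRingIsomorphism trans τ.isRingIsomorphism σ.isRingIsomorphism
      ; δ-homo            = λ x → trans (σ.⟦⟧-cong (τ.δ-homo x)) (σ.δ-homo τ.⟦ x ⟧)
      }
      where
        module σ = Automorphism σ
        module τ = Automorphism τ

    module Inv (σ : Automorphism E) where
      open Automorphism σ

      inv : Carrier → Carrier
      inv y = proj₁ (surjective y)

      invʳ : ∀ y → ⟦ inv y ⟧ ≈ y
      invʳ y = proj₂ (surjective y) refl

      unique : ∀ {x y} → ⟦ x ⟧ ≈ y → inv y ≈ x
      unique {y = y} p = injective (trans (invʳ y) (sym p))

      invAut : Automorphism E
      invAut = record
        { ⟦_⟧ = inv
        ; isRingIsomorphism = record
          { isRingMonomorphism = record
            { isRingHomomorphism = record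
              { isSemiringHomomorphism = record
                { isNearSemiringHomomorphism = record
                  { +-isMonoidHomomorphism = record
                    { isMagmaHomomorphism = record
                      { isRelHomomorphism = record
                        { cong = λ {x} {y} p → unique (trans (invʳ y) (sym p)) }
                      ; homo = λ x y → unique (trans (+-homo (inv x) (inv y)) (+-cong (invʳ x) (invʳ y)))
                      }
                    ; ε-homo = unique 0#-homo
                    }
                  ; *-homo = λ x y → unique (trans (*-homo (inv x) (inv y)) (*-cong (invʳ x) (invʳ y)))
                  }
                ; 1#-homo = unique 1#-homo
                }
              ; -‿homo = λ x → unique (trans (-‿homo (inv x)) (-‿cong (invʳ x)))
              }
            ; injective = λ {x} {y} p → trans (sym (invʳ x)) (trans (⟦⟧-cong p) (invʳ y))
            }
          ; surjective = λ x → ⟦ x ⟧ , λ p → unique (sym p)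
          }
        ; δ-homo = λ x → unique (trans (δ-homo (inv x)) (δ-cong (invʳ x)))
        }

  AutFixing : Pred Carrier ℓ → Set ℓ
  AutFixing B = Σ (Automorphism E) λ σ → ∀ x → B x → Automorphism.⟦_⟧ σ x ≈ x

  autGroup : Pred Carrier ℓ → Group ℓ ℓ
  autGroup B = record
    { Carrier = AutFixing B
    ; _≈_     = λ { (σ , _) (τ , _) → ∀ x → Automorphism.⟦_⟧ σ x ≈ Automorphism.⟦_⟧ τ x }
    ; _∙_     = λ { (σ , fσ) (τ , fτ) → compAut σ τ ,
                    λ x b → trans (Automorphism.⟦⟧-cong σ (fτ x b)) (fσ x b) }
    ; ε       = idAut , λ _ _ → refl
    ; _⁻¹     = λ { (σ , fσ) → Inv.invAut σ , λ x b → Inv.unique σ (fσ x b) }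
    ; isGroup = record
      { isMonoid = record
        { isSemigroup = record
          { isMagma = record
            { isEquivalence = record
              { refl  = λ _ → refl
              ; sym   = λ p x → sym (p x)
              ; trans = λ p q x → trans (p x) (q x)
              }
            ; ∙-cong = λ { {σ , _} {σ′ , _} {τ , _} {τ′ , _} p q x →
                trans (Automorphism.⟦⟧-cong σ (q x)) (p (Automorphism.⟦_⟧ τ′ x)) }
            }
          ; assoc = λ _ _ _ _ → refl
          }
        ; identity = (λ _ _ → refl) , (λ _ _ → refl)
        }
      ; inverse = (λ { (σ , _) _ → Inv.unique σ refl }) , (λ { (σ , _) x → Inv.invʳ σ x })
      ; ⁻¹-cong = λ { {σ , _} {τ , _} p x →
          Inv.unique σ (trans (p (Inv.inv τ x)) (Inv.invʳ τ x)) }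
      }
    }

-- Terms and formulas have n free variables and parameters from P.
data RingTerm {p} (P : Set p) (n : ℕ) : Set p where
  var         : Fin n → RingTerm P n
  par         : P → RingTerm P n
  0′ 1′       : RingTerm P n
  _+′_ _*′_   : RingTerm P n → RingTerm P n → RingTerm P n
  -′_         : RingTerm P n → RingTerm P n

data QFRingFormula {p} (P : Set p) (n : ℕ) : Set p where
  _≈′_      : RingTerm P n → RingTerm P n → QFRingFormula P n
  ¬′_       : QFRingFormula P n → QFRingFormula P n
  _∧′_ _∨′_ : QFRingFormula P n → QFRingFormula P n → QFRingFormula P n

data DiffTerm {p} (P : Set p) (n : ℕ) : Set p where
  var         : Fin n → DiffTerm P n
  par         : P → DiffTerm P n
  0′ 1′       : DiffTerm P n
  _+′_ _*′_   : DiffTerm P n → DiffTerm P n → DiffTerm P n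
  -′_ δ′_     : DiffTerm P n → DiffTerm P n

data DiffFormula {p} (P : Set p) (n : ℕ) : Set p where
  _≈′_      : DiffTerm P n → DiffTerm P n → DiffFormula P n
  ¬′_       : DiffFormula P n → DiffFormula P n
  _∧′_ _∨′_ : DiffFormula P n → DiffFormula P n → DiffFormula P n
  ∃′_ ∀′_   : DiffFormula P (suc n) → DiffFormula P n

module _ {ℓ} (R : CommutativeRing ℓ ℓ) {p} {P : Set p} (ι : P → CommutativeRing.Carrier R) where
  open CommutativeRing R

  evalRing : ∀ {n} → RingTerm P n → Vector Carrier n → Carrier
  evalRing (var i)  v = v i
  evalRing (par c)  v = ι c
  evalRing 0′       v = 0#
  evalRing 1′       v = 1#
  evalRing (s +′ t) v = evalRing s v + evalRing t v
  evalRing (s *′ t) v = evalRing s v * evalRing t v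
  evalRing (-′ t)   v = - evalRing t v

  SatQF : ∀ {n} → QFRingFormula P n → Vector Carrier n → Set ℓ
  SatQF (s ≈′ t) v = evalRing s v ≈ evalRing t v
  SatQF (¬′ φ)   v = ¬ SatQF φ v
  SatQF (φ ∧′ ψ) v = SatQF φ v × SatQF ψ v
  SatQF (φ ∨′ ψ) v = SatQF φ v ⊎ SatQF ψ v

module _ {ℓ} (F : DifferentialField ℓ) {p} {P : Set p} (ι : P → DifferentialField.Carrier F) where
  open DifferentialField F

  evalDiff : ∀ {n} → DiffTerm P n → Vector Carrier n → Carrier
  evalDiff (var i)  v = v i
  evalDiff (par c)  v = ι c
  evalDiff 0′       v = 0#
  evalDiff 1′       v = 1#
  evalDiff (s +′ t) v = evalDiff s v + evalDiff t v
  evalDiff (s *′ t) v = evalDiff s v * evalDiff t v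
  evalDiff (-′ t)   v = - evalDiff t v
  evalDiff (δ′ t)   v = δ (evalDiff t v)

  Sat : ∀ {n} → DiffFormula P n → Vector Carrier n → Set ℓ
  Sat (s ≈′ t) v = evalDiff s v ≈ evalDiff t v
  Sat (¬′ φ)   v = ¬ Sat φ v
  Sat (φ ∧′ ψ) v = Sat φ v × Sat ψ v
  Sat (φ ∨′ ψ) v = Sat φ v ⊎ Sat ψ v
  Sat (∃′ φ)   v = ∃ λ x → Sat φ (x ∷ v)
  Sat (∀′ φ)   v = ∀ x → Sat φ (x ∷ v)

-- The quotient of the interpreted domain is the setoid (Dom, _∼_); the
-- field graph says that mulF induces the graph of the group law on it.

record QFInterpretation {ℓ g} (R : CommutativeRing ℓ ℓ)
                        (B : Pred (CommutativeRing.Carrier R) ℓ)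
                        (G : Group g g) : Set (ℓ ⊔ g) where
  private
    module R = CommutativeRing R
    module G = Group G

  Param : Set ℓ
  Param = Σ R.Carrier B

  field
    d    : ℕ
    1≤d  : 1 ≤ d
    domF : QFRingFormula Param d
    eqF  : QFRingFormula Param (d +ℕ d)
    mulF : QFRingFormula Param (d +ℕ (d +ℕ d))

  Dom : Set ℓ
  Dom = Σ (Vector R.Carrier d) (SatQF R proj₁ domF)

  _∼_ : Rel Dom ℓ
  (x , _) ∼ (y , _) = SatQF R proj₁ eqF (x ++ y)

  Mul : Dom → Dom → Dom → Set ℓ
  Mul (x , _) (y , _) (z , _) = SatQF R proj₁ mulF (x ++ (y ++ z))

  field
    _∙_     : Dom → Dom → Dom
    ε       : Dom
    _⁻¹     : Dom → Dom
    isGroup : IsGroup _∼_ _∙_ ε _⁻¹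
    graph   : ∀ x y z → Mul x y z ⇔ ((x ∙ y) ∼ z)

  rawGroup : RawGroup ℓ ℓ
  rawGroup = record { Carrier = Dom ; _≈_ = _∼_ ; _∙_ = _∙_ ; ε = ε ; _⁻¹ = _⁻¹ }

  field
    iso                : Dom → G.Carrier
    isGroupIsomorphism : IsGroupIsomorphism rawGroup G.rawGroup iso

module _ {ℓ} (𝒜 : DifferentialField ℓ) where
  open DifferentialField 𝒜 hiding (zero)

  private
    open AbelianGroupProperties +-abelianGroup using (identityˡ-unique)
    open RawMonoidDefs +-rawMonoid using () renaming (_×_ to _·_)

  CharZero : Set ℓ
  CharZero = ∀ n → ¬ (suc n · 1# ≈ 0#)

  record DifferentialSubfield : Set (lsuc ℓ) where
    field
      Mem         : Pred Carrier ℓ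
      resp        : Mem Respects _≈_
      0-closed    : Mem 0#
      1-closed    : Mem 1#
      +-closed    : ∀ {x y} → Mem x → Mem y → Mem (x + y)
      *-closed    : ∀ {x y} → Mem x → Mem y → Mem (x * y)
      neg-closed  : ∀ {x} → Mem x → Mem (- x)
      inv-closed  : ∀ {x y} → Mem x → x * y ≈ 1# → Mem y
      δ-closed    : ∀ {x} → Mem x → Mem (δ x)

  open DifferentialSubfield using (Mem)

  subsetSetoid : Pred Carrier ℓ → Setoid ℓ ℓ
  subsetSetoid A = record
    { Carrier       = Σ Carrier A
    ; _≈_           = λ x y → proj₁ x ≈ proj₁ y
    ; isEquivalence = record { refl = refl ; sym = sym ; trans = trans }
    }

  module _ (F : DifferentialSubfield) where
    private
      module F = DifferentialSubfield F

      subRawRing : RawRing ℓ ℓ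
      subRawRing = record
        { Carrier = Σ Carrier F.Mem
        ; _≈_     = λ x y → proj₁ x ≈ proj₁ y
        ; _+_     = λ { (x , p) (y , q) → x + y , F.+-closed p q }
        ; _*_     = λ { (x , p) (y , q) → x * y , F.*-closed p q }
        ; -_      = λ { (x , p) → - x , F.neg-closed p }
        ; 0#      = 0# , F.0-closed
        ; 1#      = 1# , F.1-closed
        }

      proj₁-mono : IsRingMonomorphism subRawRing rawRing proj₁
      proj₁-mono = record
        { isRingHomomorphism = record
          { isSemiringHomomorphism = record
            { isNearSemiringHomomorphism = record
              { +-isMonoidHomomorphism = record
                { isMagmaHomomorphism = record
                  { isRelHomomorphism = record { cong = id }
                  ; homo              = λ _ _ → refl
                  }
                ; ε-homo = refl
                }
              ; *-homo = λ _ _ → refl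
              }
            ; 1#-homo = refl
            }
          ; -‿homo = λ _ → refl
          }
        ; injective = id
        }

    toField : DifferentialField ℓ
    toField = record
      { commutativeRing = record
        { isCommutativeRing = RingMono.isCommutativeRing proj₁-mono isCommutativeRing }
      ; 1≉0     = 1≉0
      ; inverse = λ { (x , p) x≉0 → let y , xy≈1 = inverse x x≉0 in (y , F.inv-closed p xy≈1) , xy≈1 }
      ; δ       = λ { (x , p) → δ x , F.δ-closed p }
      ; δ-cong  = δ-cong
      ; δ-+     = λ { (x , _) (y , _) → δ-+ x y }
      ; δ-*     = λ { (x , _) (y , _) → δ-* x y }
      }

  full : DifferentialSubfield
  full = record
    { Mem = λ _ → ⊤ ; resp = λ _ _ → tt ; 0-closed = tt ; 1-closed = tt
    ; +-closed = λ _ _ → tt ; *-closed = λ _ _ → tt ; neg-closed = λ _ → tt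
    ; inv-closed = λ _ _ → tt ; δ-closed = λ _ → tt
    }

  private
    open SetoidReasoning setoid

    δ0≈0 : δ 0# ≈ 0#
    δ0≈0 = identityˡ-unique (δ 0#) (δ 0#)
             (trans (sym (δ-+ 0# 0#)) (δ-cong (+-identityˡ 0#)))

    δ1≈0 : δ 1# ≈ 0#
    δ1≈0 = identityˡ-unique (δ 1#) (δ 1#) (begin
      δ 1# + δ 1#            ≈⟨ +-cong (*-identityʳ (δ 1#)) (*-identityˡ (δ 1#)) ⟨
      δ 1# * 1# + 1# * δ 1#  ≈⟨ δ-* 1# 1# ⟨
      δ (1# * 1#)            ≈⟨ δ-cong (*-identityˡ 1#) ⟩
      δ 1#                   ∎)

    δ-neg : ∀ {x} → δ x ≈ 0# → δ (- x) ≈ 0#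
    δ-neg {x} p = begin
      δ (- x)        ≈⟨ +-identityʳ _ ⟨
      δ (- x) + 0#   ≈⟨ +-congˡ p ⟨
      δ (- x) + δ x  ≈⟨ δ-+ (- x) x ⟨
      δ (- x + x)    ≈⟨ δ-cong (-‿inverseˡ x) ⟩
      δ 0#           ≈⟨ δ0≈0 ⟩
      0#             ∎

    δ-*0 : ∀ {x y} → δ x ≈ 0# → δ y ≈ 0# → δ (x * y) ≈ 0#
    δ-*0 {x} {y} p q = begin
      δ (x * y)          ≈⟨ δ-* x y ⟩
      δ x * y + x * δ y  ≈⟨ +-cong (*-congʳ p) (*-congˡ q) ⟩
      0# * y + x * 0#    ≈⟨ +-cong (zeroˡ y) (zeroʳ x) ⟩
      0# + 0#            ≈⟨ +-identityˡ 0# ⟩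
      0#                 ∎

    δ-inv : ∀ {x y} → δ x ≈ 0# → x * y ≈ 1# → δ y ≈ 0#
    δ-inv {x} {y} p q = begin
      δ y                      ≈⟨ *-identityˡ (δ y) ⟨
      1# * δ y                 ≈⟨ *-congʳ (trans (*-comm y x) q) ⟨
      (y * x) * δ y            ≈⟨ *-assoc y x (δ y) ⟩
      y * (x * δ y)            ≈⟨ *-congˡ (+-identityˡ (x * δ y)) ⟨
      y * (0# + x * δ y)       ≈⟨ *-congˡ (+-congʳ (trans (*-congʳ p) (zeroˡ y))) ⟨
      y * (δ x * y + x * δ y)  ≈⟨ *-congˡ (δ-* x y) ⟨
      y * δ (x * y)            ≈⟨ *-congˡ (trans (δ-cong q) δ1≈0) ⟩
      y * 0#                   ≈⟨ zeroʳ y ⟩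
      0#                       ∎

  constants : DifferentialSubfield → DifferentialSubfield
  constants F = record
    { Mem        = λ x → F.Mem x × δ x ≈ 0#
    ; resp       = λ { p (m , q) → F.resp p m , trans (δ-cong (sym p)) q }
    ; 0-closed   = F.0-closed , δ0≈0
    ; 1-closed   = F.1-closed , δ1≈0
    ; +-closed   = λ { (m , p) (n , q) → F.+-closed m n ,
                       trans (δ-+ _ _) (trans (+-cong p q) (+-identityˡ 0#)) }
    ; *-closed   = λ { (m , p) (n , q) → F.*-closed m n , δ-*0 p q }
    ; neg-closed = λ { (m , p) → F.neg-closed m , δ-neg p }
    ; inv-closed = λ { (m , p) q → F.inv-closed m q , δ-inv p q }
    ; δ-closed   = λ { (m , p) → F.δ-closed m , trans (δ-cong p) δ0≈0 }
    }
    where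
      module F = DifferentialSubfield F

  C𝒜 : DifferentialSubfield
  C𝒜 = constants full

  data Generated (A : Pred Carrier ℓ) : Pred Carrier ℓ where
    gen  : ∀ {x} → A x → Generated A x
    resp : ∀ {x y} → x ≈ y → Generated A x → Generated A y
    nil  : Generated A 0#
    one  : Generated A 1#
    add  : ∀ {x y} → Generated A x → Generated A y → Generated A (x + y)
    mul  : ∀ {x y} → Generated A x → Generated A y → Generated A (x * y)
    neg  : ∀ {x} → Generated A x → Generated A (- x)
    inv  : ∀ {x y} → Generated A x → x * y ≈ 1# → Generated A y
    der  : ∀ {x} → Generated A x → Generated A (δ x)

  ⟨_,_⟩ : Pred Carrier ℓ → Pred Carrier ℓ → DifferentialSubfield
  ⟨ A , B ⟩ = record
    { Mem = Generated (A ∪ B) ; resp = resp ; 0-closed = nil ; 1-closed = one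
    ; +-closed = add ; *-closed = mul ; neg-closed = neg ; inv-closed = inv ; δ-closed = der
    }

  -- Polynomials in X, δX, …, δⁿ⁻¹X.  An element of DiffPoly (suc n) lists
  -- the coefficients, by increasing degree, with respect to δⁿX.
  DiffPoly : ℕ → Set ℓ
  DiffPoly zero    = Carrier
  DiffPoly (suc n) = List (DiffPoly n)

  NonZeroPoly : ∀ n → DiffPoly n → Set ℓ
  NonZeroPoly zero    a = ¬ (a ≈ 0#)
  NonZeroPoly (suc n) f = Any (NonZeroPoly n) f

  HasOrder : ∀ n → DiffPoly (suc n) → Set ℓ
  HasOrder n f = Any (NonZeroPoly n) (drop 1 f)

  δ^ : ℕ → Carrier → Carrier
  δ^ zero    x = x
  δ^ (suc n) x = δ (δ^ n x)

  evalPoly : ∀ n → DiffPoly n → Carrier → Carrier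
  evalPoly zero    a x = a
  evalPoly (suc n) f x = foldr (λ a r → evalPoly n a x + δ^ n x * r) 0# f

  -- Blum's axioms: f of order n, g nonzero of order < n, where nonzero elements of 𝒜
  -- count as polynomials of order −1; n = 0 is algebraic closedness.
  DifferentiallyClosed : Set ℓ
  DifferentiallyClosed =
    ∀ n (f : DiffPoly (suc n)) (g : DiffPoly n) → HasOrder n f → NonZeroPoly n g →
    ∃ λ x → evalPoly (suc n) f x ≈ 0# × ¬ (evalPoly n g x ≈ 0#)

  -- A type over A is a set Φ of formulas that is finitely satisfiable in 𝒜.
  Saturated : Set (lsuc ℓ)
  Saturated =
    ∀ (A : Pred Carrier ℓ) → subsetSetoid A ≺ setoid →
    ∀ n (Φ : Pred (DiffFormula (Σ Carrier A) n) ℓ) →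
    (∀ φs → All Φ φs → ∃ λ v → All (λ φ → Sat 𝒜 proj₁ φ v) φs) →
    ∃ λ v → ∀ φ → Φ φ → Sat 𝒜 proj₁ φ v

  module _ (K L : DifferentialSubfield) where

    record HomOver : Set ℓ where
      field
        embedding : Embedding (toField L) 𝒜

      open Embedding embedding public

      field
        fixes : ∀ x → Mem K (proj₁ x) → ⟦ x ⟧ ≈ proj₁ x

      Image : Pred Carrier ℓ
      Image y = ∃ λ x → ⟦ x ⟧ ≈ y

    Strong : HomOver → Set ℓ
    Strong τ =
      (∀ x → Mem (constants L) (proj₁ x) → ⟦ x ⟧ ≈ proj₁ x) ×
      Mem ⟨ Mem L , Mem C𝒜 ⟩ ≐ Mem ⟨ Image , Mem C𝒜 ⟩
      where
        open HomOver τ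

    FinitelyGenerated : Set ℓ
    FinitelyGenerated = ∃ λ n → Σ (Vector Carrier n) λ a →
      Mem L ≐ Mem ⟨ Mem K , (λ x → ∃ λ i → a i ≈ x) ⟩

    StronglyNormal : Set ℓ
    StronglyNormal = FinitelyGenerated × (∀ τ → Strong τ)

    Gal : Group ℓ ℓ
    Gal = autGroup (toField ⟨ Mem L , Mem C𝒜 ⟩) (λ x → Mem ⟨ Mem K , Mem C𝒜 ⟩ (proj₁ x))

{-# OPTIONS --safe #-}
module Submission where

-- Write C for the constants of 𝒜.  Since K-embeddings of L into 𝒜 extend generically (quantifier
-- elimination and saturation), a constant of L outside K would be moved by one of them, so strength
-- gives C_L ⊆ K.  Hence L and C are linearly disjoint over C_K: dividing a C-linear relation between
-- elements of L by one of them and differentiating shortens it.  Consequently, for c ranging over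
-- constants, a polynomial equation in c over L is equivalent to a system over C_K.
--
-- L is finitely generated as a field, L = K(b): otherwise a generator would have a conjugate x
-- differentially transcendental over L, but x lies in ⟨ L , C ⟩, so in some L(c₁, …, cₘ), where
-- x, δx, …, δᵐx are algebraically dependent over L (count monomials).
--
-- By saturation one pair of rational expressions gives, for each realisation x of the
-- quantifier-free type of b over K, constants c with x = P(b,c)/Q(b,c) and b = P′(x,c)/Q′(x,c).
-- Conversely, if these hold and x satisfies the triangular equations of b and the equations
-- expressing δb through b, then x realises the type: b and x generate the same field over ⟨ K , C ⟩,
-- and a dimension count excludes a proper specialisation.  So the set S of such c is quantifier-free
-- definable over C_K, and c ↦ (b ↦ x) maps S onto Gal(L/K); equality and composition of the
-- automorphisms are polynomial conditions on the c's over L, hence over C_K.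

-- Every isomorphism is handled through its graph, a subring of the product ring 𝒜 × 𝒜.
-- Single-valuedness and injectivity become the two inclusions between the kernels of the
-- projections on that subring, and one computation in the product evaluates a polynomial at two
-- points at once; hence the division lemmas speak of two prime ideals. The obstacle is that the
-- type of b over K contains infinitely many inequations, which cannot simply be listed in a
-- formula. The triangular conditions only make x a specialisation of b. The inequations are
-- recovered from the requirement that b be rational over x and constants, since a proper
-- specialisation would lower the transcendence degree over ⟨ K , C ⟩. Transcendence degree is
-- measured by growth: polynomials of degree at most κD in n elements span a space of dimension at
-- most (1 + κD)ⁿ. Both uses of dimension, for L = K(b) and for the genericity of x, exhibit (1 +
-- D)ⁿ⁺¹ independent elements in such a space and let D be large.

open import Defs
open import Level using (_⊔_) renaming (suc to lsuc)
open import Algebra.Bundles using (CommutativeRing; RawRing; Group; RawGroup)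
import Algebra.Construct.DirectProduct as DirectProduct
import Algebra.Definitions.RawMonoid as RawMonoidDefs
import Algebra.Morphism.GroupMonomorphism as GroupMonomorphism
open import Algebra.Morphism.Structures using (IsRingMonomorphism; IsGroupIsomorphism)
import Algebra.Properties.AbelianGroup as AbelianGroupProperties
import Algebra.Properties.CommutativeSemiring.Exp as Exp
import Algebra.Properties.Ring as RingProperties
import Algebra.Properties.Semiring.Mult as Mult
import Algebra.Solver.Ring
open import Algebra.Solver.Ring.AlmostCommutativeRing using (fromCommutativeRing; _-Raw-AlmostCommutative⟶_)
import Algebra.Solver.Ring.NaturalCoefficients.Default as NatSolver
open import Axiom.ExcludedMiddle using (ExcludedMiddle)
open import Data.Empty using (⊥)
open import Data.Fin.Base using (Fin; _↑ˡ_; _↑ʳ_) renaming (zero to fzero; suc to fsuc)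
open import Data.List.Base as List using (List; []; _∷_; _++_; length)
import Data.List.Properties as List
open import Data.List.Relation.Unary.All as All using (All; []; _∷_)
import Data.List.Relation.Unary.All.Properties as All
open import Data.List.Relation.Unary.Any as Any using (Any; here; there)
import Data.List.Relation.Unary.Any.Properties as Any
open import Data.Maybe.Base using (Maybe; just; nothing)
open import Data.Nat.Base as ℕ using (ℕ; zero; suc; _≤_; _<_; z≤n; s≤s)
import Data.Nat.Properties as ℕ
open import Data.Product.Base using (Σ; ∃; _×_; _,_; proj₁; proj₂)
open import Data.Sum.Base using (_⊎_; inj₁; inj₂; [_,_]′)
open import Data.Unit.Polymorphic using (tt)
open import Data.Vec.Functional as Vector using (Vector)
import Data.Vec.Functional.Properties as Vector
open import Function.Base using (id; _∘_; const)
open import Function.Bundles using (Injection; mk⇔)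
import Function.Construct.Composition as Composition
open import Relation.Binary.Definitions using (_Respects_)
open import Relation.Binary.PropositionalEquality as ≡ using (_≡_)
import Relation.Binary.Reasoning.Setoid as SetoidReasoning
open import Relation.Nullary.Decidable.Core using (Dec; yes; no)
open import Relation.Nullary.Negation.Core using (¬_; contradiction)
open import Relation.Unary using (Pred; _⊆_; _∪_)

-- A solver for identities in commutative rings

-- Formal differences a − b of natural numbers, kept normalised, serve as the
-- coefficients of the ring solver in an arbitrary commutative ring.
module Differences where

  norm : ℕ → ℕ → ℕ × ℕ
  norm (suc a) (suc b) = norm a b
  norm a       b       = a , b

  coefficients : RawRing _ _
  coefficients = record
    { Carrier = ℕ × ℕ ; _≈_ = _≡_
    ; _+_ = λ (a , b) (c , d) → norm (a ℕ.+ c) (b ℕ.+ d)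
    ; _*_ = λ (a , b) (c , d) → norm (a ℕ.* c ℕ.+ b ℕ.* d) (a ℕ.* d ℕ.+ b ℕ.* c)
    ; -_  = λ (a , b) → b , a
    ; 0#  = 0 , 0 ; 1# = 1 , 0
    }

module RingSolver {c ℓ} (R : CommutativeRing c ℓ) where
  open CommutativeRing R hiding (zero)
  open Differences
  open RingProperties ring using (-0#≈0#; -‿+-comm; -‿involutive; -‿distribˡ-*; -‿distribʳ-*)
  open Mult semiring using (×1-homo-*; ×-homo-+) renaming (_×_ to _·_)
  open SetoidReasoning setoid

  private
    open NatSolver commutativeSemiring using (solve; _:=_; _:+_; _:*_)

    -- The separate clause for 1, like the clause (a , 0) of `int`, makes the solver constants `:0`
    -- and `:1` compute to `0#` and `1#`, so that solved equations match goals literally.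
    nat : ℕ → Carrier
    nat 0             = 0#
    nat 1             = 1#
    nat (suc (suc n)) = 1# + nat (suc n)

    int : ℕ × ℕ → Carrier
    int (a     , 0)     = nat a
    int (0     , suc b) = - nat (suc b)
    int (suc a , suc b) = nat (suc a) + - nat (suc b)

    nat≈ : ∀ n → nat n ≈ n · 1#
    nat≈ 0             = refl
    nat≈ 1             = sym (+-identityʳ 1#)
    nat≈ (suc (suc n)) = +-congˡ (nat≈ (suc n))

    diff : ℕ → ℕ → Carrier
    diff a b = a · 1# + - (b · 1#)

    int≈ : ∀ p → int p ≈ diff (proj₁ p) (proj₂ p)
    int≈ (a , 0) = trans (nat≈ a) (sym (trans (+-congˡ -0#≈0#) (+-identityʳ _)))
    int≈ (0 , suc b) = trans (-‿cong (nat≈ (suc b))) (sym (+-identityˡ _))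
    int≈ (suc a , suc b) = +-cong (nat≈ (suc a)) (-‿cong (nat≈ (suc b)))

    diff-norm : ∀ a b → diff (proj₁ (norm a b)) (proj₂ (norm a b)) ≈ diff a b
    diff-norm zero    b       = refl
    diff-norm (suc a) zero    = refl
    diff-norm (suc a) (suc b) = begin
      _                                          ≈⟨ diff-norm a b ⟩
      a · 1# + - (b · 1#)                        ≈⟨ +-identityˡ _ ⟨
      0# + (a · 1# + - (b · 1#))                 ≈⟨ +-congʳ (-‿inverseʳ 1#) ⟨
      (1# + - 1#) + (a · 1# + - (b · 1#))        ≈⟨ solve 4 (λ x y z w → (x :+ y) :+ (z :+ w) := (x :+ z) :+ (y :+ w)) refl 1# (- 1#) (a · 1#) (- (b · 1#)) ⟩
      (1# + a · 1#) + (- 1# + - (b · 1#))        ≈⟨ +-congˡ (-‿+-comm 1# (b · 1#)) ⟩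
      diff (suc a) (suc b)                       ∎

    int-norm : ∀ a b → int (norm a b) ≈ diff a b
    int-norm a b = trans (int≈ (norm a b)) (diff-norm a b)

    morphism : coefficients -Raw-AlmostCommutative⟶ fromCommutativeRing R
    morphism = record
      { ⟦_⟧ = int
      ; +-homo = λ { p@(a , b) q@(c , d) → begin
          int (norm (a ℕ.+ c) (b ℕ.+ d))                       ≈⟨ int-norm (a ℕ.+ c) (b ℕ.+ d) ⟩
          diff (a ℕ.+ c) (b ℕ.+ d)                             ≈⟨ +-cong (×-homo-+ 1# a c) (-‿cong (×-homo-+ 1# b d)) ⟩
          (a · 1# + c · 1#) + - (b · 1# + d · 1#)              ≈⟨ +-congˡ (-‿+-comm (b · 1#) (d · 1#)) ⟨
          (a · 1# + c · 1#) + (- (b · 1#) + - (d · 1#))        ≈⟨ solve 4 (λ x y z w → (x :+ y) :+ (z :+ w) := (x :+ z) :+ (y :+ w)) refl (a · 1#) (c · 1#) (- (b · 1#)) (- (d · 1#)) ⟩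
          diff a b + diff c d                                  ≈⟨ +-cong (int≈ p) (int≈ q) ⟨
          int p + int q                                        ∎ }
      ; *-homo = λ { p@(a , b) q@(c , d) → begin
          int (norm (a ℕ.* c ℕ.+ b ℕ.* d) (a ℕ.* d ℕ.+ b ℕ.* c))
            ≈⟨ int-norm (a ℕ.* c ℕ.+ b ℕ.* d) (a ℕ.* d ℕ.+ b ℕ.* c) ⟩
          diff (a ℕ.* c ℕ.+ b ℕ.* d) (a ℕ.* d ℕ.+ b ℕ.* c)
            ≈⟨ +-cong (sum a c b d) (-‿cong (sum a d b c)) ⟩
          (⌊ a ⌋ * ⌊ c ⌋ + ⌊ b ⌋ * ⌊ d ⌋) + - (⌊ a ⌋ * ⌊ d ⌋ + ⌊ b ⌋ * ⌊ c ⌋)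
            ≈⟨ +-congˡ (-‿+-comm _ _) ⟨
          (⌊ a ⌋ * ⌊ c ⌋ + ⌊ b ⌋ * ⌊ d ⌋) + (- (⌊ a ⌋ * ⌊ d ⌋) + - (⌊ b ⌋ * ⌊ c ⌋))
            ≈⟨ +-cong (+-congˡ (sym (neg*neg ⌊ b ⌋ ⌊ d ⌋))) (+-cong (-‿distribʳ-* ⌊ a ⌋ ⌊ d ⌋) (-‿distribˡ-* ⌊ b ⌋ ⌊ c ⌋)) ⟩
          (⌊ a ⌋ * ⌊ c ⌋ + - ⌊ b ⌋ * - ⌊ d ⌋) + (⌊ a ⌋ * - ⌊ d ⌋ + - ⌊ b ⌋ * ⌊ c ⌋)
            ≈⟨ solve 4 (λ x y z w → (x :* z :+ y :* w) :+ (x :* w :+ y :* z) := (x :+ y) :* (z :+ w)) refl ⌊ a ⌋ (- ⌊ b ⌋) ⌊ c ⌋ (- ⌊ d ⌋) ⟩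
          diff a b * diff c d
            ≈⟨ *-cong (int≈ p) (int≈ q) ⟨
          int p * int q ∎ }
      ; -‿homo = λ { p@(a , b) → begin
          int (b , a)              ≈⟨ int≈ (b , a) ⟩
          ⌊ b ⌋ + - ⌊ a ⌋          ≈⟨ +-comm _ _ ⟩
          - ⌊ a ⌋ + ⌊ b ⌋          ≈⟨ +-congˡ (-‿involutive ⌊ b ⌋) ⟨
          - ⌊ a ⌋ + - - ⌊ b ⌋      ≈⟨ -‿+-comm _ _ ⟩
          - diff a b               ≈⟨ -‿cong (int≈ p) ⟨
          - int p                  ∎ }
      ; 0-homo = refl
      ; 1-homo = refl
      }
      where
        ⌊_⌋ : ℕ → Carrier
        ⌊ n ⌋ = n · 1#

        sum : ∀ a b c d → (a ℕ.* b ℕ.+ c ℕ.* d) · 1# ≈ ⌊ a ⌋ * ⌊ b ⌋ + ⌊ c ⌋ * ⌊ d ⌋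
        sum a b c d = trans (×-homo-+ 1# (a ℕ.* b) (c ℕ.* d)) (+-cong (×1-homo-* a b) (×1-homo-* c d))

        neg*neg : ∀ x y → - x * - y ≈ x * y
        neg*neg x y = trans (sym (-‿distribˡ-* x (- y)))
          (trans (-‿cong (sym (-‿distribʳ-* x y))) (-‿involutive _))

    _coeff≟_ : ∀ p q → Maybe (int p ≈ int q)
    (a , b) coeff≟ (c , d) with a ℕ.≟ c | b ℕ.≟ d
    ... | yes ≡.refl | yes ≡.refl = just refl
    ... | _          | _          = nothing

  open Algebra.Solver.Ring coefficients (fromCommutativeRing R) morphism _coeff≟_ public
    using (Polynomial; solve; _:=_; _:+_; _:*_; _:-_; :-_; con)

  :0 :1 : ∀ {n} → Polynomial n
  :0 = con (0 , 0)
  :1 = con (1 , 0)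

-- Polynomial expressions in one element over a subring, and division modulo prime ideals

module SubringTheory {ℓ} (R : CommutativeRing ℓ ℓ) where
  open CommutativeRing R hiding (zero)
  open RingSolver R
  open Exp commutativeSemiring using (_^_; ^-homo-*)

  record IsSubmonoid (A : Pred Carrier ℓ) : Set ℓ where
    field
      respects : A Respects _≈_
      0∈   : A 0#
      +∈   : ∀ {x y} → A x → A y → A (x + y)

  record IsSubring (A : Pred Carrier ℓ) : Set ℓ where
    field
      respects : A Respects _≈_
      0∈   : A 0#
      1∈   : A 1#
      +∈   : ∀ {x y} → A x → A y → A (x + y)
      *∈   : ∀ {x y} → A x → A y → A (x * y)
      neg∈ : ∀ {x} → A x → A (- x)

    isSubmonoid : IsSubmonoid A
    isSubmonoid = record { respects = respects ; 0∈ = 0∈ ; +∈ = +∈ }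

    ^∈ : ∀ {x} n → A x → A (x ^ n)
    ^∈ zero    a = 1∈
    ^∈ (suc n) a = *∈ a (^∈ n a)

  -- In the applications the ring is 𝒜 × 𝒜 and the ideals are the kernels of its two projections.
  record IsPrimeIdeal (Z : Pred Carrier ℓ) : Set ℓ where
    field
      respects  : Z Respects _≈_
      0∈    : Z 0#
      +∈    : ∀ {x y} → Z x → Z y → Z (x + y)
      *∈ʳ   : ∀ {x} y → Z x → Z (x * y)
      prime : ∀ {x y} → Z (x * y) → Z x ⊎ Z y

    *∈ˡ : ∀ x {y} → Z y → Z (x * y)
    *∈ˡ x z = respects (*-comm _ _) (*∈ʳ x z)

    neg∈ : ∀ {x} → Z x → Z (- x)
    neg∈ {x} z = respects (solve 1 (λ x → x :* (:- :1) := :- x) refl x) (*∈ʳ (- 1#) z)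

    ∉-* : ∀ {x y} → ¬ Z x → ¬ Z y → ¬ Z (x * y)
    ∉-* p q z = [ p , q ]′ (prime z)

    cancelʳ : ∀ {x y} → Z (x + y) → Z y → Z x
    cancelʳ {x} {y} p q = respects (solve 2 (λ x y → x :+ y :+ (:- y) := x) refl x y) (+∈ p (neg∈ q))

  -- A + A u + … + A uᵏ⁻¹
  Deg : Pred Carrier ℓ → Carrier → ℕ → Pred Carrier ℓ
  Deg A u zero    v = v ≈ 0#
  Deg A u (suc k) v = ∃ λ a → ∃ λ w → A a × Deg A u k w × v ≈ a + u * w

  _[_] : Pred Carrier ℓ → Carrier → Pred Carrier ℓ
  (A [ u ]) v = ∃ λ k → Deg A u k v

  deg-resp : ∀ {A u} k → Deg A u k Respects _≈_
  deg-resp zero    p q               = trans (sym p) q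
  deg-resp (suc k) p (a , w , x , y , q) = a , w , x , y , trans (sym p) q

  deg-scale : ∀ {A A′ : Pred Carrier ℓ} {u} s → (∀ {a} → A a → A′ (s * a)) →
              ∀ k {v} → Deg A u k v → Deg A′ u k (s * v)
  deg-scale s f zero    p = trans (*-congˡ p) (zeroʳ s)
  deg-scale {u = u} s f (suc k) (a , w , x , y , q) = s * a , s * w , f x , deg-scale s f k y ,
    trans (*-congˡ q) (solve 4 (λ s a u w → s :* (a :+ u :* w) := s :* a :+ u :* (s :* w)) refl s a u w)

  deg-⊆ : ∀ {A A′ : Pred Carrier ℓ} {u} → A ⊆ A′ → ∀ k {v} → Deg A u k v → Deg A′ u k v
  deg-⊆ f zero    p                   = p
  deg-⊆ f (suc k) (a , w , x , y , q) = a , w , f x , deg-⊆ f k y , q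

  module DegProperties {A : Pred Carrier ℓ} (A-sub : IsSubmonoid A) (u : Carrier) where
    open IsSubmonoid A-sub

    deg-0 : ∀ k → Deg A u k 0#
    deg-0 zero    = refl
    deg-0 (suc k) = 0# , 0# , 0∈ , deg-0 k , solve 1 (λ u → :0 := :0 :+ u :* :0) refl u

    deg-+ : ∀ k {v w} → Deg A u k v → Deg A u k w → Deg A u k (v + w)
    deg-+ zero    p q = trans (+-cong p q) (+-identityˡ 0#)
    deg-+ (suc k) (a , v , x , y , p) (b , w , x′ , y′ , q) = a + b , v + w , +∈ x x′ , deg-+ k y y′ ,
      trans (+-cong p q) (solve 5 (λ a b u v w → a :+ u :* v :+ (b :+ u :* w) := a :+ b :+ u :* (v :+ w)) refl a b u v w)

    deg-shift : ∀ k {v} → Deg A u k v → Deg A u (suc k) (u * v)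
    deg-shift k {v} p = 0# , v , 0∈ , p , sym (+-identityˡ _)

    deg-suc : ∀ k {v} → Deg A u k v → Deg A u (suc k) v
    deg-suc zero    p                   = deg-resp 1 (sym p) (deg-0 1)
    deg-suc (suc k) (a , w , x , y , q) = a , w , x , deg-suc k y , q

    deg-≤ : ∀ {j k v} → j ≤ k → Deg A u j v → Deg A u k v
    deg-≤ {k = k} z≤n p = deg-resp k (sym p) (deg-0 k)
    deg-≤ (s≤s j≤k) (a , w , x , y , q) = a , w , x , deg-≤ j≤k y , q

    deg-const : ∀ k {a} → A a → Deg A u (suc k) a
    deg-const k {a} x = a , 0# , x , deg-0 k , solve 2 (λ a u → a := a :+ u :* :0) refl a u

    deg-pow : ∀ j k {v} → Deg A u k v → Deg A u (j ℕ.+ k) (u ^ j * v)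
    deg-pow zero    k p = deg-resp k (sym (*-identityˡ _)) p
    deg-pow (suc j) k p = deg-resp (suc j ℕ.+ k) (sym (*-assoc u (u ^ j) _)) (deg-shift (j ℕ.+ k) (deg-pow j k p))

    deg-snoc : ∀ k {w a} → Deg A u k w → A a → Deg A u (suc k) (w + a * u ^ k)
    deg-snoc zero {w} {a} p x = a , 0# , x , refl ,
      trans (+-congʳ p) (solve 2 (λ a u → :0 :+ a :* :1 := a :+ u :* :0) refl a u)
    deg-snoc (suc k) {w} {a} (b , v , x , y , p) z = b , v + a * u ^ k , x , deg-snoc k y z ,
      trans (+-congʳ p) (solve 5 (λ b u v a t → b :+ u :* v :+ a :* (u :* t) := b :+ u :* (v :+ a :* t)) refl b u v a (u ^ k))

    deg-unsnoc : ∀ k {v} → Deg A u (suc k) v → ∃ λ w → ∃ λ a → Deg A u k w × A a × v ≈ w + a * u ^ k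
    deg-unsnoc zero (a , w , x , y , p) = 0# , a , refl , x ,
      trans p (trans (+-congˡ (*-congˡ y)) (solve 2 (λ a u → a :+ u :* :0 := :0 :+ a :* :1) refl a u))
    deg-unsnoc (suc k) (a , w , x , y , p) with w′ , b , y′ , x′ , q ← deg-unsnoc k y =
      a + u * w′ , b , (a , w′ , x , y′ , refl) , x′ ,
      trans p (trans (+-congˡ (*-congˡ q))
        (solve 5 (λ a u w b t → a :+ u :* (w :+ b :* t) := a :+ u :* w :+ b :* (u :* t)) refl a u w′ b (u ^ k)))

  -- Sums of k and of k′ + 1 terms multiply to a sum of k + k′ terms. The three coefficient sets
  -- differ because coefficients may themselves be polynomials of bounded degree, and then the
  -- product has a larger bound.
  deg-* : ∀ {A A′ A″ : Pred Carrier ℓ} {u} → IsSubmonoid A″ → (∀ {x y} → A x → A′ y → A″ (x * y)) →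
          ∀ k k′ {v w} → Deg A u k v → Deg A′ u (suc k′) w → Deg A″ u (k ℕ.+ k′) (v * w)
  deg-* {u = u} sub f zero k′ p q = deg-resp k′ (sym (trans (*-congʳ p) (zeroˡ _))) (DegProperties.deg-0 sub u k′)
  deg-* {u = u} sub f (suc k) k′ {v} {w} (a , v′ , x , y , p) q =
    deg-resp (suc (k ℕ.+ k′)) (trans (solve 4 (λ a w u v → a :* w :+ u :* (v :* w) := (a :+ u :* v) :* w) refl a w u v′) (*-congʳ (sym p)))
      (deg-+ (suc (k ℕ.+ k′)) (deg-≤ (s≤s (ℕ.m≤n+m k′ k)) (deg-scale a (f x) (suc k′) q))
             (deg-shift (k ℕ.+ k′) (deg-* sub f k k′ y q)))
    where open DegProperties sub u

  module _ {A : Pred Carrier ℓ} (A-sub : IsSubring A) (u : Carrier) where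
    open IsSubring A-sub
    open DegProperties isSubmonoid u

    [u]-isSubring : IsSubring (A [ u ])
    [u]-isSubring = record
      { respects = λ p (k , q) → k , deg-resp k p q
      ; 0∈   = 0 , refl
      ; 1∈   = 1 , deg-const 0 1∈
      ; +∈   = λ (j , p) (k , q) → j ℕ.+ k ,
                 deg-+ (j ℕ.+ k) (deg-≤ (ℕ.m≤m+n j k) p) (deg-≤ (ℕ.m≤n+m k j) q)
      ; *∈   = λ (j , p) (k , q) → j ℕ.+ k , deg-* isSubmonoid *∈ j k p (deg-suc k q)
      ; neg∈ = λ {x} (k , p) → k , deg-resp k (solve 1 (λ x → (:- :1) :* x := :- x) refl x)
                                     (deg-scale (- 1#) (*∈ (neg∈ 1∈)) k p)
      }

    A⊆A[u] : A ⊆ A [ u ]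
    A⊆A[u] p = 1 , deg-const 0 p

    u∈A[u] : (A [ u ]) u
    u∈A[u] = 2 , deg-resp 2 (*-identityʳ u) (deg-shift 1 (deg-const 0 1∈))

    -- If l uᵈ + g vanishes, every element of A[u] reduces, after multiplication
    -- by powers of l, to one of degree < d.
    module _ {Z₁ Z₂ : Pred Carrier ℓ} (P₁ : IsPrimeIdeal Z₁) (P₂ : IsPrimeIdeal Z₂) where
      private
        module P₁ = IsPrimeIdeal P₁
        module P₂ = IsPrimeIdeal P₂

      vanishing-reduces : ∀ d {l g} → (∀ {v} → Deg A u d v → Z₁ v → Z₂ v) →
                          A l → ¬ Z₂ l → Deg A u d g → Z₁ (g + l * u ^ d) → Z₂ (g + l * u ^ d) →
                          ∀ {v} → (A [ u ]) v → Z₁ v → Z₂ v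
      vanishing-reduces d {l} {g} small l∈ l∉ g∈ z₁ z₂ (k , p) = go k (deg-≤ (ℕ.m≤m+n k d) p)
        where
          go : ∀ j {v} → Deg A u (j ℕ.+ d) v → Z₁ v → Z₂ v
          go zero    p z = small p z
          go (suc j) {v} p z with w , a , w∈ , a∈ , q ← deg-unsnoc (j ℕ.+ d) p =
            [ (λ l∈Z → contradiction l∈Z l∉) , id ]′ (P₂.prime (P₂.respects eq
              (P₂.+∈ (go j rem∈ (P₁.respects (sym rem≈) (P₁.+∈ (P₁.*∈ˡ l z) (P₁.neg∈ (P₁.*∈ˡ (a * u ^ j) z₁)))))
                     (P₂.*∈ˡ (a * u ^ j) z₂))))
            where
              -- This is l v - a uʲ (g + l uᵈ): the leading terms l a uʲ⁺ᵈ cancel, so the degree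
              -- drops.
              rem : Carrier
              rem = l * w + (- a) * (u ^ j * g)
              rem∈ : Deg A u (j ℕ.+ d) rem
              rem∈ = deg-+ (j ℕ.+ d) (deg-scale l (*∈ l∈) (j ℕ.+ d) w∈)
                       (deg-scale (- a) (*∈ (neg∈ a∈)) (j ℕ.+ d) (deg-pow j d g∈))
              rem≈ : rem ≈ l * v + - (a * u ^ j * (g + l * u ^ d))
              rem≈ = sym (trans (+-congʳ (*-congˡ (trans q (+-congˡ (*-congˡ (^-homo-* u j d))))))
                (solve 6 (λ l w a s t g → l :* (w :+ a :* (s :* t)) :+ (:- (a :* s :* (g :+ l :* t)))
                   := l :* w :+ (:- a) :* (s :* g)) refl l w a (u ^ j) (u ^ d) g))
              eq : rem + a * u ^ j * (g + l * u ^ d) ≈ l * v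
              eq = trans (+-congʳ rem≈) (solve 2 (λ x y → x :+ (:- y) :+ y := x) refl (l * v) _)

    module _ {Z : Pred Carrier ℓ} (P : IsPrimeIdeal Z) where
      private
        module P = IsPrimeIdeal P

      -- The leading coefficient p need not be invertible, so each step multiplies by p; the
      -- multiplier s is a power of p and stays outside Z by primality.
      pseudo-division : ∀ k {w p} → Deg A u k w → A p → ¬ Z p → ∀ j {f} → Deg A u (j ℕ.+ k) f →
        ∃ λ s → ∃ λ q → ∃ λ r → A s × ¬ Z s × Deg A u j q × Deg A u k r × s * f ≈ q * (w + p * u ^ k) + r
      pseudo-division k {w} {p} w∈ p∈ p∉ zero {f} f∈ =
        p , 0# , p * f , p∈ , p∉ , refl , deg-scale p (*∈ p∈) k f∈ ,
        solve 2 (λ x y → x := :0 :* y :+ x) refl (p * f) _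
      pseudo-division k {w} {p} w∈ p∈ p∉ (suc j) {f} f∈
        with f′ , a , f′∈ , a∈ , e ← deg-unsnoc (j ℕ.+ k) f∈
        with s , q , r , s∈ , s∉ , q∈ , r∈ , e′ ← pseudo-division k w∈ p∈ p∉ j {p * f′ + (- a) * (u ^ j * w)}
               (deg-+ (j ℕ.+ k) (deg-scale p (*∈ p∈) (j ℕ.+ k) f′∈)
                 (deg-scale (- a) (*∈ (neg∈ a∈)) (j ℕ.+ k) (deg-pow j k w∈))) =
        s * p , q + (s * a) * u ^ j , r , *∈ s∈ p∈ , P.∉-* s∉ p∉ ,
        deg-snoc j q∈ (*∈ s∈ a∈) , r∈ , (begin
          s * p * f
            ≈⟨ *-congˡ (trans e (+-congˡ (*-congˡ (^-homo-* u j k)))) ⟩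
          s * p * (f′ + a * (u ^ j * u ^ k))
            ≈⟨ solve 7 (λ s p f a x y w → s :* p :* (f :+ a :* (x :* y)) :=
                 s :* (p :* f :+ (:- a) :* (x :* w)) :+ s :* a :* x :* (w :+ p :* y)) refl s p f′ a (u ^ j) (u ^ k) w ⟩
          s * (p * f′ + (- a) * (u ^ j * w)) + s * a * u ^ j * (w + p * u ^ k)
            ≈⟨ +-congʳ e′ ⟩
          q * (w + p * u ^ k) + r + s * a * u ^ j * (w + p * u ^ k)
            ≈⟨ solve 4 (λ q v r t → q :* v :+ r :+ t :* v := (q :+ t) :* v :+ r) refl q (w + p * u ^ k) r (s * a * u ^ j) ⟩
          (q + s * a * u ^ j) * (w + p * u ^ k) + r ∎)
        where open SetoidReasoning setoid

    -- No nontrivial relation of degree below d holds for u modulo Z. That one of degree d exists is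
    -- left to the user of the notion, so that elements transcendental modulo Z are covered as well.
    Minimal : Pred Carrier ℓ → ℕ → Set ℓ
    Minimal Z d = ∀ j {w t} → j < d → Deg A u j w → A t → Z (w + t * u ^ j) → Z t

    -- Minimality puts the leading coefficient in Z₁, so it can be stripped off and the argument
    -- repeated: all coefficients lie in Z₁, hence in Z₂.
    minimal-small : ∀ {Z₁ Z₂} → IsPrimeIdeal Z₁ → IsPrimeIdeal Z₂ → (∀ {v} → A v → Z₁ v → Z₂ v) →
                    ∀ d → Minimal Z₁ d → ∀ {v} → Deg A u d v → Z₁ v → Z₂ v
    minimal-small P₁ P₂ A⇒ zero    min p z = IsPrimeIdeal.respects P₂ (sym p) (IsPrimeIdeal.0∈ P₂)
    minimal-small P₁ P₂ A⇒ (suc d) min p z with w , a , w∈ , a∈ , q ← deg-unsnoc d p =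
      let z′ = P₁.respects q z
          za = min d ℕ.≤-refl w∈ a∈ z′
      in P₂.respects (sym q) (P₂.+∈
           (minimal-small P₁ P₂ A⇒ d (λ j j<d → min j (ℕ.m<n⇒m<1+n j<d)) w∈ (P₁.cancelʳ z′ (P₁.*∈ʳ _ za)))
           (P₂.*∈ʳ _ (A⇒ a∈ za)))
      where
        module P₁ = IsPrimeIdeal P₁
        module P₂ = IsPrimeIdeal P₂

    module _ {Z₁ Z₂ : Pred Carrier ℓ} (P₁ : IsPrimeIdeal Z₁) (P₂ : IsPrimeIdeal Z₂)
             (stable : ∀ {t} → ¬ ¬ Z₂ t → Z₂ t)
             (A⇒ : ∀ {v} → A v → Z₁ v → Z₂ v) (A⇐ : ∀ {v} → A v → Z₂ v → Z₁ v)
             (d : ℕ) (min₁ : Minimal Z₁ d) {l g : Carrier}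
             (l∈ : A l) (l∉ : ¬ Z₁ l) (g∈ : Deg A u d g)
             (root₁ : Z₁ (g + l * u ^ d)) (root₂ : Z₂ (g + l * u ^ d)) where
      private
        module P₁ = IsPrimeIdeal P₁
        module P₂ = IsPrimeIdeal P₂

      -- A polynomial of lower degree vanishing at u modulo Z₂ would give a
      -- factorisation modulo Z₁ of the minimal polynomial.
      minimal-transfer : ∀ n → n ≤ d → Minimal Z₂ n
      minimal-transfer zero    n≤d j ()
      minimal-transfer (suc n) n<d j {w} {t} j<1+n w∈ t∈ z with ℕ.m<1+n⇒m<n∨m≡n j<1+n
      ... | inj₁ j<n = minimal-transfer n (ℕ.<⇒≤ n<d) j j<n w∈ t∈ z
      -- Here the relation is t itself. The case is separate because the cofactor below must have
      -- degree i < d, which needs n ≥ 1.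
      minimal-transfer (suc zero) n<d j {w} {t} j<1+n w∈ t∈ z | inj₂ ≡.refl =
        P₂.respects (trans (+-cong w∈ (*-identityʳ t)) (+-identityˡ t)) z
      minimal-transfer (suc n@(suc _)) n<d _ {w} {t} j<1+n w∈ t∈ z | inj₂ ≡.refl = stable λ t∉₂ →
        let t∉₁ = λ z₁ → t∉₂ (A⇒ t∈ z₁)
            i , d≡ = ℕ.m≤n⇒∃[o]m+o≡n (ℕ.<⇒≤ n<d)
            d≡′ = ≡.trans (ℕ.+-comm i n) d≡
            i<d : i < d
            i<d = ≡.subst (i <_) d≡′ (ℕ.m<m+n i (s≤s z≤n))
            -- t (g + l uᵈ) = h + l uⁱ (w + t uⁿ) with h of degree below d. Dividing h instead of
            -- the whole polynomial keeps the leading coefficient s l of the final quotient `q₁` in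
            -- sight.
            h  = t * g + (- l) * (u ^ i * w)
            h∈ = deg-+ d (deg-scale t (*∈ t∈) d g∈)
                   (deg-scale (- l) (*∈ (neg∈ l∈)) d (≡.subst (λ e → Deg A u e (u ^ i * w)) d≡′ (deg-pow i n w∈)))
            s , q , r , s∈ , s∉ , q∈ , r∈ , e = pseudo-division P₁ n w∈ t∈ t∉₁ i
                   (≡.subst (λ e → Deg A u e h) (≡.sym d≡′) h∈)
            v  = w + t * u ^ n
            q₁ = q + (s * l) * u ^ i
            e₁ : s * t * (g + l * u ^ d) ≈ q₁ * v + r
            e₁ = let open SetoidReasoning setoid in begin
              s * t * (g + l * u ^ d)
                ≈⟨ *-congˡ (+-congˡ (*-congˡ (trans (reflexive (≡.cong (u ^_) (≡.sym d≡′))) (^-homo-* u i n)))) ⟩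
              s * t * (g + l * (u ^ i * u ^ n))
                ≈⟨ solve 7 (λ s t g l x y w → s :* t :* (g :+ l :* (x :* y)) :=
                      s :* (t :* g :+ (:- l) :* (x :* w)) :+ s :* l :* x :* (w :+ t :* y))
                      refl s t g l (u ^ i) (u ^ n) w ⟩
              s * h + s * l * u ^ i * v
                ≈⟨ +-congʳ e ⟩
              q * v + r + s * l * u ^ i * v
                ≈⟨ solve 4 (λ q v r t → q :* v :+ r :+ t :* v := (q :+ t) :* v :+ r) refl q v r (s * l * u ^ i) ⟩
              q₁ * v + r ∎
            -- Modulo Z₂ the polynomial and v vanish, hence so does the remainder. Its degree is
            -- below n, so by induction it vanishes modulo Z₁, and then q₁ v vanishes there,
            -- although both factors have degree below d and leading coefficients outside Z₁.
            r₂ = P₂.cancelʳ (P₂.respects (trans e₁ (+-comm _ _)) (P₂.*∈ˡ (s * t) root₂)) (P₂.*∈ˡ q₁ z)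
            r₁ = minimal-small P₂ P₁ A⇐ n (minimal-transfer n (ℕ.<⇒≤ n<d)) r∈ r₂
            qv = P₁.cancelʳ (P₁.respects e₁ (P₁.*∈ˡ (s * t) root₁)) r₁
        in [ (λ zq → P₁.∉-* s∉ l∉ (min₁ i i<d q∈ (*∈ s∈ l∈) zq))
           , (λ zv → t∉₁ (min₁ n n<d w∈ t∈ zv)) ]′ (P₁.prime qv)

      vanishing⇒ : ∀ {v} → (A [ u ]) v → Z₁ v → Z₂ v
      vanishing⇒ = vanishing-reduces P₁ P₂ d (minimal-small P₁ P₂ A⇒ d min₁) l∈ (l∉ ∘ A⇐ l∈) g∈ root₁ root₂

      vanishing⇐ : ∀ {v} → (A [ u ]) v → Z₂ v → Z₁ v
      vanishing⇐ = vanishing-reduces P₂ P₁ d (minimal-small P₂ P₁ A⇐ d (minimal-transfer d ℕ.≤-refl)) l∈ l∉ g∈ root₂ root₁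

-- Derivations on rings, separants and fractions

record DifferentialRing ℓ : Set (lsuc ℓ) where
  field
    commutativeRing : CommutativeRing ℓ ℓ
  open CommutativeRing commutativeRing public
  field
    δ       : Carrier → Carrier
    δ-cong  : ∀ {x y} → x ≈ y → δ x ≈ δ y
    δ-+     : ∀ x y → δ (x + y) ≈ δ x + δ y
    δ-*     : ∀ x y → δ (x * y) ≈ δ x * y + x * δ y

  δ-0 : δ 0# ≈ 0#
  δ-0 = AbelianGroupProperties.identityˡ-unique +-abelianGroup (δ 0#) (δ 0#)
          (trans (sym (δ-+ 0# 0#)) (δ-cong (+-identityˡ 0#)))

  δ-neg : ∀ x → δ (- x) ≈ - δ x
  δ-neg x = AbelianGroupProperties.inverseˡ-unique +-abelianGroup (δ (- x)) (δ x)
              (trans (sym (δ-+ (- x) x)) (trans (δ-cong (-‿inverseˡ x)) δ-0))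

module DifferentialRingTheory {ℓ} (D : DifferentialRing ℓ) where
  open DifferentialRing D hiding (zero)
  open RingSolver commutativeRing
  open SubringTheory commutativeRing
  open Exp commutativeSemiring using (_^_)
  open RawMonoidDefs +-rawMonoid using () renaming (_×_ to _·_)
  open SetoidReasoning setoid

  δ-pow : ∀ u d → δ (u ^ suc d) ≈ (suc d · 1#) * u ^ d * δ u
  δ-pow u zero = trans (δ-cong (*-identityʳ u)) (solve 1 (λ x → x := (:1 :+ :0) :* :1 :* x) refl (δ u))
  δ-pow u (suc d) = begin
    δ (u * u ^ suc d)                                  ≈⟨ δ-* u (u ^ suc d) ⟩
    δ u * u ^ suc d + u * δ (u ^ suc d)                ≈⟨ +-congˡ (*-congˡ (δ-pow u d)) ⟩
    δ u * (u * u ^ d) + u * ((suc d · 1#) * u ^ d * δ u)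
      ≈⟨ solve 4 (λ e u p n → e :* (u :* p) :+ u :* (n :* p :* e) := (:1 :+ n) :* (u :* p) :* e) refl (δ u) u (u ^ d) (suc d · 1#) ⟩
    (suc (suc d) · 1#) * u ^ suc d * δ u               ∎

  module Derivative {A M : Pred Carrier ℓ} (A-sub : IsSubring A) (M-sub : IsSubring M) (u : Carrier)
                    (u∈M : M u) (δA⊆M : ∀ {a} → A a → M (δ a)) where
    private
      module A = IsSubring A-sub
      module M = IsSubring M-sub
    open DegProperties A.isSubmonoid u

    -- The multiplier s is the value of the formal derivative, hence of one degree less; e comes
    -- from differentiating the coefficients.
    δ-deg : ∀ k {v} → Deg A u k v → ∃ λ s → ∃ λ e → Deg A u (ℕ.pred k) s × M e × δ v ≈ s * δ u + e
    δ-deg zero p = 0# , 0# , refl , M.0∈ , trans (trans (δ-cong p) δ-0) (solve 1 (λ x → :0 := :0 :* x :+ :0) refl (δ u))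
    δ-deg (suc k) {v} (a , w , a∈ , w∈ , p) with s , e , s∈ , e∈ , q ← δ-deg k w∈ =
      w + u * s , δ a + u * e , deg-+ k w∈ (shift k w∈ s∈) , M.+∈ (δA⊆M a∈) (M.*∈ u∈M e∈) , (begin
        δ v                                        ≈⟨ δ-cong p ⟩
        δ (a + u * w)                              ≈⟨ trans (δ-+ a _) (+-congˡ (δ-* u w)) ⟩
        δ a + (δ u * w + u * δ w)                  ≈⟨ +-congˡ (+-congˡ (*-congˡ q)) ⟩
        δ a + (δ u * w + u * (s * δ u + e))
          ≈⟨ solve 6 (λ x y w u s e → x :+ (y :* w :+ u :* (s :* y :+ e)) := (w :+ u :* s) :* y :+ (x :+ u :* e)) refl (δ a) (δ u) w u s e ⟩
        (w + u * s) * δ u + (δ a + u * e)          ∎)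
      where
        shift : ∀ k {w s} → Deg A u k w → Deg A u (ℕ.pred k) s → Deg A u k (u * s)
        shift zero    p q = trans (*-congˡ q) (zeroʳ u)
        shift (suc k) p q = deg-shift k q

    δ-[u] : A ⊆ M → M (δ u) → ∀ {v} → (A [ u ]) v → M (δ v)
    δ-[u] A⊆M δu∈M (k , p) with s , e , s∈ , e∈ , q ← δ-deg k p =
      M.respects (sym q) (M.+∈ (M.*∈ (deg∈ (ℕ.pred k) s∈) δu∈M) e∈)
      where
        deg∈ : ∀ k {v} → Deg A u k v → M v
        deg∈ zero    p                   = M.respects (sym p) M.0∈
        deg∈ (suc k) (a , w , x , y , p) = M.respects (sym p) (M.+∈ (A⊆M x) (M.*∈ u∈M (deg∈ k y)))

    -- s is the separant of the polynomial g + l uᵈ⁺¹.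
    separant : ∀ d {g l} → Deg A u (suc d) g → A l → ∃ λ s₀ → ∃ λ e → Deg A u d s₀ × M e ×
               δ (g + l * u ^ suc d) ≈ (s₀ + ((suc d · 1#) * l) * u ^ d) * δ u + e
    separant d {g} {l} g∈ l∈ = s₀ , e + δ l * u ^ suc d , s₀∈ , M.+∈ e∈ (M.*∈ (δA⊆M l∈) (M.^∈ (suc d) u∈M)) , eq
      where
        dg  = δ-deg (suc d) g∈
        s₀  = proj₁ dg
        e   = proj₁ (proj₂ dg)
        s₀∈ = proj₁ (proj₂ (proj₂ dg))
        e∈  = proj₁ (proj₂ (proj₂ (proj₂ dg)))
        eq₁ : δ (l * u ^ suc d) ≈ δ l * u ^ suc d + l * ((suc d · 1#) * u ^ d * δ u)
        eq₁ = trans (δ-* l (u ^ suc d)) (+-congˡ {δ l * u ^ suc d} (*-congˡ {l} (δ-pow u d)))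
        collect : ∀ s y e x l n p → s * y + e + (x + l * (n * p * y)) ≈ (s + (n * l) * p) * y + (e + x)
        collect = solve 7 (λ s y e x l n p → s :* y :+ e :+ (x :+ l :* (n :* p :* y)) := (s :+ (n :* l) :* p) :* y :+ (e :+ x)) refl
        eq : δ (g + l * u ^ suc d) ≈ (s₀ + ((suc d · 1#) * l) * u ^ d) * δ u + (e + δ l * u ^ suc d)
        eq = trans (δ-+ g (l * u ^ suc d)) (trans (+-cong (proj₂ (proj₂ (proj₂ (proj₂ dg)))) eq₁)
               (collect s₀ (δ u) e (δ l * u ^ suc d) l (suc d · 1#) (u ^ d)))

  -- In a field the denominators are the nonzero elements, in 𝒜 × 𝒜 the pairs with both components
  -- nonzero. Fractions are elements of the ambient ring, not of a formal localisation.
  record IsDenominatorSet (N : Pred Carrier ℓ) : Set ℓ where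
    field
      respects : N Respects _≈_
      1∈   : N 1#
      *∈   : ∀ {x y} → N x → N y → N (x * y)

  module Fractions {N : Pred Carrier ℓ} (N-den : IsDenominatorSet N) where
    private
      module N = IsDenominatorSet N-den

    Fr : Pred Carrier ℓ → Pred Carrier ℓ
    Fr A v = ∃ λ r → ∃ λ w → A r × A w × N w × v * w ≈ r

    DivisionClosed : Pred Carrier ℓ → Set ℓ
    DivisionClosed M = ∀ {z w r} → M r → M w → N w → z * w ≈ r → M z

    Fr⊆ : ∀ {A M : Pred Carrier ℓ} → A ⊆ M → DivisionClosed M → Fr A ⊆ M
    Fr⊆ f div (r , w , r∈ , w∈ , n , p) = div (f r∈) (f w∈) n p

    module _ {A : Pred Carrier ℓ} (A-sub : IsSubring A) where
      private
        module A = IsSubring A-sub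

      ⊆Fr : A ⊆ Fr A
      ⊆Fr {v} p = v , 1# , p , A.1∈ , N.1∈ , *-identityʳ v

      Fr-isSubring : IsSubring (Fr A)
      Fr-isSubring = record
        { respects = λ p (r , w , r∈ , w∈ , n , q) → r , w , r∈ , w∈ , n , trans (*-congʳ (sym p)) q
        ; 0∈ = ⊆Fr A.0∈
        ; 1∈ = ⊆Fr A.1∈
        ; +∈ = λ {x} {y} (r , w , r∈ , w∈ , n , q) (r′ , w′ , r′∈ , w′∈ , n′ , q′) →
            r * w′ + r′ * w , w * w′ , A.+∈ (A.*∈ r∈ w′∈) (A.*∈ r′∈ w∈) , A.*∈ w∈ w′∈ , N.*∈ n n′ ,
            trans (solve 4 (λ x y w z → (x :+ y) :* (w :* z) := x :* w :* z :+ y :* z :* w) refl x y w w′)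
                  (+-cong (*-congʳ q) (*-congʳ q′))
        ; *∈ = λ {x} {y} (r , w , r∈ , w∈ , n , q) (r′ , w′ , r′∈ , w′∈ , n′ , q′) →
            r * r′ , w * w′ , A.*∈ r∈ r′∈ , A.*∈ w∈ w′∈ , N.*∈ n n′ ,
            trans (solve 4 (λ x y w z → (x :* y) :* (w :* z) := (x :* w) :* (y :* z)) refl x y w w′)
                  (*-cong q q′)
        ; neg∈ = λ {x} (r , w , r∈ , w∈ , n , q) → - r , w , A.neg∈ r∈ , w∈ , n ,
            trans (solve 2 (λ x w → (:- x) :* w := :- (x :* w)) refl x w) (-‿cong q)
        }

      Fr-div : DivisionClosed (Fr A)
      Fr-div {z} {w} {r} (r₁ , r₂ , r₁∈ , r₂∈ , n , p) (w₁ , w₂ , w₁∈ , w₂∈ , n′ , q) nw e =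
        r₁ * w₂ , w₁ * r₂ , A.*∈ r₁∈ w₂∈ , A.*∈ w₁∈ r₂∈ , N.*∈ (N.respects q (N.*∈ nw n′)) n , (begin
          z * (w₁ * r₂)         ≈⟨ *-congˡ (*-congʳ q) ⟨
          z * (w * w₂ * r₂)     ≈⟨ solve 4 (λ z w x y → z :* (w :* x :* y) := z :* w :* y :* x) refl z w w₂ r₂ ⟩
          z * w * r₂ * w₂       ≈⟨ *-congʳ (trans (*-congʳ e) p) ⟩
          r₁ * w₂               ∎)

      module _ (δA : ∀ {a} → A a → Fr A (δ a)) where
        private
          module F = IsSubring Fr-isSubring

        -- The quotient rule in the form δv · w = δr - v · δw: since v is already a fraction, one
        -- more division by w suffices.
        Fr-δ : ∀ {v} → Fr A v → Fr A (δ v)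
        Fr-δ {v} v∈@(r , w , r∈ , w∈ , n , p) =
          Fr-div (F.+∈ (δA r∈) (F.neg∈ (F.*∈ v∈ (δA w∈)))) (⊆Fr w∈) n (begin
            δ v * w                            ≈⟨ solve 3 (λ x y z → x := x :+ y :* z :+ (:- (y :* z))) refl (δ v * w) v (δ w) ⟩
            δ v * w + v * δ w + - (v * δ w)    ≈⟨ +-congʳ (δ-* v w) ⟨
            δ (v * w) + - (v * δ w)            ≈⟨ +-congʳ (δ-cong p) ⟩
            δ r + - (v * δ w)                  ∎)

underlyingRing : ∀ {ℓ} → DifferentialField ℓ → DifferentialRing ℓ
underlyingRing 𝒜 = record
  { commutativeRing = commutativeRing ; δ = δ ; δ-cong = δ-cong ; δ-+ = δ-+ ; δ-* = δ-* }
  where open DifferentialField 𝒜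

-- Its zero divisors are the reason why derivations and fractions are treated over rings.
pairRing : ∀ {ℓ} → DifferentialField ℓ → DifferentialRing ℓ
pairRing 𝒜 = record
  { commutativeRing = DirectProduct.commutativeRing commutativeRing commutativeRing
  ; δ = λ (x , y) → δ x , δ y
  ; δ-cong = λ (p , q) → δ-cong p , δ-cong q
  ; δ-+ = λ (x , y) (x′ , y′) → δ-+ x x′ , δ-+ y y′
  ; δ-* = λ (x , y) (x′ , y′) → δ-* x x′ , δ-* y y′
  }
  where open DifferentialField 𝒜

module Classical (em : ∀ {a} → ExcludedMiddle a) where

  decide : ∀ {a} (P : Set a) → Dec P
  decide P = em

  stable : ∀ {a} {P : Set a} → ¬ ¬ P → P
  stable {P = P} ¬¬p with decide P
  ... | yes p = p
  ... | no ¬p = contradiction ¬p ¬¬p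

  least : ∀ {a} (P : ℕ → Set a) → ∃ P → ∃ λ n → P n × ∀ m → m < n → ¬ P m
  least P (n , p) = go n 0 (ℕ.+-identityʳ n) (λ _ ())
    where
      go : ∀ k j → k ℕ.+ j ≡ n → (∀ m → m < j → ¬ P m) → ∃ λ n → P n × ∀ m → m < n → ¬ P m
      go zero    j ≡.refl below = n , p , below
      go (suc k) j e      below with decide (P j)
      ... | yes q = j , q , below
      ... | no ¬q = go k (suc j) (≡.trans (ℕ.+-suc k j) e)
                      λ m m<1+j → [ below m , (λ { ≡.refl → ¬q }) ]′ (ℕ.m<1+n⇒m<n∨m≡n m<1+j)

-- Differential polynomials and generic solutions of them

NestedPoly : ∀ {a} → Set a → ℕ → Set a
NestedPoly X zero    = X
NestedPoly X (suc n) = List (NestedPoly X n)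

module DifferentialPolynomials (em : ∀ {a} → ExcludedMiddle a) {ℓ} (𝒜 : DifferentialField ℓ) where
  open DifferentialField 𝒜 hiding (zero)
  open Classical em
  open RingSolver commutativeRing

  -- Coefficients from X may carry a proof of membership in a parameter set. When they are pairs,
  -- two choices of h give a polynomial and its conjugate.
  toDiffPoly : ∀ {a} {X : Set a} → (X → Carrier) → ∀ n → NestedPoly X n → DiffPoly 𝒜 n
  toDiffPoly h zero    x = h x
  toDiffPoly h (suc n) f = List.map (toDiffPoly h n) f

  integral : ∀ {x y} → x * y ≈ 0# → x ≈ 0# ⊎ y ≈ 0#
  integral {x} {y} p with decide (x ≈ 0#)
  ... | yes q = inj₁ q
  ... | no x≉0 = inj₂ (let z , xz≈1 = inverse x x≉0 in begin
    y            ≈⟨ *-identityʳ y ⟨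
    y * 1#       ≈⟨ *-congˡ xz≈1 ⟨
    y * (x * z)  ≈⟨ solve 3 (λ x y z → y :* (x :* z) := x :* y :* z) refl x y z ⟩
    x * y * z    ≈⟨ *-congʳ p ⟩
    0# * z       ≈⟨ zeroˡ z ⟩
    0#           ∎)
    where open SetoidReasoning setoid

  *-≉0 : ∀ {x y} → ¬ x ≈ 0# → ¬ y ≈ 0# → ¬ x * y ≈ 0#
  *-≉0 p q r = [ p , q ]′ (integral r)

  quotient : ∀ {z w r y} → w * y ≈ 1# → z * w ≈ r → r * y ≈ z
  quotient {z} {w} {r} {y} wy≈1 zw≈r =
    trans (*-congʳ (sym zw≈r)) (trans (*-assoc z w y) (trans (*-congˡ wy≈1) (*-identityʳ z)))

  private
    eval : ∀ n → DiffPoly 𝒜 n → Carrier → Carrier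
    eval = evalPoly 𝒜

    δⁿ : ℕ → Carrier → Carrier
    δⁿ = δ^ 𝒜

  zeroPoly : ∀ n → DiffPoly 𝒜 n
  zeroPoly zero    = 0#
  zeroPoly (suc n) = []

  onePoly : ∀ n → DiffPoly 𝒜 n
  onePoly zero    = 1#
  onePoly (suc n) = onePoly n ∷ []

  onePoly-nonZero : ∀ n → NonZeroPoly 𝒜 n (onePoly n)
  onePoly-nonZero zero    = 1≉0
  onePoly-nonZero (suc n) = here (onePoly-nonZero n)

  eval-zeroPoly : ∀ n x → eval n (zeroPoly n) x ≈ 0#
  eval-zeroPoly zero    x = refl
  eval-zeroPoly (suc n) x = refl

  nonZero-eval : ∀ n f x → ¬ eval n f x ≈ 0# → NonZeroPoly 𝒜 n f
  nonZero-eval zero    a       x p = p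
  nonZero-eval (suc n) []      x p = contradiction refl p
  nonZero-eval (suc n) (a ∷ f) x p with decide (NonZeroPoly 𝒜 n a)
  ... | yes q = here q
  ... | no ¬q = there (nonZero-eval (suc n) f x λ e → p (trans
          (+-cong (stable (¬q ∘ nonZero-eval n a x)) (*-congˡ e))
          (solve 1 (λ u → :0 :+ u :* :0 := :0) refl (δⁿ n x))))

  addPoly : ∀ n (f g : DiffPoly 𝒜 n) → ∃ λ h → ∀ x → eval n h x ≈ eval n f x + eval n g x
  addPoly zero a b = a + b , λ _ → refl
  addPoly (suc n) [] g = g , λ x → sym (+-identityˡ _)
  addPoly (suc n) (a ∷ f) [] = a ∷ f , λ x → sym (+-identityʳ _)
  addPoly (suc n) (a ∷ f) (b ∷ g) =
    let c , p = addPoly n a b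
        h , q = addPoly (suc n) f g
    in c ∷ h , λ x → trans (+-cong (p x) (*-congˡ (q x)))
         (solve 5 (λ a b u f g → a :+ b :+ u :* (f :+ g) := a :+ u :* f :+ (b :+ u :* g)) refl
           (eval n a x) (eval n b x) (δⁿ n x) (eval (suc n) f x) (eval (suc n) g x))

  mulPoly : ∀ n (f g : DiffPoly 𝒜 n) → ∃ λ h → ∀ x → eval n h x ≈ eval n f x * eval n g x
  scalePoly : ∀ n (a : DiffPoly 𝒜 n) g → ∃ λ h → ∀ x → eval (suc n) h x ≈ eval n a x * eval (suc n) g x
  scalePoly n a []      = [] , λ x → sym (zeroʳ _)
  scalePoly n a (b ∷ g) =
    let c , p = mulPoly n a b
        h , q = scalePoly n a g
    in c ∷ h , λ x → trans (+-cong (p x) (*-congˡ (q x)))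
         (solve 4 (λ a b u g → a :* b :+ u :* (a :* g) := a :* (b :+ u :* g)) refl
           (eval n a x) (eval n b x) (δⁿ n x) (eval (suc n) g x))
  mulPoly zero a b = a * b , λ _ → refl
  mulPoly (suc n) [] g = [] , λ x → sym (zeroˡ _)
  mulPoly (suc n) (a ∷ f) g =
    let s , p = scalePoly n a g
        t , q = mulPoly (suc n) f g
        h , r = addPoly (suc n) s (zeroPoly n ∷ t)
    in h , λ x → trans (r x) (trans (+-cong (p x) (+-cong (eval-zeroPoly n x) (*-congˡ (q x))))
         (solve 4 (λ a u f g → a :* g :+ (:0 :+ u :* (f :* g)) := (a :+ u :* f) :* g) refl
           (eval n a x) (δⁿ n x) (eval (suc n) f x) (eval (suc n) g x)))

  -- Stripping the zero coefficients of lowest degree from both factors, the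
  -- lowest coefficient of the product is the product of nonzero coefficients.
  nonZero-* : ∀ n (f g : DiffPoly 𝒜 n) → NonZeroPoly 𝒜 n f → NonZeroPoly 𝒜 n g →
              ∃ λ h → NonZeroPoly 𝒜 n h × ∀ x → eval n h x ≈ eval n f x * eval n g x
  nonZero-* zero a b p q = a * b , *-≉0 p q , λ _ → refl
  nonZero-* (suc n) f g p q = stripˡ f p
    where
      Product : (f g : DiffPoly 𝒜 (suc n)) → Set ℓ
      Product f g = ∃ λ h → NonZeroPoly 𝒜 (suc n) h × ∀ x → eval (suc n) h x ≈ eval (suc n) f x * eval (suc n) g x

      stripʳ : ∀ a f → NonZeroPoly 𝒜 n a → ∀ g → NonZeroPoly 𝒜 (suc n) g → Product (a ∷ f) g
      stripʳ a f az (b ∷ g) q with decide (NonZeroPoly 𝒜 n b)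
      ... | no ¬b =
        let h , hz , e = stripʳ a f az g (Any.tail ¬b q)
        in zeroPoly n ∷ h , there hz , λ x → trans (+-cong (eval-zeroPoly n x) (*-congˡ (e x)))
             (trans (solve 3 (λ u y g → :0 :+ u :* (y :* g) := y :* (:0 :+ u :* g)) refl (δⁿ n x) (eval (suc n) (a ∷ f) x) (eval (suc n) g x))
                    (*-congˡ (+-congʳ (sym (stable (¬b ∘ nonZero-eval n b x))))))
      ... | yes bz =
        let c , cz , e  = nonZero-* n a b az bz
            s , e₁ = scalePoly n a g
            t , e₂ = mulPoly (suc n) f (b ∷ g)
            h , e₃ = addPoly (suc n) s t
        in c ∷ h , here cz , λ x → trans (+-cong (e x) (*-congˡ (trans (e₃ x) (+-cong (e₁ x) (e₂ x)))))
             (solve 5 (λ a b u f g → a :* b :+ u :* (a :* g :+ f :* (b :+ u :* g)) := (a :+ u :* f) :* (b :+ u :* g)) refl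
               (eval n a x) (eval n b x) (δⁿ n x) (eval (suc n) f x) (eval (suc n) g x))

      stripˡ : ∀ f → NonZeroPoly 𝒜 (suc n) f → Product f g
      stripˡ (a ∷ f) p with decide (NonZeroPoly 𝒜 n a)
      ... | yes az = stripʳ a f az g q
      ... | no ¬a =
        let h , hz , e = stripˡ f (Any.tail ¬a p)
        in zeroPoly n ∷ h , there hz , λ x → trans (+-cong (eval-zeroPoly n x) (*-congˡ (e x)))
             (trans (solve 3 (λ u f y → :0 :+ u :* (f :* y) := (:0 :+ u :* f) :* y) refl (δⁿ n x) (eval (suc n) f x) (eval (suc n) g x))
                    (*-congʳ (+-congʳ (sym (stable (¬a ∘ nonZero-eval n a x))))))

  raise : ∀ k n (f : DiffPoly 𝒜 n) → NonZeroPoly 𝒜 n f →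
          ∃ λ h → NonZeroPoly 𝒜 (k ℕ.+ n) h × ∀ x → eval (k ℕ.+ n) h x ≈ eval n f x
  raise zero    n f p = f , p , λ _ → refl
  raise (suc k) n f p = let h , hz , e = raise k n f p in
    h ∷ [] , here hz , λ x → trans (+-cong (e x) (zeroʳ _)) (+-identityʳ _)

  module Generic (closed : DifferentiallyClosed 𝒜) (saturated : Saturated 𝒜)
                 (A : Pred Carrier ℓ) (small : subsetSetoid 𝒜 A ≺ setoid) where

    private
      Param : Set ℓ
      Param = Σ Carrier A

    ⟪_⟫ : ∀ {n} → NestedPoly Param n → DiffPoly 𝒜 n
    ⟪_⟫ {n} = toDiffPoly proj₁ n

    private
      δterm : ℕ → DiffTerm Param 1
      δterm zero    = var fzero
      δterm (suc n) = δ′ δterm n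

      δterm≡ : ∀ n v → evalDiff 𝒜 proj₁ (δterm n) v ≡ δⁿ n (v fzero)
      δterm≡ zero    v = ≡.refl
      δterm≡ (suc n) v = ≡.cong δ (δterm≡ n v)

      term : ∀ n → NestedPoly Param n → DiffTerm Param 1
      term zero    a       = par a
      term (suc n) []      = 0′
      term (suc n) (a ∷ f) = term n a +′ (δterm n *′ term (suc n) f)

      term≡ : ∀ n f v → evalDiff 𝒜 proj₁ (term n f) v ≡ eval n (toDiffPoly proj₁ n f) (v fzero)
      term≡ zero    a       v = ≡.refl
      term≡ (suc n) []      v = ≡.refl
      term≡ (suc n) (a ∷ f) v = ≡.cong₂ _+_ (term≡ n a v) (≡.cong₂ _*_ (δterm≡ n v) (term≡ (suc n) f v))

    -- Take the equation f = 0 with all inequations g ≠ 0 for nonzero g of lower order over A.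
    -- Finitely many of them are met by Blum's axiom for f and the product of the g's; saturation
    -- solves all of them together.
    generic-root : ∀ n (f : NestedPoly Param (suc n)) → HasOrder 𝒜 n ⟪ f ⟫ →
      ∃ λ x → eval (suc n) ⟪ f ⟫ x ≈ 0# ×
              ∀ (g : NestedPoly Param n) → NonZeroPoly 𝒜 n ⟪ g ⟫ → ¬ eval n ⟪ g ⟫ x ≈ 0#
    generic-root n f ord =
      let v , sat = saturated A small 1 Φ finite
      in v fzero , trans (sym (reflexive (term≡ (suc n) f v))) (sat _ (inj₁ ≡.refl)) ,
         λ g gz e → sat _ (inj₂ (g , gz , ≡.refl)) (trans (reflexive (term≡ n g v)) e)
      where
        Φ : Pred (DiffFormula Param 1) ℓ
        Φ φ = φ ≡ (term (suc n) f ≈′ 0′)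
            ⊎ ∃ λ (g : NestedPoly Param n) → NonZeroPoly 𝒜 n ⟪ g ⟫ × φ ≡ (¬′ (term n g ≈′ 0′))

        combined : ∀ φs → All Φ φs → ∃ λ G → NonZeroPoly 𝒜 n G ×
          ∀ x → eval (suc n) ⟪ f ⟫ x ≈ 0# → ¬ eval n G x ≈ 0# → All (λ φ → Sat 𝒜 proj₁ φ (const x)) φs
        combined [] [] = onePoly n , onePoly-nonZero n , λ _ _ _ → []
        combined (_ ∷ φs) (inj₁ ≡.refl ∷ ps) =
          let G , Gz , h = combined φs ps
          in G , Gz , λ x p q → trans (reflexive (term≡ (suc n) f _)) p ∷ h x p q
        combined (_ ∷ φs) (inj₂ (g , gz , ≡.refl) ∷ ps) =
          let G , Gz , h = combined φs ps
              H , Hz , e = nonZero-* n ⟪ g ⟫ G gz Gz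
          in H , Hz , λ x p q →
               (λ r → q (trans (e x) (trans (*-congʳ (trans (sym (reflexive (term≡ n g _))) r)) (zeroˡ _))))
               ∷ h x p (λ r → q (trans (e x) (trans (*-congˡ r) (zeroʳ _))))

        finite : ∀ φs → All Φ φs → ∃ λ v → All (λ φ → Sat 𝒜 proj₁ φ v) φs
        finite φs ps = let G , Gz , h = combined φs ps
                           x , p , q = closed n ⟪ f ⟫ G ord Gz
                       in const x , h x p q

    -- The same argument with inequations of every order: finitely many polynomials are first raised
    -- to a common order and then multiplied.
    generic-point : ∃ λ x → ∀ n (g : NestedPoly Param n) → NonZeroPoly 𝒜 n ⟪ g ⟫ → ¬ eval n ⟪ g ⟫ x ≈ 0#
    generic-point =
      let v , sat = saturated A small 1 Φ finite
      in v fzero , λ n g gz e → sat _ (n , g , gz , ≡.refl) (trans (reflexive (term≡ n g v)) e)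
      where
        Φ : Pred (DiffFormula Param 1) ℓ
        Φ φ = ∃ λ n → ∃ λ (g : NestedPoly Param n) → NonZeroPoly 𝒜 n ⟪ g ⟫ × φ ≡ (¬′ (term n g ≈′ 0′))

        combined : ∀ φs → All Φ φs → ∃ λ n → ∃ λ G → NonZeroPoly 𝒜 n G ×
          ∀ x → ¬ eval n G x ≈ 0# → All (λ φ → Sat 𝒜 proj₁ φ (const x)) φs
        combined [] [] = 0 , onePoly 0 , onePoly-nonZero 0 , λ _ _ → []
        combined (_ ∷ φs) ((n , g , gz , ≡.refl) ∷ ps) =
          let m , G , Gz , h = combined φs ps
              g′ , g′z , e₁ = raise m n ⟪ g ⟫ gz
              G′ , G′z , e₂ = ≡.subst (λ k → ∃ λ H → NonZeroPoly 𝒜 k H × ∀ x → eval k H x ≈ eval m G x)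
                                (ℕ.+-comm n m) (raise n m G Gz)
              H , Hz , e = nonZero-* (m ℕ.+ n) g′ G′ g′z G′z
          in m ℕ.+ n , H , Hz , λ x q →
               (λ r → q (trans (e x) (trans (*-congʳ (trans (e₁ x) (trans (sym (reflexive (term≡ n g _))) r))) (zeroˡ _))))
               ∷ h x (λ r → q (trans (e x) (trans (*-congˡ (trans (e₂ x) r)) (zeroʳ _))))

        finite : ∀ φs → All Φ φs → ∃ λ v → All (λ φ → Sat 𝒜 proj₁ φ v) φs
        finite φs ps = let n , G , Gz , h = combined φs ps
                           -- The list is the polynomial δⁿX, of order n, to be paired with G of
                           -- order below n.
                           x , _ , q = closed n (zeroPoly n ∷ onePoly n ∷ []) G (here (onePoly-nonZero n)) Gz
                       in const x , h x q

-- Partial isomorphisms as subrings of the product ring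

module Pairs (em : ∀ {a} → ExcludedMiddle a) {ℓ} (𝒜 : DifferentialField ℓ) where
  open DifferentialField 𝒜 hiding (zero)
  open Classical em
  open DifferentialPolynomials em 𝒜 using (integral; *-≉0)

  module 𝒫 = DifferentialRing (pairRing 𝒜)

  open SubringTheory 𝒫.commutativeRing public using (IsSubring; IsPrimeIdeal)
  open DifferentialRingTheory (pairRing 𝒜) public using (IsDenominatorSet; module Fractions)

  Zero₁ Zero₂ : Pred 𝒫.Carrier ℓ
  Zero₁ v = proj₁ v ≈ 0#
  Zero₂ v = proj₂ v ≈ 0#

  zero₁-prime : IsPrimeIdeal Zero₁
  zero₁-prime = record
    { respects = λ (p , _) z → trans (sym p) z
    ; 0∈    = refl
    ; +∈    = λ p q → trans (+-cong p q) (+-identityˡ 0#)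
    ; *∈ʳ   = λ y p → trans (*-congʳ p) (zeroˡ _)
    ; prime = integral
    }

  zero₂-prime : IsPrimeIdeal Zero₂
  zero₂-prime = record
    { respects = λ (_ , p) z → trans (sym p) z
    ; 0∈    = refl
    ; +∈    = λ p q → trans (+-cong p q) (+-identityˡ 0#)
    ; *∈ʳ   = λ y p → trans (*-congʳ p) (zeroˡ _)
    ; prime = integral
    }

  NonZeros : Pred 𝒫.Carrier ℓ
  NonZeros v = ¬ Zero₁ v × ¬ Zero₂ v

  nonZeros-isDenominatorSet : IsDenominatorSet NonZeros
  nonZeros-isDenominatorSet = record
    { respects = λ (p , q) (x , y) → (λ z → x (trans p z)) , (λ z → y (trans q z))
    ; 1∈   = 1≉0 , 1≉0
    ; *∈   = λ (x , y) (x′ , y′) → *-≉0 x x′ , *-≉0 y y′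
    }

  open Fractions nonZeros-isDenominatorSet public

  -- The graph of an isomorphism between two differential subfields of 𝒜.
  record PartialIso : Set (lsuc ℓ) where
    field
      Graph     : Pred 𝒫.Carrier ℓ
      isSubring : IsSubring Graph
      δ∈        : ∀ {v} → Graph v → Graph (𝒫.δ v)
      div∈      : DivisionClosed Graph
      zero⇒     : ∀ {v} → Graph v → Zero₁ v → Zero₂ v
      zero⇐     : ∀ {v} → Graph v → Zero₂ v → Zero₁ v

    open IsSubring isSubring public

  Fr-zero⇒ : ∀ {A} → (∀ {v} → A v → Zero₁ v → Zero₂ v) → ∀ {v} → Fr A v → Zero₁ v → Zero₂ v
  Fr-zero⇒ A⇒ (r , w , r∈ , w∈ , (_ , w₂) , p , q) z =
    [ id , (λ w≈0 → contradiction w≈0 w₂) ]′ (integral (trans q (A⇒ r∈ (trans (sym p) (trans (*-congʳ z) (zeroˡ _))))))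

  Fr-zero⇐ : ∀ {A} → (∀ {v} → A v → Zero₂ v → Zero₁ v) → ∀ {v} → Fr A v → Zero₂ v → Zero₁ v
  Fr-zero⇐ A⇐ (r , w , r∈ , w∈ , (w₁ , _) , p , q) z =
    [ id , (λ w≈0 → contradiction w≈0 w₁) ]′ (integral (trans p (A⇐ r∈ (trans (sym q) (trans (*-congʳ z) (zeroˡ _))))))

  -- It is enough to compare the two kernels on a ring A: they agree on its fractions too, because a
  -- denominator vanishes in neither component.
  fractionIso : ∀ {A} → IsSubring A → (∀ {v} → A v → Zero₁ v → Zero₂ v) → (∀ {v} → A v → Zero₂ v → Zero₁ v) →
                (∀ {v} → A v → Fr A (𝒫.δ v)) → PartialIso
  fractionIso {A} A-sub A⇒ A⇐ δA = record
    { Graph     = Fr A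
    ; isSubring = Fr-isSubring A-sub
    ; δ∈        = Fr-δ A-sub δA
    ; div∈      = Fr-div A-sub
    ; zero⇒     = Fr-zero⇒ A⇒
    ; zero⇐     = Fr-zero⇐ A⇐
    }

-- Extending a partial isomorphism by one element

module Extension (em : ∀ {a} → ExcludedMiddle a) {ℓ} (𝒜 : DifferentialField ℓ) (charZero : CharZero 𝒜) where
  open Pairs em 𝒜
  open Classical em
  open DifferentialField 𝒜 hiding (zero)
  open DifferentialPolynomials em 𝒜
  open SubringTheory 𝒫.commutativeRing hiding (IsSubring; IsPrimeIdeal)
  open DifferentialRingTheory (pairRing 𝒜) hiding (IsDenominatorSet; module Fractions)
  open Exp 𝒫.commutativeSemiring using (_^_)
  open RawMonoidDefs +-rawMonoid using () renaming (_×_ to _·_)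
  open RawMonoidDefs 𝒫.+-rawMonoid using () renaming (_×_ to _·ₚ_)
  private module S = RingSolver 𝒫.commutativeRing

  δ̂ : ℕ → 𝒫.Carrier → 𝒫.Carrier
  δ̂ n (x , y) = δ^ 𝒜 n x , δ^ 𝒜 n y

  module _ (ρ : PartialIso) where
    private module ρ = PartialIso ρ

    Coefficient : Set ℓ
    Coefficient = Σ 𝒫.Carrier ρ.Graph

    poly₁ poly₂ : ∀ n → NestedPoly Coefficient n → DiffPoly 𝒜 n
    poly₁ = toDiffPoly (proj₁ ∘ proj₁)
    poly₂ = toDiffPoly (proj₂ ∘ proj₁)

    nonZero₁₂ : ∀ n f → NonZeroPoly 𝒜 n (poly₁ n f) → NonZeroPoly 𝒜 n (poly₂ n f)
    nonZero₁₂ zero    (_ , g) p = p ∘ ρ.zero⇐ g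
    nonZero₁₂ (suc n) f p = Any.map⁺ (Any.map (λ {x} → nonZero₁₂ n x) (Any.map⁻ p))

    nonZero₂₁ : ∀ n f → NonZeroPoly 𝒜 n (poly₂ n f) → NonZeroPoly 𝒜 n (poly₁ n f)
    nonZero₂₁ zero    (_ , g) p = p ∘ ρ.zero⇒ g
    nonZero₂₁ (suc n) f p = Any.map⁺ (Any.map (λ {x} → nonZero₂₁ n x) (Any.map⁻ p))

    Transcendental₁ Transcendental₂ : Carrier → ℕ → Set ℓ
    Transcendental₁ z n = ∀ f → NonZeroPoly 𝒜 n (poly₁ n f) → ¬ evalPoly 𝒜 n (poly₁ n f) z ≈ 0#
    Transcendental₂ z n = ∀ f → NonZeroPoly 𝒜 n (poly₂ n f) → ¬ evalPoly 𝒜 n (poly₂ n f) z ≈ 0#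

    AlgebraicOfDegree : Carrier → ℕ → ℕ → Set ℓ
    AlgebraicOfDegree z n d = ∃ λ (g : NestedPoly Coefficient (suc n)) → ∃ λ (l : NestedPoly Coefficient n) →
      length g ≡ d × NonZeroPoly 𝒜 n (poly₁ n l) × evalPoly 𝒜 (suc n) (poly₁ (suc n) (g ++ l ∷ [])) z ≈ 0#

    -- The minimal differential polynomial of z: least order first, then least degree in the highest
    -- derivative. Its leading coefficient is a polynomial in the lower derivatives, so it is not
    -- made monic.
    record Algebraic (z : Carrier) : Set ℓ where
      field
        order          : ℕ
        transcendental : Transcendental₁ z order
        degree         : ℕ
        lower          : NestedPoly Coefficient (suc order)
        leading        : NestedPoly Coefficient order
        length-lower   : length lower ≡ degree
        leading≢0      : NonZeroPoly 𝒜 order (poly₁ order leading)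
        root           : evalPoly 𝒜 (suc order) (poly₁ (suc order) (lower ++ leading ∷ [])) z ≈ 0#
        minimal        : ∀ j → j < degree → ¬ AlgebraicOfDegree z order j

      minPoly : NestedPoly Coefficient (suc order)
      minPoly = lower ++ leading ∷ []

      Root₂ : Carrier → Set ℓ
      Root₂ z′ = evalPoly 𝒜 (suc order) (poly₂ (suc order) minPoly) z′ ≈ 0# × Transcendental₂ z′ order

      -- In degree 0 the leading coefficient, a nonzero polynomial in the lower derivatives, would
      -- itself vanish at z.
      1≤degree : 1 ≤ degree
      1≤degree = ≡.subst (1 ≤_) length-lower (nonempty lower root)
        where
          nonempty : ∀ g → evalPoly 𝒜 (suc order) (poly₁ (suc order) (g ++ leading ∷ [])) z ≈ 0# → 1 ≤ length g
          nonempty []      e = contradiction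
            (trans (sym (trans (+-congˡ (zeroʳ _)) (+-identityʳ _))) e)
            (transcendental leading leading≢0)
          nonempty (_ ∷ g) e = s≤s z≤n

      hasOrder : HasOrder 𝒜 order (poly₂ (suc order) minPoly)
      hasOrder = go lower (≡.subst (1 ≤_) (≡.sym length-lower) 1≤degree)
        where
          go : ∀ g → 1 ≤ length g → HasOrder 𝒜 order (poly₂ (suc order) (g ++ leading ∷ []))
          go (_ ∷ g) _ = Any.map⁺ (Any.++⁺ʳ g (here (nonZero₁₂ order leading leading≢0)))

    private
      split-leading : ∀ n (f : NestedPoly Coefficient (suc n)) → NonZeroPoly 𝒜 (suc n) (poly₁ (suc n) f) →
        ∃ λ g → ∃ λ l → NonZeroPoly 𝒜 n (poly₁ n l) ×
        ∀ x → evalPoly 𝒜 (suc n) (poly₁ (suc n) (g ++ l ∷ [])) x ≈ evalPoly 𝒜 (suc n) (poly₁ (suc n) f) x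
      split-leading n (a ∷ f) p with decide (NonZeroPoly 𝒜 (suc n) (poly₁ (suc n) f))
      ... | yes q = let g , l , lz , e = split-leading n f q
                    in a ∷ g , l , lz , λ x → +-congˡ (*-congˡ (e x))
      ... | no ¬q = [] , a , Any.head ¬q p ,
                    λ x → +-congˡ (*-congˡ (sym (stable (¬q ∘ nonZero-eval (suc n) _ x))))

    classify : ∀ z → (∀ n → Transcendental₁ z n) ⊎ Algebraic z
    classify z with decide (∀ n → Transcendental₁ z n)
    ... | yes t = inj₁ t
    ... | no ¬t with least (λ n → ¬ Transcendental₁ z n) (stable λ ¬∃ → ¬t λ n → stable λ ¬tr → ¬∃ (n , ¬tr))
    ... | zero  , ¬tr , _     = contradiction (λ _ p → p) ¬tr
    ... | suc n , ¬tr , below =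
      let f , fz , e = stable λ ¬∃ → ¬tr λ f fz e → ¬∃ (f , fz , e)
          g₀ , l₀ , l₀z , e₀ = split-leading n f fz
          d , (g , l , len , lz , r) , min = least (AlgebraicOfDegree z n) (_ , g₀ , l₀ , ≡.refl , l₀z , trans (e₀ z) e)
      in inj₂ record
           { order = n ; transcendental = stable (below n ℕ.≤-refl) ; degree = d ; lower = g ; leading = l
           ; length-lower = len ; leading≢0 = lz ; root = r ; minimal = min }

    module Adjoin (ẑ : 𝒫.Carrier) where
      private
        z z′ : Carrier
        z  = proj₁ ẑ
        z′ = proj₂ ẑ

        ev : ∀ n → NestedPoly Coefficient n → 𝒫.Carrier
        ev n f = evalPoly 𝒜 n (poly₁ n f) z , evalPoly 𝒜 n (poly₂ n f) z′

      û : ℕ → 𝒫.Carrier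
      û n = δ̂ n ẑ

      -- The pairs of values at ẑ of the polynomials in X, δX, …, δⁿ⁻¹X.
      Values : ℕ → Pred 𝒫.Carrier ℓ
      Values n v = ∃ λ f → v 𝒫.≈ ev n f

      private
        toDeg : ∀ n f → Deg (Values n) (û n) (length f) (ev (suc n) f)
        toDeg n []      = 𝒫.refl
        toDeg n (a ∷ f) = ev n a , ev (suc n) f , (a , 𝒫.refl) , toDeg n f , 𝒫.refl

        fromDeg : ∀ n k {v} → Deg (Values n) (û n) k v → ∃ λ f → length f ≡ k × v 𝒫.≈ ev (suc n) f
        fromDeg n zero    p = [] , ≡.refl , p
        fromDeg n (suc k) (a , w , (b , p) , q , e) =
          let f , len , e′ = fromDeg n k q
          in b ∷ f , ≡.cong suc len , 𝒫.trans e (𝒫.+-cong p (𝒫.*-congˡ {x = û n} e′))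

      [û]⊆ : ∀ n → Values n [ û n ] ⊆ Values (suc n)
      [û]⊆ n (k , p) = let f , _ , e = fromDeg n k p in f , e

      ⊆[û] : ∀ n → Values (suc n) ⊆ Values n [ û n ]
      ⊆[û] n (f , e) = length f , deg-resp (length f) (𝒫.sym e) (toDeg n f)

      values-isSubring : ∀ n → IsSubring (Values n)
      values-isSubring zero = record
        { respects = λ e (f , p) → f , 𝒫.trans (𝒫.sym e) p
        ; 0∈ = (_ , ρ.0∈) , 𝒫.refl
        ; 1∈ = (_ , ρ.1∈) , 𝒫.refl
        ; +∈ = λ ((_ , p) , e) ((_ , q) , e′) → (_ , ρ.+∈ p q) , 𝒫.+-cong e e′
        ; *∈ = λ ((_ , p) , e) ((_ , q) , e′) → (_ , ρ.*∈ p q) , 𝒫.*-cong e e′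
        ; neg∈ = λ ((_ , p) , e) → (_ , ρ.neg∈ p) , 𝒫.-‿cong e
        }
      values-isSubring (suc n) = record
        { respects = λ e (f , p) → f , 𝒫.trans (𝒫.sym e) p
        ; 0∈   = [û]⊆ n A.0∈
        ; 1∈   = [û]⊆ n A.1∈
        ; +∈   = λ p q → [û]⊆ n (A.+∈ (⊆[û] n p) (⊆[û] n q))
        ; *∈   = λ p q → [û]⊆ n (A.*∈ (⊆[û] n p) (⊆[û] n q))
        ; neg∈ = λ p → [û]⊆ n (A.neg∈ (⊆[û] n p))
        }
        where module A = IsSubring ([u]-isSubring (values-isSubring n) (û n))

      values-suc : ∀ n → Values n ⊆ Values (suc n)
      values-suc n = [û]⊆ n ∘ A⊆A[u] (values-isSubring n) (û n)

      û∈values : ∀ n → Values (suc n) (û n)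
      û∈values n = [û]⊆ n (u∈A[u] (values-isSubring n) (û n))

      values-≤ : ∀ {m n} → m ≤ n → Values m ⊆ Values n
      values-≤ = go ∘ ℕ.≤⇒≤′
        where
          go : ∀ {m n} → m ℕ.≤′ n → Values m ⊆ Values n
          go ℕ.≤′-refl p = p
          go (ℕ.≤′-step m≤n) p = values-suc _ (go m≤n p)

      graph⊆values : ∀ n → ρ.Graph ⊆ Values n
      graph⊆values n p = values-≤ (z≤n {n}) ((_ , p) , 𝒫.refl)

      δ-values : ∀ n {v} → Values n v → Values (suc n) (𝒫.δ v)
      δ-values zero ((w , p) , e) = respects (𝒫.δ-cong (𝒫.sym e)) (graph⊆values 1 (ρ.δ∈ p))
        where open IsSubring (values-isSubring 1)
      δ-values (suc n) p = δ-[u] (values-≤ (ℕ.m≤n+m n 2)) (û∈values (suc n)) (⊆[û] n p)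
        where open Derivative (values-isSubring n) (values-isSubring (2 ℕ.+ n)) (û n)
                     (values-suc (suc n) (û∈values n)) (λ p → values-suc (suc n) (δ-values n p))

      values⊆ : ∀ {M} → IsSubring M → ρ.Graph ⊆ M → ∀ n → (∀ i → i < n → M (û i)) → Values n ⊆ M
      values⊆ M-sub ρ⊆M zero    û∈M ((w , p) , e) = IsSubring.respects M-sub (𝒫.sym e) (ρ⊆M p)
      values⊆ {M} M-sub ρ⊆M (suc n) û∈M (f , e) = M.respects (𝒫.sym e) (go f)
        where
          module M = IsSubring M-sub
          go : ∀ f → M (ev (suc n) f)
          go []      = M.0∈
          go (a ∷ f) = M.+∈ (values⊆ M-sub ρ⊆M n (λ i i<n → û∈M i (ℕ.m<n⇒m<1+n i<n)) (a , 𝒫.refl))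
                            (M.*∈ (û∈M n ℕ.≤-refl) (go f))

      -- Only the zero polynomial vanishes at a transcendental z, and zero coefficients correspond
      -- to zero coefficients under ρ.
      values-zero⇒ : ∀ n → Transcendental₁ z n → ∀ {v} → Values n v → Zero₁ v → Zero₂ v
      values-zero⇒ n t (f , e₁ , e₂) p = trans e₂ (stable λ ne →
        t f (nonZero₂₁ n f (nonZero-eval n _ z′ ne)) (trans (sym e₁) p))

      values-zero⇐ : ∀ n → Transcendental₂ z′ n → ∀ {v} → Values n v → Zero₂ v → Zero₁ v
      values-zero⇐ n t (f , e₁ , e₂) p = trans e₁ (stable λ ne →
        t f (nonZero₁₂ n f (nonZero-eval n _ z ne)) (trans (sym e₂) p))

      -- `InRange` tells which derivatives of ẑ generate the extension as a field: all of them in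
      -- the transcendental case, those up to the order of the minimal polynomial in the algebraic
      -- case. The second bound later yields finitely many field generators of L.
      record ExtensionBy (InRange : ℕ → Set) : Set (lsuc ℓ) where
        field
          iso       : PartialIso
          extends   : ρ.Graph ⊆ PartialIso.Graph iso
          contains  : PartialIso.Graph iso ẑ
          generated : ∀ {M} → IsSubring M → DivisionClosed M → ρ.Graph ⊆ M →
                      (∀ i → InRange i → M (û i)) → PartialIso.Graph iso ⊆ M

      adjoin-transcendental : (∀ n → Transcendental₁ z n) → (∀ n → Transcendental₂ z′ n) → ExtensionBy (_≤_ 0)
      adjoin-transcendental t₁ t₂ = record
        { iso       = fractionIso sub (λ (n , p) → values-zero⇒ n (t₁ n) p) (λ (n , p) → values-zero⇐ n (t₂ n) p)
                        (λ (n , p) → ⊆Fr sub (suc n , δ-values n p))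
        ; extends   = λ p → ⊆Fr sub (0 , graph⊆values 0 p)
        ; contains  = ⊆Fr sub (1 , û∈values 0)
        ; generated = λ M-sub div ρ⊆M û∈M → Fr⊆ (λ (n , p) → values⊆ M-sub ρ⊆M n (λ i _ → û∈M i z≤n) p) div
        }
        where
          V : Pred 𝒫.Carrier ℓ
          V v = ∃ λ n → Values n v

          join : ∀ {x y} → V x → V y → ∃ λ n → Values n x × Values n y
          join (m , p) (n , q) = m ℕ.+ n , values-≤ (ℕ.m≤m+n m n) p , values-≤ (ℕ.m≤n+m n m) q

          sub : IsSubring V
          sub = record
            { respects = λ e (n , p) → n , IsSubring.respects (values-isSubring n) e p
            ; 0∈ = 0 , IsSubring.0∈ (values-isSubring 0)
            ; 1∈ = 0 , IsSubring.1∈ (values-isSubring 0)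
            ; +∈ = λ p q → let n , p′ , q′ = join p q in n , IsSubring.+∈ (values-isSubring n) p′ q′
            ; *∈ = λ p q → let n , p′ , q′ = join p q in n , IsSubring.*∈ (values-isSubring n) p′ q′
            ; neg∈ = λ (n , p) → n , IsSubring.neg∈ (values-isSubring n) p
            }

      private
        ev-snoc : ∀ n g l → ev (suc n) (g ++ l ∷ []) 𝒫.≈ ev (suc n) g 𝒫.+ ev n l 𝒫.* û n ^ length g
        ev-snoc n []      l = S.solve 2 (λ l u → l S.:+ u S.:* S.:0 S.:= S.:0 S.:+ l S.:* S.:1) 𝒫.refl (ev n l) (û n)
        ev-snoc n (a ∷ g) l = 𝒫.trans (𝒫.+-congˡ {ev n a} (𝒫.*-congˡ {û n} (ev-snoc n g l)))
          (S.solve 5 (λ a u g l p → a S.:+ u S.:* (g S.:+ l S.:* p) S.:= (a S.:+ u S.:* g) S.:+ l S.:* (u S.:* p)) 𝒫.refl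
             (ev n a) (û n) (ev (suc n) g) (ev n l) (û n ^ length g))

        ·ₚ≡ : ∀ n → n ·ₚ 𝒫.1# ≡ (n · 1# , n · 1#)
        ·ₚ≡ zero    = ≡.refl
        ·ₚ≡ (suc n) = ≡.cong (𝒫.1# 𝒫.+_) (·ₚ≡ n)

      adjoin-algebraic : (a : Algebraic z) → Algebraic.Root₂ a z′ → ExtensionBy (_≤ Algebraic.order a)
      adjoin-algebraic a (root₂ , t₂) = record
        { iso       = fractionIso [u]-sub van⇒ van⇐ δ-van
        ; extends   = ⊆Fr [u]-sub ∘ A⊆A[u] A-sub u ∘ graph⊆values n
        ; contains  = ⊆Fr [u]-sub (⊆[û] n (values-≤ (s≤s (z≤n {n})) (û∈values 0)))
        ; generated = λ M-sub div ρ⊆M û∈M →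
            Fr⊆ (λ p → values⊆ M-sub ρ⊆M (suc n) (λ i i<1+n → û∈M i (ℕ.s≤s⁻¹ i<1+n)) ([û]⊆ n p)) div
        }
        where
          open Algebraic a renaming (order to n; degree to d)
          A-sub = values-isSubring n
          u = û n
          [u]-sub = [u]-isSubring A-sub u

          min₁ : Minimal A-sub u Zero₁ d
          min₁ j j<d w∈ (l , l≈) p = stable λ ne →
            let g , len , g≈ = fromDeg n j w∈
            in minimal j j<d (g , l , len , nonZero-eval n _ z (λ e → ne (trans (proj₁ l≈) e)) ,
                 trans (trans (proj₁ (ev-snoc n g l)) (sym (proj₁ (𝒫.+-cong g≈ (𝒫.*-cong l≈
                   (𝒫.reflexive (≡.cong (u ^_) (≡.sym len)))))))) p)

          F : 𝒫.Carrier
          F = ev (suc n) lower 𝒫.+ ev n leading 𝒫.* u ^ d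

          F≈ : ev (suc n) minPoly 𝒫.≈ F
          F≈ = ≡.subst (λ k → ev (suc n) minPoly 𝒫.≈ ev (suc n) lower 𝒫.+ ev n leading 𝒫.* u ^ k) length-lower (ev-snoc n lower leading)

          F₁ : Zero₁ F
          F₁ = trans (sym (proj₁ F≈)) root
          F₂ : Zero₂ F
          F₂ = trans (sym (proj₂ F≈)) root₂

          l∈ : Values n (ev n leading)
          l∈ = leading , 𝒫.refl
          l∉ : ¬ Zero₁ (ev n leading)
          l∉ = transcendental leading leading≢0
          g∈ : Deg (Values n) u d (ev (suc n) lower)
          g∈ = ≡.subst (λ k → Deg (Values n) u k (ev (suc n) lower)) length-lower (toDeg n lower)

          van⇒ : ∀ {v} → (Values n [ u ]) v → Zero₁ v → Zero₂ v
          van⇒ = vanishing⇒ A-sub u zero₁-prime zero₂-prime stable (values-zero⇒ n transcendental) (values-zero⇐ n t₂)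
                   d min₁ l∈ l∉ g∈ F₁ F₂
          van⇐ : ∀ {v} → (Values n [ u ]) v → Zero₂ v → Zero₁ v
          van⇐ = vanishing⇐ A-sub u zero₁-prime zero₂-prime stable (values-zero⇒ n transcendental) (values-zero⇐ n t₂)
                   d min₁ l∈ l∉ g∈ F₁ F₂

          -- Differentiating the minimal equation gives s · δu + e = 0 with s the separant. Its
          -- leading coefficient is a positive multiple of the one of the equation, nonzero in
          -- characteristic 0, and its degree is smaller, so minimality forbids s = 0 and δu = -e /
          -- s.
          δu∈ : ∀ d → Minimal A-sub u Zero₁ d → 1 ≤ d → Deg (Values n) u d (ev (suc n) lower) →
                ev (suc n) lower 𝒫.+ ev n leading 𝒫.* u ^ d 𝒫.≈ 𝒫.0# → Fr (Values n [ u ]) (𝒫.δ u)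
          δu∈ (suc d) min _ g∈ F≈0 =
            Fr-div [u]-sub (⊆Fr [u]-sub (IsSubring.neg∈ [u]-sub e∈)) (⊆Fr [u]-sub s∈) (s∉ , s∉ ∘ van⇐ s∈)
              (𝒫.trans (𝒫.*-comm (𝒫.δ u) s) (𝒫.trans
                (S.solve 2 (λ x e → x S.:= (x S.:+ e) S.:+ (S.:- e)) 𝒫.refl (s 𝒫.* 𝒫.δ u) e)
                (𝒫.trans (𝒫.+-congʳ { 𝒫.- e} (𝒫.trans (𝒫.sym eq) (𝒫.trans (𝒫.δ-cong F≈0) 𝒫.δ-0))) (𝒫.+-identityˡ (𝒫.- e)))))
            where
              open Derivative A-sub [u]-sub u (u∈A[u] A-sub u) (⊆[û] n ∘ δ-values n)
              sep = separant d g∈ l∈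
              s₀ = proj₁ sep
              e = proj₁ (proj₂ sep)
              s₀∈ = proj₁ (proj₂ (proj₂ sep))
              e∈ = proj₁ (proj₂ (proj₂ (proj₂ sep)))
              c = (suc d ·ₚ 𝒫.1#) 𝒫.* ev n leading
              s = s₀ 𝒫.+ c 𝒫.* u ^ d
              eq : 𝒫.δ (ev (suc n) lower 𝒫.+ ev n leading 𝒫.* u ^ suc d) 𝒫.≈ s 𝒫.* 𝒫.δ u 𝒫.+ e
              eq = proj₂ (proj₂ (proj₂ (proj₂ sep)))
              ·∈ : ∀ k → Values n (k ·ₚ 𝒫.1#)
              ·∈ zero    = IsSubring.0∈ A-sub
              ·∈ (suc k) = IsSubring.+∈ A-sub (IsSubring.1∈ A-sub) (·∈ k)
              c∈ : Values n c
              c∈ = IsSubring.*∈ A-sub (·∈ (suc d)) l∈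
              s∈ : (Values n [ u ]) s
              s∈ = suc d , DegProperties.deg-snoc (IsSubring.isSubmonoid A-sub) u d s₀∈ c∈
              s∉ : ¬ Zero₁ s
              s∉ p = [ (λ q → charZero d (trans (sym (reflexive (≡.cong proj₁ (·ₚ≡ (suc d))))) q)) , l∉ ]′
                       (integral (min d ℕ.≤-refl s₀∈ c∈ p))

          δ-van : ∀ {v} → (Values n [ u ]) v → Fr (Values n [ u ]) (𝒫.δ v)
          δ-van = δ-[u] (⊆Fr [u]-sub ∘ A⊆A[u] A-sub u) (δu∈ d min₁ 1≤degree g∈ (F₁ , F₂))
            where open Derivative A-sub (Fr-isSubring [u]-sub) u (⊆Fr [u]-sub (u∈A[u] A-sub u)) (⊆Fr [u]-sub ∘ ⊆[û] n ∘ δ-values n)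

-- Embeddings of L over K, and the constants of L

mapNested : ∀ {a b} {X : Set a} {Y : Set b} → (X → Y) → ∀ n → NestedPoly X n → NestedPoly Y n
mapNested h zero    x = h x
mapNested h (suc n) f = List.map (mapNested h n) f

module Homomorphisms (em : ∀ {a} → ExcludedMiddle a) {ℓ} (𝒜 : DifferentialField ℓ)
    (K L : DifferentialSubfield 𝒜) (charZero : CharZero 𝒜) (closed : DifferentiallyClosed 𝒜)
    (saturated : Saturated 𝒜) (K⊆L : DifferentialSubfield.Mem K ⊆ DifferentialSubfield.Mem L)
    (L-small : subsetSetoid 𝒜 (DifferentialSubfield.Mem L) ≺ DifferentialField.setoid 𝒜) where
  open DifferentialField 𝒜 hiding (zero)
  open Classical em
  open DifferentialPolynomials em 𝒜
  open Pairs em 𝒜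
  open Extension em 𝒜 charZero
  open RingSolver commutativeRing
  open RawMonoidDefs +-rawMonoid using () renaming (_×_ to _·_)
  open Injection using (to)
  private
    module K = DifferentialSubfield K
    module L = DifferentialSubfield L

  toDiffPoly-map : ∀ {a b} {X : Set a} {Y : Set b} (k : Y → Carrier) (h : X → Y) n f →
                   toDiffPoly k n (mapNested h n f) ≡ toDiffPoly (k ∘ h) n f
  toDiffPoly-map k h zero    x = ≡.refl
  toDiffPoly-map k h (suc n) f =
    ≡.trans (≡.sym (List.map-∘ f)) (List.map-cong (toDiffPoly-map k h n) f)

  small : ∀ {A} → Injection (subsetSetoid 𝒜 A) (subsetSetoid 𝒜 L.Mem) → subsetSetoid 𝒜 A ≺ setoid
  small i = record { to = proj₁ ; cong = id ; injective = id } ,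
            λ j → proj₂ L-small (Composition.injection j i)

  module _ (ρ : PartialIso) where
    private module ρ = PartialIso ρ

    -- The difference (x - x′ , y - y′) lies in the graph, so `zero⇒` gives single-valuedness;
    -- `injective` is the mirror image with `zero⇐`.
    functional : ∀ {x x′ y y′} → ρ.Graph (x , y) → ρ.Graph (x′ , y′) → x ≈ x′ → y ≈ y′
    functional {x} {x′} {y} {y′} p q e = begin
      y               ≈⟨ solve 2 (λ x y → x := x :+ (:- y) :+ y) refl y y′ ⟩
      y + - y′ + y′   ≈⟨ +-congʳ (ρ.zero⇒ (ρ.+∈ p (ρ.neg∈ q)) (trans (+-congʳ e) (-‿inverseʳ x′))) ⟩
      0# + y′         ≈⟨ +-identityˡ y′ ⟩
      y′              ∎
      where open SetoidReasoning setoid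

    injective : ∀ {x x′ y y′} → ρ.Graph (x , y) → ρ.Graph (x′ , y′) → y ≈ y′ → x ≈ x′
    injective {x} {x′} {y} {y′} p q e = begin
      x               ≈⟨ solve 2 (λ x y → x := x :+ (:- y) :+ y) refl x x′ ⟩
      x + - x′ + x′   ≈⟨ +-congʳ (ρ.zero⇐ (ρ.+∈ p (ρ.neg∈ q)) (trans (+-congʳ e) (-‿inverseʳ y′))) ⟩
      0# + x′         ≈⟨ +-identityˡ x′ ⟩
      x′              ∎
      where open SetoidReasoning setoid

    Domain Range : Pred Carrier ℓ
    Domain x = ∃ λ y → ρ.Graph (x , y)
    Range  y = ∃ λ x → ρ.Graph (x , y)

    domain-generated : ∀ {A} → A ⊆ Domain → Generated 𝒜 A ⊆ Domain
    domain-generated h (gen p)  = h p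
    domain-generated h (resp e p) = let y , q = domain-generated h p in y , ρ.respects (e , refl) q
    domain-generated h nil = 0# , ρ.0∈
    domain-generated h one = 1# , ρ.1∈
    domain-generated h (add p q) = let _ , p′ = domain-generated h p ; _ , q′ = domain-generated h q in _ , ρ.+∈ p′ q′
    domain-generated h (mul p q) = let _ , p′ = domain-generated h p ; _ , q′ = domain-generated h q in _ , ρ.*∈ p′ q′
    domain-generated h (neg p) = let _ , p′ = domain-generated h p in _ , ρ.neg∈ p′
    domain-generated h (inv {x} {y} p e) =
      let x′ , p′ = domain-generated h p
          x≉0 : ¬ x ≈ 0#
          x≉0 z = 1≉0 (trans (sym e) (trans (*-congʳ z) (zeroˡ y)))
          x′≉0 : ¬ x′ ≈ 0#
          x′≉0 z = x≉0 (ρ.zero⇐ p′ z)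
          y′ , e′ = inverse x′ x′≉0
      in y′ , ρ.div∈ ρ.1∈ p′ (x≉0 , x′≉0) (trans (*-comm y x) e , trans (*-comm y′ x′) e′)
    domain-generated h (der p) = let _ , p′ = domain-generated h p in _ , ρ.δ∈ p′

    -- The inverse isomorphism carries the range back into L, so the range is a small enough
    -- parameter set for saturation.
    range-injection : Domain ⊆ L.Mem → Injection (subsetSetoid 𝒜 Range) (subsetSetoid 𝒜 L.Mem)
    range-injection dom⊆ = record
      { to = λ (y , x , g) → x , dom⊆ (y , g)
      ; cong = λ { {_ , _ , g} {_ , _ , g′} e → injective g g′ e }
      ; injective = λ { {_ , _ , g} {_ , _ , g′} e → functional g g′ e }
      }

    module _ (A : Pred Carrier ℓ) (A-small : subsetSetoid 𝒜 A ≺ setoid) (range⊆A : Range ⊆ A) where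
      open Generic closed saturated A A-small

      private
        relabel : ∀ n → NestedPoly (Coefficient ρ) n → NestedPoly (Σ Carrier A) n
        relabel = mapNested (λ ((x , y) , g) → y , range⊆A (x , g))

        relabel≡ : ∀ n f → toDiffPoly proj₁ n (relabel n f) ≡ poly₂ ρ n f
        relabel≡ = toDiffPoly-map proj₁ (λ ((x , y) , g) → y , range⊆A (x , g))

      -- A may exceed the range. With A = L the new element is generic over L itself, which is what
      -- moves a constant of L and what later contradicts strong normality.
      find-transcendental : ∃ λ z′ → (∀ n → Transcendental₂ ρ z′ n) ×
        ∀ n (g : NestedPoly (Σ Carrier A) n) → NonZeroPoly 𝒜 n (toDiffPoly proj₁ n g) →
        ¬ evalPoly 𝒜 n (toDiffPoly proj₁ n g) z′ ≈ 0#
      find-transcendental = let z′ , avoid = generic-point in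
        z′ , (λ n f → ≡.subst (λ h → NonZeroPoly 𝒜 n h → ¬ evalPoly 𝒜 n h z′ ≈ 0#) (relabel≡ n f) (avoid n (relabel n f))) , avoid

      find-algebraic : ∀ {z} (a : Algebraic ρ z) → ∃ λ z′ → Algebraic.Root₂ a z′ ×
        ∀ (g : NestedPoly (Σ Carrier A) (Algebraic.order a)) →
        NonZeroPoly 𝒜 (Algebraic.order a) (toDiffPoly proj₁ (Algebraic.order a) g) →
        ¬ evalPoly 𝒜 (Algebraic.order a) (toDiffPoly proj₁ (Algebraic.order a) g) z′ ≈ 0#
      find-algebraic a =
        let open Algebraic a renaming (order to n)
            z′ , root′ , avoid = generic-root n (relabel (suc n) minPoly)
              (≡.subst (HasOrder 𝒜 n) (≡.sym (relabel≡ (suc n) minPoly)) hasOrder)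
        in z′ , ( ≡.subst (λ h → evalPoly 𝒜 (suc n) h z′ ≈ 0#) (relabel≡ (suc n) minPoly) root′
                , λ f → ≡.subst (λ h → NonZeroPoly 𝒜 n h → ¬ evalPoly 𝒜 n h z′ ≈ 0#) (relabel≡ n f) (avoid (relabel n f)))
              , avoid

    record Extended (z z′ : Carrier) : Set (lsuc ℓ) where
      field
        iso      : PartialIso
        extends  : ρ.Graph ⊆ PartialIso.Graph iso
        contains : PartialIso.Graph iso (z , z′)
        domain⊆L : ∀ {v} → PartialIso.Graph iso v → L.Mem (proj₁ v)

    module _ (dom⊆ : ∀ {v} → ρ.Graph v → L.Mem (proj₁ v)) {z z′ : Carrier} (z∈L : L.Mem z) where
      private
        δⁿ∈L : ∀ n → L.Mem (δ^ 𝒜 n z)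
        δⁿ∈L zero    = z∈L
        δⁿ∈L (suc n) = L.δ-closed (δⁿ∈L n)

        L-sub : IsSubring (L.Mem ∘ proj₁)
        L-sub = record
          { respects = L.resp ∘ proj₁ ; 0∈ = L.0-closed ; 1∈ = L.1-closed ; +∈ = L.+-closed
          ; *∈ = L.*-closed ; neg∈ = L.neg-closed }

        L-div : DivisionClosed (L.Mem ∘ proj₁)
        L-div {z , _} {w , _} {r , _} r∈ w∈ (w≉0 , _) (e , _) =
          let y , wy≈1 = inverse w w≉0
          in L.resp (quotient wy≈1 e) (L.*-closed r∈ (L.inv-closed w∈ wy≈1))

      extended : ∀ {P} → Adjoin.ExtensionBy ρ (z , z′) P → Extended z z′
      extended E = record
        { iso = iso ; extends = extends ; contains = contains
        ; domain⊆L = generated L-sub L-div dom⊆ (λ i _ → δⁿ∈L i) }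
        where open Adjoin.ExtensionBy E

  -- One step of quantifier elimination: z is either differentially transcendental over the domain
  -- or a generic zero of its minimal polynomial, and saturation supplies z′ of the same kind over
  -- the range.
  extend : ∀ ρ → (∀ {v} → PartialIso.Graph ρ v → L.Mem (proj₁ v)) → ∀ {z} → L.Mem z → ∃ λ z′ → Extended ρ z z′
  extend ρ dom⊆ {z} z∈ with classify ρ z
  ... | inj₁ t = let z′ , t′ , _ = find-transcendental ρ (Range ρ) (small (range-injection ρ (dom⊆ ∘ proj₂))) id
                 in z′ , extended ρ dom⊆ z∈ (Adjoin.adjoin-transcendental ρ _ t t′)
  ... | inj₂ a = let z′ , r , _ = find-algebraic ρ (Range ρ) (small (range-injection ρ (dom⊆ ∘ proj₂))) id a
                 in z′ , extended ρ dom⊆ z∈ (Adjoin.adjoin-algebraic ρ _ a r)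

  extend-all : ∀ ρ → (∀ {v} → PartialIso.Graph ρ v → L.Mem (proj₁ v)) →
    ∀ k (a : Vector Carrier k) → (∀ i → L.Mem (a i)) →
    ∃ λ ρ′ → (PartialIso.Graph ρ ⊆ PartialIso.Graph ρ′) × (∀ i → Domain ρ′ (a i))
  extend-all ρ dom⊆ zero    a a∈ = ρ , id , λ ()
  extend-all ρ dom⊆ (suc k) a a∈ =
    let z′ , E = extend ρ dom⊆ (a∈ fzero)
        open Extended E
        ρ′ , ext′ , total = extend-all iso domain⊆L k (a ∘ fsuc) (a∈ ∘ fsuc)
    in ρ′ , ext′ ∘ extends , λ { fzero → z′ , ext′ contains ; (fsuc i) → total i }

  module _ (ρ : PartialIso) (K-fixed : ∀ {x} → K.Mem x → PartialIso.Graph ρ (x , x)) (total : L.Mem ⊆ Domain ρ) where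
    private
      module ρ = PartialIso ρ
      image : Σ Carrier L.Mem → Carrier
      image (x , x∈) = proj₁ (total x∈)

      graph : ∀ x → ρ.Graph (proj₁ x , image x)
      graph (x , x∈) = proj₂ (total x∈)

    homOver : HomOver 𝒜 K L
    homOver = record
      { embedding = record
        { ⟦_⟧ = image
        ; isRingMonomorphism = record
          { isRingHomomorphism = record
            { isSemiringHomomorphism = record
              { isNearSemiringHomomorphism = record
                { +-isMonoidHomomorphism = record
                  { isMagmaHomomorphism = record
                    { isRelHomomorphism = record { cong = λ {x} {y} → functional ρ (graph x) (graph y) }
                    ; homo = λ x y → functional ρ (graph _) (ρ.+∈ (graph x) (graph y)) refl
                    }
                  ; ε-homo = functional ρ (graph _) ρ.0∈ refl
                  }
                ; *-homo = λ x y → functional ρ (graph _) (ρ.*∈ (graph x) (graph y)) refl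
                }
              ; 1#-homo = functional ρ (graph _) ρ.1∈ refl
              }
            ; -‿homo = λ x → functional ρ (graph _) (ρ.neg∈ (graph x)) refl
            }
          ; injective = λ {x} {y} → injective ρ (graph x) (graph y)
          }
        ; δ-homo = λ x → functional ρ (graph _) (ρ.δ∈ (graph x)) refl
        }
      ; fixes = λ x x∈K → functional ρ (graph x) (K-fixed x∈K) refl
      }

    homOver-graph : ∀ x → ρ.Graph (proj₁ x , HomOver.⟦_⟧ homOver x)
    homOver-graph = graph

  diagonal : DifferentialSubfield 𝒜 → PartialIso
  diagonal M = record
    { Graph = λ (x , y) → M.Mem x × x ≈ y
    ; isSubring = record
      { respects = λ (e , e′) (m , p) → M.resp e m , trans (sym e) (trans p e′)
      ; 0∈ = M.0-closed , refl ; 1∈ = M.1-closed , refl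
      ; +∈ = λ (m , p) (n , q) → M.+-closed m n , +-cong p q
      ; *∈ = λ (m , p) (n , q) → M.*-closed m n , *-cong p q
      ; neg∈ = λ (m , p) → M.neg-closed m , -‿cong p
      }
    ; δ∈ = λ (m , p) → M.δ-closed m , δ-cong p
    ; div∈ = λ { {z , z′} {w , w′} {r , r′} (r∈ , p) (w∈ , q) (w≉0 , _) (e , e′) →
        let y , wy≈1 = inverse w w≉0
            w′y≈1 = trans (*-congʳ (sym q)) wy≈1
        in M.resp (quotient wy≈1 e) (M.*-closed r∈ (M.inv-closed w∈ wy≈1)) ,
           trans (sym (quotient wy≈1 e)) (trans (*-congʳ p) (quotient w′y≈1 e′)) }
    ; zero⇒ = λ (_ , p) z → trans (sym p) z
    ; zero⇐ = λ (_ , p) z → trans p z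
    }
    where module M = DifferentialSubfield M

  module _ (fg : FinitelyGenerated 𝒜 K L) where
    private
      k = proj₁ fg
      a = proj₁ (proj₂ fg)
      L≐ = proj₂ (proj₂ fg)

    generator∈L : ∀ i → L.Mem (a i)
    generator∈L i = proj₂ L≐ (gen (inj₂ (i , refl)))

    -- L is generated over K by finitely many elements, and the domain of a partial isomorphism is a
    -- differential field, so finitely many one-element extensions reach all of L.
    hom-extending : ∀ ρ → (∀ {x} → K.Mem x → PartialIso.Graph ρ (x , x)) →
      (∀ {v} → PartialIso.Graph ρ v → L.Mem (proj₁ v)) →
      ∃ λ (τ : HomOver 𝒜 K L) → ∀ x {y} → PartialIso.Graph ρ (proj₁ x , y) → HomOver.⟦_⟧ τ x ≈ y
    hom-extending ρ K-fixed dom⊆ =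
      let ρ′ , ext , total = extend-all ρ dom⊆ k a generator∈L
          total′ : L.Mem ⊆ Domain ρ′
          total′ x∈ = domain-generated ρ′
            (λ { (inj₁ x∈K) → _ , ext (K-fixed x∈K)
               ; (inj₂ (i , e)) → let y , g = total i in y , PartialIso.respects ρ′ (e , refl) g })
            (proj₁ L≐ x∈)
      in homOver ρ′ (ext ∘ K-fixed) total′ ,
         λ x g → functional ρ′ (homOver-graph ρ′ (ext ∘ K-fixed) total′ x) (ext g) refl

    private
      ρK = diagonal K

      -- The value at c of the quotient of p by X − c is that of the formal derivative of p.
      module _ (c : Carrier) where
        ev : List Carrier → Carrier → Carrier
        ev = evalPoly 𝒜 1

        quot : List Carrier → List Carrier
        quot []      = []
        quot (a ∷ p) = ev p c ∷ quot p

        ev-quot : ∀ p x → ev p x ≈ (x + - c) * ev (quot p) x + ev p c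
        ev-quot []      x = solve 2 (λ x c → :0 := (x :+ (:- c)) :* :0 :+ :0) refl x c
        ev-quot (a ∷ p) x = trans (+-congˡ (*-congˡ (ev-quot p x)))
          (solve 5 (λ a x c h p → a :+ x :* ((x :+ (:- c)) :* h :+ p) := (x :+ (:- c)) :* (p :+ x :* h) :+ (a :+ c :* p))
            refl a x c (ev (quot p) x) (ev p c))

        -- `scaled 1 p` is the formal derivative of a + X p for every constant term a. By
        -- `ev-scaled` its value at c is the value at c of the quotient of a + X p by X - c.
        scaled : ℕ → List Carrier → List Carrier
        scaled j []      = []
        scaled j (a ∷ p) = (j · 1#) * a ∷ scaled (suc j) p

        ev-scaled : ∀ j p → ev (scaled j p) c ≈ (j · 1#) * ev p c + c * ev (quot p) c
        ev-scaled j []      = solve 2 (λ j c → :0 := j :* :0 :+ c :* :0) refl (j · 1#) c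
        ev-scaled j (a ∷ p) = trans (+-congˡ (*-congˡ (ev-scaled (suc j) p)))
          (solve 5 (λ j a c p h → j :* a :+ c :* ((:1 :+ j) :* p :+ c :* h) := j :* (a :+ c :* p) :+ c :* (p :+ c :* h))
            refl (j · 1#) a c (ev p c) (ev (quot p) c))

        quot-nonZero : ∀ a g l → ¬ l ≈ 0# → Any (NonZeroPoly 𝒜 0) (quot (a ∷ g ++ l ∷ []))
        quot-nonZero a []      l l≉0 = here (λ e → l≉0 (trans (solve 2 (λ l c → l := l :+ c :* :0) refl l c) e))
        quot-nonZero a (b ∷ g) l l≉0 = there (quot-nonZero b g l l≉0)

      scaledC : ℕ → List (Coefficient ρK) → List (Coefficient ρK)
      scaledC j []      = []
      scaledC j (((x , y) , p) ∷ f) =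
        (((j · 1#) * x , (j · 1#) * y) , K.*-closed (·∈K j) (proj₁ p) , *-congˡ (proj₂ p)) ∷ scaledC (suc j) f
        where
          ·∈K : ∀ j → K.Mem (j · 1#)
          ·∈K zero    = K.0-closed
          ·∈K (suc j) = K.+-closed K.1-closed (·∈K j)

      length-scaledC : ∀ j f → length (scaledC j f) ≡ length f
      length-scaledC j []      = ≡.refl
      length-scaledC j (_ ∷ f) = ≡.cong suc (length-scaledC (suc j) f)

      scaledC-snoc : ∀ j g l → ∃ λ l′ → scaledC j (g ++ l ∷ []) ≡ scaledC j g ++ l′ ∷ []
                     × proj₁ (proj₁ l′) ≡ ((length g ℕ.+ j) · 1#) * proj₁ (proj₁ l)
      scaledC-snoc j []      l = _ , ≡.refl , ≡.refl
      scaledC-snoc j (a ∷ g) l = let l′ , e , e′ = scaledC-snoc (suc j) g l in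
        l′ , ≡.cong (_ ∷_) e , ≡.trans e′ (≡.cong (λ k → (k · 1#) * proj₁ (proj₁ l)) (ℕ.+-suc (length g) j))

      poly₁-scaledC : ∀ c j f → poly₁ ρK 1 (scaledC j f) ≡ scaled c j (poly₁ ρK 1 f)
      poly₁-scaledC c j []      = ≡.refl
      poly₁-scaledC c j (_ ∷ f) = ≡.cong (_ ∷_) (poly₁-scaledC c (suc j) f)

      poly₁≈poly₂ : ∀ f x → evalPoly 𝒜 1 (poly₂ ρK 1 f) x ≈ evalPoly 𝒜 1 (poly₁ ρK 1 f) x
      poly₁≈poly₂ []                  x = refl
      poly₁≈poly₂ ((_ , _ , p) ∷ f) x = +-cong (sym p) (*-congˡ (poly₁≈poly₂ f x))

      -- The minimal polynomial of c has a simple root at c, hence another root.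
      other-root : ∀ c → ¬ K.Mem c → (a : Algebraic ρK c) → Algebraic.order a ≡ 0 →
                   ∃ λ c′ → ¬ c′ ≈ c × Algebraic.Root₂ a c′
      other-root c c∉K a@record { order = zero ; degree = d ; lower = g₀ ; leading = l ; length-lower = len
                                ; leading≢0 = l≉0 ; root = root ; minimal = minimal } ≡.refl
        = go g₀ len root
        where
          go : ∀ g → length g ≡ d → evalPoly 𝒜 1 (poly₁ ρK 1 (g ++ l ∷ [])) c ≈ 0# →
               ∃ λ c′ → ¬ c′ ≈ c × evalPoly 𝒜 1 (poly₂ ρK 1 (g ++ l ∷ [])) c′ ≈ 0# × Transcendental₂ ρK c′ 0
          go [] len e = contradiction (trans (solve 2 (λ l c → l := l :+ c :* :0) refl (proj₁ (proj₁ l)) c) e) l≉0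
          -- Degree 1: c = -b / l would lie in K.
          go (b ∷ []) len e =
            let ((b₁ , _) , b∈ , _) = b
                ((l₁ , _) , l∈ , _) = l
                y , ly≈1 = inverse l₁ l≉0
                c≈ : - b₁ * y ≈ c
                c≈ = begin
                  - b₁ * y                          ≈⟨ solve 3 (λ b y t → (:- b) :* y := (t :+ (:- (b :+ t))) :* y) refl b₁ y (c * (l₁ + c * 0#)) ⟩
                  (c * (l₁ + c * 0#) + - (b₁ + c * (l₁ + c * 0#))) * y ≈⟨ *-congʳ (+-congˡ (-‿cong e)) ⟩
                  (c * (l₁ + c * 0#) + - 0#) * y    ≈⟨ solve 3 (λ c l y → (c :* (l :+ c :* :0) :+ (:- :0)) :* y := c :* (l :* y)) refl c l₁ y ⟩
                  c * (l₁ * y)                      ≈⟨ trans (*-congˡ ly≈1) (*-identityʳ c) ⟩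
                  c                                 ∎
            in contradiction (K.resp c≈ (K.*-closed (K.neg-closed b∈) (K.inv-closed l∈ ly≈1))) c∉K
            where open SetoidReasoning setoid
          go (b ∷ b′ ∷ g) len e =
            let f  = poly₁ ρK 1 (b ∷ b′ ∷ g ++ l ∷ [])
                l₁ = proj₁ (proj₁ l)
                h  = quot c f
                h-order : HasOrder 𝒜 0 h
                h-order = ≡.subst (λ p → Any (NonZeroPoly 𝒜 0) (quot c (proj₁ (proj₁ b′) ∷ p)))
                            (≡.sym (List.map-++ (proj₁ ∘ proj₁) g (l ∷ [])))
                            (quot-nonZero c (proj₁ (proj₁ b′)) (List.map (proj₁ ∘ proj₁) g) l₁ l≉0)
                -- Blum's axiom for n = 0 gives a root of the nonconstant quotient, hence another
                -- zero of f unless it is c again.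
                c′ , hc′≈0 , _ = closed 0 h 1# h-order 1≉0
                fc′≈0 : ev c f c′ ≈ 0#
                fc′≈0 = trans (ev-quot c f c′) (trans (+-cong (*-congˡ hc′≈0) e)
                          (solve 1 (λ x → x :* :0 :+ :0 := :0) refl (c′ + - c)))
                lead , snoc≡ , lead≡ = scaledC-snoc 1 (b′ ∷ g) l
                hc≈ : ev c h c ≈ ev c (scaled c 1 (poly₁ ρK 1 (b′ ∷ g ++ l ∷ []))) c
                hc≈ = trans (+-congʳ (solve 1 (λ p → p := (:1 :+ :0) :* p) refl (ev c (poly₁ ρK 1 (b′ ∷ g ++ l ∷ [])) c))) (sym (ev-scaled c 1 (poly₁ ρK 1 (b′ ∷ g ++ l ∷ []))))
                ≡hc : evalPoly 𝒜 1 (poly₁ ρK 1 (scaledC 1 (b′ ∷ g) ++ lead ∷ [])) c ≡ ev c (scaled c 1 (poly₁ ρK 1 (b′ ∷ g ++ l ∷ []))) c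
                ≡hc = ≡.cong (λ p → ev c p c) (≡.trans (≡.cong (poly₁ ρK 1) (≡.sym snoc≡)) (poly₁-scaledC c 1 (b′ ∷ g ++ l ∷ [])))
                -- The value is that of the derivative of f at c. If it were 0, the derivative would
                -- be a relation of smaller degree, with leading coefficient a positive multiple of
                -- l.
                hc≉0 : ¬ ev c h c ≈ 0#
                hc≉0 z = minimal (suc (length g)) (ℕ.≤-reflexive len)
                  ( scaledC 1 (b′ ∷ g) , lead , length-scaledC 1 (b′ ∷ g)
                  , (λ q → *-≉0 (charZero (length g ℕ.+ 1)) l≉0 (trans (sym (reflexive lead≡)) q))
                  , trans (reflexive ≡hc) (trans (sym hc≈) z))
            in c′ , (λ c′≈c → hc≉0 (trans (sym (ev-cong c h c′≈c)) hc′≈0)) ,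
               trans (poly₁≈poly₂ (b ∷ b′ ∷ g ++ l ∷ []) c′) fc′≈0 , λ _ p → p
            where
              ev-cong : ∀ c h {x y} → x ≈ y → ev c h x ≈ ev c h y
              ev-cong c []      e = refl
              ev-cong c (a ∷ h) e = +-congˡ (*-cong e (ev-cong c h e))

      module _ {c : Carrier} (c∈L : L.Mem c) where
        -- The polynomial X - c at every nesting depth, to be fed to the genericity over L: an
        -- element that does not annul it differs from c.
        X-c : ∀ n → NestedPoly (Σ Carrier L.Mem) (suc n)
        X-c zero    = (- c , L.neg-closed c∈L) ∷ (1# , L.1-closed) ∷ []
        X-c (suc n) = X-c n ∷ []

        X-c≉0 : ∀ n → NonZeroPoly 𝒜 (suc n) (toDiffPoly proj₁ (suc n) (X-c n))
        X-c≉0 zero    = there (here 1≉0)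
        X-c≉0 (suc n) = here (X-c≉0 n)

        eval-X-c : ∀ n x → evalPoly 𝒜 (suc n) (toDiffPoly proj₁ (suc n) (X-c n)) x ≈ x + - c
        eval-X-c zero    x = solve 2 (λ x c → (:- c) :+ x :* (:1 :+ x :* :0) := x :+ (:- c)) refl x c
        eval-X-c (suc n) x = trans (+-cong (eval-X-c n x) (zeroʳ _)) (+-identityʳ _)

    private
      avoids : ∀ {c} (c∈L : L.Mem c) n {x} → ¬ evalPoly 𝒜 (suc n) (toDiffPoly proj₁ (suc n) (X-c c∈L n)) x ≈ 0# → ¬ x ≈ c
      avoids {c} c∈L n {x} p e = p (trans (eval-X-c c∈L n x) (trans (+-congʳ e) (-‿inverseʳ c)))

      range⊆L : Range ρK ⊆ L.Mem
      range⊆L (x , x∈K , e) = K⊆L (K.resp e x∈K)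

    -- If c is transcendental, or its minimal polynomial has positive order, a conjugate generic
    -- over L avoids X - c, a polynomial of lower order. In order 0 genericity says nothing about X
    -- - c, and a second root of the minimal polynomial is taken.
    moved : ∀ {c} → L.Mem c → ¬ K.Mem c → ∃ λ c′ → ¬ c′ ≈ c × Extended ρK c c′
    moved {c} c∈L c∉K with classify ρK c
    ... | inj₁ t = let c′ , t′ , avoid = find-transcendental ρK L.Mem L-small range⊆L
                   in c′ , avoids c∈L 0 (avoid 1 (X-c c∈L 0) (X-c≉0 c∈L 0)) ,
                      extended ρK (K⊆L ∘ proj₁) c∈L (Adjoin.adjoin-transcendental ρK _ t t′)
    ... | inj₂ a = go a (Algebraic.order a) ≡.refl
      where
        go : (a : Algebraic ρK c) → ∀ n → Algebraic.order a ≡ n → ∃ λ c′ → ¬ c′ ≈ c × Extended ρK c c′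
        go a zero    e = let c′ , c′≉c , r = other-root c c∉K a e
                         in c′ , c′≉c , extended ρK (K⊆L ∘ proj₁) c∈L (Adjoin.adjoin-algebraic ρK _ a r)
        go a@record { order = suc n } (suc n) ≡.refl =
          let c′ , r , avoid = find-algebraic ρK L.Mem L-small range⊆L a
          in c′ , avoids c∈L n (avoid (X-c c∈L n) (X-c≉0 c∈L n)) ,
             extended ρK (K⊆L ∘ proj₁) c∈L (Adjoin.adjoin-algebraic ρK _ a r)

    constants⊆K : (∀ τ → Strong 𝒜 K L τ) → ∀ {c} → L.Mem c → δ c ≈ 0# → K.Mem c
    constants⊆K strong {c} c∈L δc≈0 = stable λ c∉K →
      let c′ , c′≉c , E = moved c∈L c∉K
          open Extended E
          τ , τ-graph = hom-extending iso (λ x∈ → extends (x∈ , refl)) domain⊆L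
      in c′≉c (trans (sym (τ-graph (c , c∈L) contains)) (proj₁ (strong τ) (c , c∈L) (c∈L , δc≈0)))

-- Polynomials in several elements with bounded degree in each

module BoxTheory {ℓ} (R : CommutativeRing ℓ ℓ) where
  open CommutativeRing R hiding (zero)
  open RingSolver R
  open SubringTheory R
  open Exp commutativeSemiring using (_^_)

  -- Polynomials over F in b, of degree ≤ D in each variable.
  Box : Pred Carrier ℓ → ∀ {n} → Vector Carrier n → ℕ → Pred Carrier ℓ
  Box F {zero}  b D = F
  Box F {suc n} b D = Deg (Box F (b ∘ fsuc) D) (b fzero) (suc D)

  module _ {F : Pred Carrier ℓ} (F-sub : IsSubring F) where
    private module F = IsSubring F-sub

    box-isSubmonoid : ∀ {n} (b : Vector Carrier n) D → IsSubmonoid (Box F b D)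
    box-isSubmonoid {zero}  b D = F.isSubmonoid
    box-isSubmonoid {suc n} b D = record { respects = deg-resp (suc D) ; 0∈ = deg-0 (suc D) ; +∈ = deg-+ (suc D) }
      where open DegProperties (box-isSubmonoid (b ∘ fsuc) D) (b fzero)

    box-≤ : ∀ {n} (b : Vector Carrier n) {D D′} → D ≤ D′ → Box F b D ⊆ Box F b D′
    box-≤ {zero}  b D≤ p = p
    box-≤ {suc n} b {D} {D′} D≤ p = deg-≤ (s≤s D≤) (deg-⊆ (box-≤ (b ∘ fsuc) D≤) (suc D) p)
      where open DegProperties (box-isSubmonoid (b ∘ fsuc) D′) (b fzero)

    box-const : ∀ {n} (b : Vector Carrier n) D {c} → F c → Box F b D c
    box-const {zero}  b D p = p
    box-const {suc n} b D p = deg-const D (box-const (b ∘ fsuc) D p)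
      where open DegProperties (box-isSubmonoid (b ∘ fsuc) D) (b fzero)

    box-* : ∀ {n} (b : Vector Carrier n) {D D′ v w} → Box F b D v → Box F b D′ w → Box F b (D ℕ.+ D′) (v * w)
    box-* {zero}  b p q = F.*∈ p q
    box-* {suc n} b {D} {D′} p q = deg-* (box-isSubmonoid (b ∘ fsuc) (D ℕ.+ D′)) (box-* (b ∘ fsuc)) (suc D) D′ p q

    box-var : ∀ {n} (b : Vector Carrier n) i → Box F b 1 (b i)
    box-var {suc n} b fzero = deg-resp 2 (*-identityʳ (b fzero)) (deg-shift 1 (deg-const 0 (box-const (b ∘ fsuc) 1 F.1∈)))
      where open DegProperties (box-isSubmonoid (b ∘ fsuc) 1) (b fzero)
    box-var {suc n} b (fsuc i) = deg-const 1 (box-var (b ∘ fsuc) i)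
      where open DegProperties (box-isSubmonoid (b ∘ fsuc) 1) (b fzero)

    box-respects : ∀ {n} (b : Vector Carrier n) D → Box F b D Respects _≈_
    box-respects b D = IsSubmonoid.respects (box-isSubmonoid b D)

    SomeBox : ∀ {n} → Vector Carrier n → Pred Carrier ℓ
    SomeBox b v = ∃ λ D → Box F b D v

    someBox-isSubring : ∀ {n} (b : Vector Carrier n) → IsSubring (SomeBox b)
    someBox-isSubring b = record
      { respects = λ e (D , p) → D , box-respects b D e p
      ; 0∈ = 0 , box-const b 0 F.0∈
      ; 1∈ = 0 , box-const b 0 F.1∈
      ; +∈ = λ (D , p) (D′ , q) → D ℕ.+ D′ , IsSubmonoid.+∈ (box-isSubmonoid b (D ℕ.+ D′))
               (box-≤ b (ℕ.m≤m+n D D′) p) (box-≤ b (ℕ.m≤n+m D′ D) q)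
      ; *∈ = λ (D , p) (D′ , q) → D ℕ.+ D′ , box-* b p q
      ; neg∈ = λ {x} (D , p) → D , box-respects b D (solve 1 (λ x → (:- :1) :* x := :- x) refl x)
               (box-* b (box-const b 0 (F.neg∈ F.1∈)) p)
      }

    common-degree : ∀ {n} (b : Vector Carrier n) k {v : Vector Carrier k} → (∀ i → SomeBox b (v i)) → ∃ λ κ → ∀ i → Box F b κ (v i)
    common-degree b zero    h = 0 , λ ()
    common-degree b (suc k) h =
      let D , p = h fzero
          κ , q = common-degree b k (h ∘ fsuc)
      in D ℕ.+ κ , λ { fzero → box-≤ b (ℕ.m≤m+n D κ) p ; (fsuc i) → box-≤ b (ℕ.m≤n+m κ D) (q i) }

    module _ {m n} (b : Vector Carrier m) (y : Vector Carrier n) (κ : ℕ) {q : Carrier}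
             (q∈ : Box F b κ q) (yq∈ : ∀ i → Box F b κ (y i * q)) where

      private
        step : ∀ {A : Pred Carrier ℓ} {u} e → Box F b κ (u * q) → (∀ {a} → A a → Box F b (e ℕ.* κ) (q ^ e * a)) →
               ∀ k {v} → Deg A u (suc k) v → Box F b ((k ℕ.+ e) ℕ.* κ) (q ^ (k ℕ.+ e) * v)
        step {u = u} e uq A⇒ zero {v} (a , w , a∈ , w≈0 , p) = box-respects b (e ℕ.* κ)
          (*-congˡ (sym (trans p (trans (+-congˡ (*-congˡ w≈0)) (solve 2 (λ a u → a :+ u :* :0 := a) refl a u))))) (A⇒ a∈)
        step {A} {u} e uq A⇒ (suc k) {v} (a , w , a∈ , w∈ , p) = box-respects b ((suc k ℕ.+ e) ℕ.* κ)
          (trans (solve 6 (λ q t s a u w → q :* t :* a :+ u :* q :* (t :* w) := q :* t :* (a :+ u :* w)) refl q (q ^ (k ℕ.+ e)) (q ^ e) a u w)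
                 (*-congˡ (sym p)))
          (IsSubmonoid.+∈ (box-isSubmonoid b ((suc k ℕ.+ e) ℕ.* κ))
            (low (suc k) a∈)
            (box-* b uq (step e uq A⇒ k w∈)))
          where
            low : ∀ k {a} → A a → Box F b ((k ℕ.+ e) ℕ.* κ) (q ^ (k ℕ.+ e) * a)
            low zero    a∈ = A⇒ a∈
            low (suc k) {a} a∈ = box-respects b ((suc k ℕ.+ e) ℕ.* κ) (sym (*-assoc q (q ^ (k ℕ.+ e)) a)) (box-* b q∈ (low k a∈))

      -- Each of the n variables contributes at most D factors yᵢ, and each factor absorbs one q.
      -- Since q and all yᵢ q have degree at most κ, the result has degree at most n D κ.
      clear-denominators : ∀ D {v} → Box F y D v → Box F b (n ℕ.* D ℕ.* κ) (q ^ (n ℕ.* D) * v)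
      clear-denominators = go n y yq∈
        where
          go : ∀ n (y : Vector Carrier n) → (∀ i → Box F b κ (y i * q)) →
               ∀ D {v} → Box F y D v → Box F b (n ℕ.* D ℕ.* κ) (q ^ (n ℕ.* D) * v)
          go zero    y yq∈ D p = box-const b 0 (F.*∈ F.1∈ p)
          go (suc n) y yq∈ D p = step (n ℕ.* D) (yq∈ fzero) (go n (y ∘ fsuc) (yq∈ ∘ fsuc) D) D p

-- Linear independence over a subfield, and counting monomials

module LinearAlgebra (em : ∀ {a} → ExcludedMiddle a) {ℓ} (𝒜 : DifferentialField ℓ) where
  open DifferentialField 𝒜 hiding (zero)
  open Classical em
  open DifferentialPolynomials em 𝒜 using (integral; *-≉0)
  open RingSolver commutativeRing
  open SubringTheory commutativeRing
  open BoxTheory commutativeRing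

  lc : List Carrier → List Carrier → Carrier
  lc (c ∷ cs) (v ∷ vs) = c * v + lc cs vs
  lc _        _        = 0#

  lc-++ : ∀ cs ds vs ws → length cs ≡ length vs → lc (cs ++ ds) (vs ++ ws) ≈ lc cs vs + lc ds ws
  lc-++ []       ds []       ws e = sym (+-identityˡ _)
  lc-++ (c ∷ cs) ds (v ∷ vs) ws e = trans (+-congˡ (lc-++ cs ds vs ws (ℕ.suc-injective e))) (sym (+-assoc _ _ _))

  lc-map : ∀ u cs vs → lc cs (List.map (u *_) vs) ≈ u * lc cs vs
  lc-map u []       vs       = sym (zeroʳ u)
  lc-map u (c ∷ cs) []       = sym (zeroʳ u)
  lc-map u (c ∷ cs) (v ∷ vs) = trans (+-congˡ (lc-map u cs vs))
    (solve 4 (λ c u v s → c :* (u :* v) :+ u :* s := u :* (c :* v :+ s)) refl c u v (lc cs vs))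

  lc-zero : ∀ cs vs → All (_≈ 0#) cs → lc cs vs ≈ 0#
  lc-zero []       vs       _        = refl
  lc-zero (c ∷ cs) []       _        = refl
  lc-zero (c ∷ cs) (v ∷ vs) (p ∷ ps) = trans (+-cong (trans (*-congʳ p) (zeroˡ v)) (lc-zero cs vs ps)) (+-identityˡ 0#)

  split-length : ∀ {A : Set ℓ} (vs ws : List A) (cs : List Carrier) → length cs ≡ length (vs ++ ws) →
    ∃ λ cs₁ → ∃ λ cs₂ → cs ≡ cs₁ ++ cs₂ × length cs₁ ≡ length vs × length cs₂ ≡ length ws
  split-length []       ws cs       e = [] , cs , ≡.refl , ≡.refl , e
  split-length (v ∷ vs) ws (c ∷ cs) e =
    let cs₁ , cs₂ , p , q , r = split-length vs ws cs (ℕ.suc-injective e)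
    in c ∷ cs₁ , cs₂ , ≡.cong (c ∷_) p , ≡.cong suc q , r

  -- The products uⁱ w with i < k and w in ws; iterated over the variables this lists all monomials
  -- of a box.
  powers : List Carrier → Carrier → ℕ → List Carrier
  powers ws u zero    = []
  powers ws u (suc k) = ws ++ List.map (u *_) (powers ws u k)

  length-powers : ∀ ws u k → length (powers ws u k) ≡ k ℕ.* length ws
  length-powers ws u zero    = ≡.refl
  length-powers ws u (suc k) = ≡.trans (List.length-++ ws)
    (≡.cong (length ws ℕ.+_) (≡.trans (List.length-map (u *_) (powers ws u k)) (length-powers ws u k)))

  module _ (F : DifferentialSubfield 𝒜) where
    private module F = DifferentialSubfield F

    F-isSubring : IsSubring F.Mem
    F-isSubring = record
      { respects = F.resp ; 0∈ = F.0-closed ; 1∈ = F.1-closed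
      ; +∈ = F.+-closed ; *∈ = F.*-closed ; neg∈ = F.neg-closed }

    Span : List Carrier → Pred Carrier ℓ
    Span ms v = ∃ λ cs → All F.Mem cs × length cs ≡ length ms × v ≈ lc cs ms

    Independent : List Carrier → Set ℓ
    Independent vs = ∀ cs → All F.Mem cs → length cs ≡ length vs → lc cs vs ≈ 0# → All (_≈ 0#) cs

    private
      zeros : List Carrier → List Carrier
      zeros = List.map (const 0#)

      zeros∈ : ∀ vs → All F.Mem (zeros vs)
      zeros∈ []       = []
      zeros∈ (_ ∷ vs) = F.0-closed ∷ zeros∈ vs

      zeros≈0 : ∀ vs → All (_≈ 0#) (zeros vs)
      zeros≈0 []       = []
      zeros≈0 (_ ∷ vs) = refl ∷ zeros≈0 vs

      add-lc : ∀ ms {v w} → Span ms v → Span ms w → ∀ t → F.Mem t → Span ms (v + t * w)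
      add-lc [] ([] , _ , _ , p) ([] , _ , _ , q) t t∈ = [] , [] , ≡.refl ,
        trans (+-cong p (*-congˡ q)) (solve 1 (λ t → :0 :+ t :* :0 := :0) refl t)
      add-lc (m ∷ ms) (c ∷ cs , c∈ ∷ cs∈ , e , p) (d ∷ ds , d∈ ∷ ds∈ , e′ , q) t t∈ =
        let es , es∈ , e″ , r = add-lc ms (cs , cs∈ , ℕ.suc-injective e , refl) (ds , ds∈ , ℕ.suc-injective e′ , refl) t t∈
        in c + t * d ∷ es , F.+-closed c∈ (F.*-closed t∈ d∈) ∷ es∈ , ≡.cong suc e″ ,
           trans (+-cong p (*-congˡ q)) (trans (collect c m (lc cs ms) t d (lc ds ms)) (+-congˡ r))
        where
          collect : ∀ c m s t d r → c * m + s + t * (d * m + r) ≈ (c + t * d) * m + (s + t * r)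
          collect = solve 6 (λ c m s t d r → c :* m :+ s :+ t :* (d :* m :+ r) := (c :+ t :* d) :* m :+ (s :+ t :* r)) refl

      pivot : ∀ m ms vs → All (Span (m ∷ ms)) vs → All (Span ms) vs ⊎
        ∃ λ xs → ∃ λ p → ∃ λ ys → vs ≡ xs ++ p ∷ ys × ∃ λ c → F.Mem c × ¬ c ≈ 0# × ∃ λ r → Span ms r × p ≈ c * m + r
      pivot m ms []       []       = inj₁ []
      pivot m ms (v ∷ vs) ((c ∷ cs , c∈ ∷ cs∈ , e , p) ∷ qs) with decide (c ≈ 0#) | pivot m ms vs qs
      ... | no c≉0 | _ = inj₂ ([] , v , vs , ≡.refl , c , c∈ , c≉0 , lc cs ms , (cs , cs∈ , ℕ.suc-injective e , refl) , p)
      ... | yes c≈0 | inj₁ rs = inj₁ ((cs , cs∈ , ℕ.suc-injective e ,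
              trans p (trans (+-congʳ (trans (*-congʳ c≈0) (zeroˡ m))) (+-identityˡ _))) ∷ rs)
      ... | yes _ | inj₂ (xs , p′ , ys , eq , rest) = inj₂ (v ∷ xs , p′ , ys , ≡.cong (v ∷_) eq , rest)

      -- Each v is changed by a multiple of the pivot p so as to lose its m-component. The last
      -- clause turns a relation among the changed vectors into one among the old ones and p.
      eliminate : ∀ m ms {p c r} → F.Mem c → ¬ c ≈ 0# → Span ms r → p ≈ c * m + r → ∀ vs → All (Span (m ∷ ms)) vs →
        ∃ λ vs′ → length vs′ ≡ length vs × All (Span ms) vs′ ×
        (∀ ds → All F.Mem ds → ∃ λ e → F.Mem e × lc ds vs′ ≈ lc ds vs + e * p)
      eliminate m ms c∈ c≉0 r∈ p≈ [] [] = [] , ≡.refl , [] , λ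
        { [] _ → 0# , F.0-closed , solve 1 (λ p → :0 := :0 :+ :0 :* p) refl _
        ; (_ ∷ _) _ → 0# , F.0-closed , solve 1 (λ p → :0 := :0 :+ :0 :* p) refl _ }
      eliminate m ms {p} {c} {r} c∈ c≉0 r∈ p≈ (v ∷ vs) ((a ∷ as , a∈ ∷ as∈ , len , q) ∷ qs) =
        let vs′ , e , all , h = eliminate m ms c∈ c≉0 r∈ p≈ vs qs
            y , cy≈1 = inverse c c≉0
            t = - (a * y)
            t∈ = F.neg-closed (F.*-closed a∈ (F.inv-closed c∈ cy≈1))
            w = lc as ms + t * r
            w≈ : w ≈ v + t * p
            w≈ = let open SetoidReasoning setoid in begin
              lc as ms + t * r
                ≈⟨ solve 5 (λ s a y r m → s :+ (:- (a :* y)) :* r := a :* m :* :1 :+ s :+ (:- (a :* m)) :* :1 :+ (:- (a :* y)) :* r) refl (lc as ms) a y r m ⟩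
              a * m * 1# + lc as ms + (- (a * m)) * 1# + t * r
                ≈⟨ +-congʳ (+-congˡ (*-congˡ (sym cy≈1))) ⟩
              a * m * 1# + lc as ms + (- (a * m)) * (c * y) + t * r
                ≈⟨ solve 6 (λ s a y r m c → a :* m :* :1 :+ s :+ (:- (a :* m)) :* (c :* y) :+ (:- (a :* y)) :* r
                      := a :* m :+ s :+ (:- (a :* y)) :* (c :* m :+ r)) refl (lc as ms) a y r m c ⟩
              a * m + lc as ms + t * (c * m + r)
                ≈⟨ +-cong (sym q) (*-congˡ (sym p≈)) ⟩
              v + t * p ∎
        in w ∷ vs′ , ≡.cong suc e , add-lc ms (as , as∈ , ℕ.suc-injective len , refl) r∈ t t∈ ∷ all , λ
             { [] _ → 0# , F.0-closed , solve 1 (λ p → :0 := :0 :+ :0 :* p) refl p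
             ; (d ∷ ds) (d∈ ∷ ds∈) →
                 let e , e∈ , eq = h ds ds∈
                 in d * t + e , F.+-closed (F.*-closed d∈ t∈) e∈ ,
                    trans (+-cong (*-congˡ w≈) eq) (collect d v t p (lc ds vs) e) }
        where
          collect : ∀ d v t p s e → d * (v + t * p) + (s + e * p) ≈ d * v + s + (d * t + e) * p
          collect = solve 6 (λ d v t p s e → d :* (v :+ t :* p) :+ (s :+ e :* p) := d :* v :+ s :+ (d :* t :+ e) :* p) refl

    -- Gaussian elimination on the spanning vectors: either no v involves m, or one v with nonzero
    -- m-component serves as pivot and is given up to remove m from the others.
    pigeonhole : ∀ ms vs → All (Span ms) vs → length ms < length vs → ¬ Independent vs
    pigeonhole [] (v ∷ vs) (([] , _ , _ , v≈0) ∷ _) _ ind =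
      1≉0 (All.head (ind (1# ∷ zeros vs) (F.1-closed ∷ zeros∈ vs) (≡.cong suc (List.length-map _ vs))
        (trans (+-cong (trans (*-identityˡ v) v≈0) (lc-zero (zeros vs) vs (zeros≈0 vs))) (+-identityˡ 0#))))
    pigeonhole (m ∷ ms) vs all lt ind with pivot m ms vs all
    ... | inj₁ all′ = pigeonhole ms vs all′ (ℕ.<⇒≤ lt) ind
    ... | inj₂ (xs , p , ys , ≡.refl , c , c∈ , c≉0 , r , r∈ , p≈) =
      let all-xs = All.++⁻ˡ xs all
          all-ys = All.tail (All.++⁻ʳ xs all)
          zs , len , all′ , h = eliminate m ms c∈ c≉0 r∈ p≈ (xs ++ ys) (All.++⁺ all-xs all-ys)
          lt′ : length ms < length zs
          lt′ = ≡.subst (length ms <_) (≡.sym len) (ℕ.≤-pred (≡.subst (suc (length ms) <_)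
                  (≡.trans (List.length-++ xs) (≡.trans (ℕ.+-suc (length xs) (length ys)) (≡.cong suc (≡.sym (List.length-++ xs))))) lt))
      in pigeonhole ms zs all′ lt′ λ ds ds∈ e lc≈0 →
           let d₁ , d₂ , ds≡ , e₁ , e₂ = split-length xs ys ds (≡.trans e len)
               t , t∈ , eq = h ds ds∈
               ds∈′ = ≡.subst (All F.Mem) ds≡ ds∈
               -- The relation among the reduced vectors, with the multiples of the pivot collected
               -- in the coefficient t, is a relation among the original ones.
               res = ind (d₁ ++ t ∷ d₂) (All.++⁺ (All.++⁻ˡ d₁ ds∈′) (t∈ ∷ All.++⁻ʳ d₁ ds∈′))
                       (≡.trans (List.length-++ d₁) (≡.trans (≡.cong₂ (λ a b → a ℕ.+ suc b) e₁ e₂) (≡.sym (List.length-++ xs))))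
                       (let open SetoidReasoning setoid in begin
                         lc (d₁ ++ t ∷ d₂) (xs ++ p ∷ ys)        ≈⟨ lc-++ d₁ (t ∷ d₂) xs (p ∷ ys) e₁ ⟩
                         lc d₁ xs + (t * p + lc d₂ ys)           ≈⟨ solve 3 (λ a b c → a :+ (b :+ c) := a :+ c :+ b) refl (lc d₁ xs) (t * p) (lc d₂ ys) ⟩
                         lc d₁ xs + lc d₂ ys + t * p             ≈⟨ +-congʳ (lc-++ d₁ d₂ xs ys e₁) ⟨
                         lc (d₁ ++ d₂) (xs ++ ys) + t * p        ≈⟨ +-congʳ (reflexive (≡.cong (λ l → lc l (xs ++ ys)) (≡.sym ds≡))) ⟩
                         lc ds (xs ++ ys) + t * p                ≈⟨ eq ⟨
                         lc ds zs                                ≈⟨ lc≈0 ⟩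
                         0#                                      ∎)
           in ≡.subst (All (_≈ 0#)) (≡.sym ds≡) (All.++⁺ (All.++⁻ˡ d₁ res) (All.tail (All.++⁻ʳ d₁ res)))

    independent-scale : ∀ {q} vs → ¬ q ≈ 0# → Independent vs → Independent (List.map (q *_) vs)
    independent-scale {q} vs q≉0 ind cs cs∈ len e = ind cs cs∈ (≡.trans len (List.length-map _ vs))
      ([ (λ q≈0 → contradiction q≈0 q≉0) , id ]′ (integral (trans (sym (lc-map q cs vs)) e)))

    monomials : ∀ {n} → Vector Carrier n → ℕ → List Carrier
    monomials {zero}  b D = 1# ∷ []
    monomials {suc n} b D = powers (monomials (b ∘ fsuc) D) (b fzero) (suc D)

    length-monomials : ∀ {n} (b : Vector Carrier n) D → length (monomials b D) ≡ suc D ℕ.^ n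
    length-monomials {zero}  b D = ≡.refl
    length-monomials {suc n} b D = ≡.trans (length-powers (monomials (b ∘ fsuc) D) (b fzero) (suc D)) (≡.cong (suc D ℕ.*_) (length-monomials (b ∘ fsuc) D))

    private
      deg⊆span : ∀ {A : Pred Carrier ℓ} {ms} u → A ⊆ Span ms → ∀ k → Deg A u k ⊆ Span (powers ms u k)
      deg⊆span u A⊆ zero    p = [] , [] , ≡.refl , p
      deg⊆span {ms = ms} u A⊆ (suc k) {v} (a , w , a∈ , w∈ , p) =
        let cs , cs∈ , e , q = A⊆ a∈
            ds , ds∈ , e′ , q′ = deg⊆span u A⊆ k w∈
        in cs ++ ds , All.++⁺ cs∈ ds∈ ,
           ≡.trans (List.length-++ cs) (≡.trans (≡.cong₂ ℕ._+_ e (≡.trans e′ (≡.sym (List.length-map _ (powers ms u k))))) (≡.sym (List.length-++ ms))) ,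
           trans p (trans (+-cong q (trans (*-congˡ q′) (sym (lc-map u ds (powers ms u k))))) (sym (lc-++ cs ds ms _ e)))

    box⊆span : ∀ {n} (b : Vector Carrier n) D → Box F.Mem b D ⊆ Span (monomials b D)
    box⊆span {zero}  b D {v} p = v ∷ [] , p ∷ [] , ≡.refl , solve 1 (λ v → v := v :* :1 :+ :0) refl v
    box⊆span {suc n} b D = deg⊆span (b fzero) (box⊆span (b ∘ fsuc) D) (suc D)

    -- There are (1 + κD)ⁿ monomials, at most κⁿ(1 + D)ⁿ < (1 + D)ⁿ⁺¹ for D = κⁿ.
    box-count : ∀ {n} (b : Vector Carrier n) κ′ vs → let κ = suc κ′ ; D = κ ℕ.^ n in
                All (Box F.Mem b (κ ℕ.* D)) vs → length vs ≡ suc D ℕ.^ suc n → ¬ Independent vs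
    box-count {n} b κ′ vs all len = pigeonhole (monomials b (κ ℕ.* D)) vs (All.map (box⊆span b (κ ℕ.* D)) all)
      (≡.subst₂ _<_ (≡.sym (length-monomials b (κ ℕ.* D))) (≡.sym len) bound)
      where
        κ = suc κ′
        D = κ ℕ.^ n
        ^-distrib : ∀ k → (κ ℕ.* suc D) ℕ.^ k ≡ κ ℕ.^ k ℕ.* suc D ℕ.^ k
        ^-distrib zero    = ≡.refl
        ^-distrib (suc k) = ≡.trans (≡.cong (κ ℕ.* suc D ℕ.*_) (^-distrib k))
          (ℕ.[m*n]*[o*p]≡[m*o]*[n*p] κ (suc D) (κ ℕ.^ k) (suc D ℕ.^ k))
        bound : suc (κ ℕ.* D) ℕ.^ n < suc D ℕ.^ suc n
        bound = begin-strict
          suc (κ ℕ.* D) ℕ.^ n       ≤⟨ ℕ.^-monoˡ-≤ n (s≤s (ℕ.m≤n+m (κ ℕ.* D) κ′)) ⟩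
          (κ ℕ.+ κ ℕ.* D) ℕ.^ n     ≡⟨ ≡.cong (ℕ._^ n) (≡.sym (ℕ.*-suc κ D)) ⟩
          (κ ℕ.* suc D) ℕ.^ n       ≡⟨ ^-distrib n ⟩
          D ℕ.* suc D ℕ.^ n         <⟨ ℕ.*-monoˡ-< (suc D ℕ.^ n) {{ℕ.m^n≢0 (suc D) n}} (ℕ.n<1+n D) ⟩
          suc D ℕ.* suc D ℕ.^ n     ∎
          where open ℕ.≤-Reasoning

-- Compositum with a ring of constants, and its fractions

module ConstantSpan {ℓ} (D : DifferentialRing ℓ) where
  open DifferentialRing D hiding (zero)
  open RingSolver commutativeRing
  open SubringTheory commutativeRing

  -- The image of the tensor product in the ambient ring: finite sums of products a c. That the map
  -- from the tensor product is injective is the content of linear disjointness.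
  data _⊗_ (A C : Pred Carrier ℓ) : Pred Carrier ℓ where
    none : ∀ {v} → v ≈ 0# → (A ⊗ C) v
    term : ∀ {a c v w} → A a → C c → (A ⊗ C) w → v ≈ a * c + w → (A ⊗ C) v

  module _ {A C : Pred Carrier ℓ} where

    ⊗-respects : (A ⊗ C) Respects _≈_
    ⊗-respects e (none p)         = none (trans (sym e) p)
    ⊗-respects e (term a c w p) = term a c w (trans (sym e) p)

    ⊗-+ : ∀ {x y} → (A ⊗ C) x → (A ⊗ C) y → (A ⊗ C) (x + y)
    ⊗-+ (none p) q = ⊗-respects (sym (trans (+-congʳ p) (+-identityˡ _))) q
    ⊗-+ (term a c w p) q = term a c (⊗-+ w q) (trans (+-congʳ p) (+-assoc _ _ _))

  module _ {A C : Pred Carrier ℓ} (A-sub : IsSubring A) (C-sub : IsSubring C) where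
    private
      module A = IsSubring A-sub
      module C = IsSubring C-sub

    ⊗-scale : ∀ {a c x} → A a → C c → (A ⊗ C) x → (A ⊗ C) (a * c * x)
    ⊗-scale a∈ c∈ (none p) = none (trans (*-congˡ p) (zeroʳ _))
    ⊗-scale {a} {c} a∈ c∈ (term {a′} {c′} {_} {w} a′∈ c′∈ w∈ p) =
      term (A.*∈ a∈ a′∈) (C.*∈ c∈ c′∈) (⊗-scale a∈ c∈ w∈)
        (trans (*-congˡ p) (solve 5 (λ a c x y w → a :* c :* (x :* y :+ w) := a :* x :* (c :* y) :+ a :* c :* w) refl a c a′ c′ w))

    ⊗-* : ∀ {x y} → (A ⊗ C) x → (A ⊗ C) y → (A ⊗ C) (x * y)
    ⊗-* (none p) q = none (trans (*-congʳ p) (zeroˡ _))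
    ⊗-* (term a∈ c∈ w∈ p) q = ⊗-respects (sym (trans (*-congʳ p) (distribʳ _ _ _))) (⊗-+ (⊗-scale a∈ c∈ q) (⊗-* w∈ q))

    A⊆⊗ : A ⊆ A ⊗ C
    A⊆⊗ {a} a∈ = term a∈ C.1∈ (none refl) (solve 1 (λ a → a := a :* :1 :+ :0) refl a)

    C⊆⊗ : C ⊆ A ⊗ C
    C⊆⊗ {c} c∈ = term A.1∈ c∈ (none refl) (solve 1 (λ a → a := :1 :* a :+ :0) refl c)

    ⊗-isSubring : IsSubring (A ⊗ C)
    ⊗-isSubring = record
      { respects = ⊗-respects
      ; 0∈ = none refl
      ; 1∈ = A⊆⊗ A.1∈
      ; +∈ = ⊗-+
      ; *∈ = ⊗-*
      ; neg∈ = λ {x} p → ⊗-respects (solve 1 (λ x → (:- :1) :* :1 :* x := :- x) refl x) (⊗-scale (A.neg∈ A.1∈) C.1∈ p)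
      }

    ⊗-δ : (∀ {a} → A a → A (δ a)) → (∀ {c} → C c → δ c ≈ 0#) → ∀ {x} → (A ⊗ C) x → (A ⊗ C) (δ x)
    ⊗-δ δA δC (none p) = none (trans (δ-cong p) δ-0)
    ⊗-δ δA δC (term {a} {c} {_} {w} a∈ c∈ w∈ p) = term (δA a∈) c∈ (⊗-δ δA δC w∈)
      (trans (δ-cong p) (trans (δ-+ (a * c) w) (+-congʳ (trans (δ-* a c)
        (trans (+-congˡ (trans (*-congˡ (δC c∈)) (zeroʳ a))) (+-identityʳ _))))))

module FieldFractions (em : ∀ {a} → ExcludedMiddle a) {ℓ} (𝒜 : DifferentialField ℓ) where
  open DifferentialField 𝒜 hiding (zero)
  open DifferentialPolynomials em 𝒜 using (*-≉0)
  open SubringTheory commutativeRing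
  open DifferentialRingTheory (underlyingRing 𝒜)

  nonZero-isDenominatorSet : IsDenominatorSet (λ x → ¬ x ≈ 0#)
  nonZero-isDenominatorSet = record
    { respects = λ e p q → p (trans e q) ; 1∈ = 1≉0 ; *∈ = *-≉0 }

  open Fractions nonZero-isDenominatorSet public

  generated⊆ : ∀ {A M : Pred Carrier ℓ} → IsSubring M → DivisionClosed M → (∀ {v} → M v → M (δ v)) →
               A ⊆ M → Generated 𝒜 A ⊆ M
  generated⊆ {M = M} sub div δM A⊆M = go
    where
      open IsSubring sub
      go : Generated 𝒜 _ ⊆ M
      go (gen p)    = A⊆M p
      go (resp e p) = respects e (go p)
      go nil        = 0∈
      go one        = 1∈
      go (add p q)  = +∈ (go p) (go q)
      go (mul p q)  = *∈ (go p) (go q)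
      go (neg p)    = neg∈ (go p)
      go (inv {x} {y} p e) = div 1∈ (go p) (λ x≈0 → 1≉0 (trans (sym e) (trans (*-congʳ x≈0) (zeroˡ y)))) (trans (*-comm y x) e)
      go (der p)    = δM (go p)

  subfield : ∀ {A} → IsSubring A → (∀ {v} → A v → Fr A (δ v)) → DifferentialSubfield 𝒜
  subfield {A} sub δA = record
    { Mem = Fr A ; resp = respects ; 0-closed = 0∈ ; 1-closed = 1∈ ; +-closed = +∈ ; *-closed = *∈ ; neg-closed = neg∈
    ; inv-closed = λ {x} {y} p e → Fr-div sub 1∈ p (λ x≈0 → 1≉0 (trans (sym e) (trans (*-congʳ x≈0) (zeroˡ y)))) (trans (*-comm y x) e)
    ; δ-closed = Fr-δ sub δA
    }
    where open IsSubring (Fr-isSubring sub)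

-- Linear disjointness from the constants

module LinearDisjointness (em : ∀ {a} → ExcludedMiddle a) {ℓ} (𝒜 : DifferentialField ℓ) where
  open DifferentialField 𝒜 hiding (zero)
  open Classical em
  open DifferentialPolynomials em 𝒜 using (integral; *-≉0)
  open DifferentialRing (underlyingRing 𝒜) using (δ-0; δ-neg)
  open RingSolver commutativeRing
  open LinearAlgebra em 𝒜
  open Pairs em 𝒜 using (module 𝒫; IsSubring; Zero₁; Zero₂)

  private
    C = DifferentialSubfield.Mem (C𝒜 𝒜)

    δ-lc : ∀ cs vs → All C cs → δ (lc cs vs) ≈ lc cs (List.map δ vs)
    δ-lc []       vs       _        = δ-0
    δ-lc (c ∷ cs) []       _        = δ-0
    δ-lc (c ∷ cs) (v ∷ vs) ((_ , p) ∷ ps) = trans (δ-+ (c * v) _) (+-cong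
      (trans (δ-* c v) (trans (+-congʳ (trans (*-congʳ p) (zeroˡ v))) (+-identityˡ _))) (δ-lc cs vs ps))

    lc∈ : ∀ (M : DifferentialSubfield 𝒜) cs vs → All (DifferentialSubfield.Mem M) cs → All (DifferentialSubfield.Mem M) vs →
          DifferentialSubfield.Mem M (lc cs vs)
    lc∈ M []       vs       _        _        = DifferentialSubfield.0-closed M
    lc∈ M (c ∷ cs) []       _        _        = DifferentialSubfield.0-closed M
    lc∈ M (c ∷ cs) (v ∷ vs) (p ∷ ps) (q ∷ qs) =
      DifferentialSubfield.+-closed M (DifferentialSubfield.*-closed M p q) (lc∈ M cs vs ps qs)

  Ĉ : Pred 𝒫.Carrier ℓ
  Ĉ (x , y) = C x × x ≈ y

  Ĉ-isSubring : IsSubring Ĉ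
  Ĉ-isSubring = record
    { respects = λ (e , e′) (m , p) → C.resp e m , trans (sym e) (trans p e′)
    ; 0∈ = C.0-closed , refl ; 1∈ = C.1-closed , refl
    ; +∈ = λ (m , p) (n , q) → C.+-closed m n , +-cong p q
    ; *∈ = λ (m , p) (n , q) → C.*-closed m n , *-cong p q
    ; neg∈ = λ (m , p) → C.neg-closed m , -‿cong p
    }
    where module C = DifferentialSubfield (C𝒜 𝒜)

  module _ (M : DifferentialSubfield 𝒜) where
    private module M = DifferentialSubfield M

    Dependent : DifferentialSubfield 𝒜 → List Carrier → Set ℓ
    Dependent F vs = ∃ λ cs → All (DifferentialSubfield.Mem F) cs × length cs ≡ length vs × lc cs vs ≈ 0# × ¬ All (_≈ 0#) cs

    -- After dividing by v the relation reads c + Σ cᵢ wᵢ = 0, and differentiating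
    -- it gives a shorter one.
    dependent-descends : ∀ n vs → length vs ≡ n → All M.Mem vs → Dependent (C𝒜 𝒜) vs → Dependent (constants 𝒜 M) vs
    dependent-descends zero [] _ _ ([] , _ , _ , _ , ne) = contradiction [] ne
    dependent-descends (suc n) (v ∷ vs) len (v∈ ∷ vs∈) (c ∷ cs , c∈ ∷ cs∈ , e , p , ne) with decide (v ≈ 0#)
    ... | yes v≈0 = 1# ∷ List.map (const 0#) vs , DifferentialSubfield.1-closed (constants 𝒜 M) ∷ All.map⁺ (All.universal (λ _ → DifferentialSubfield.0-closed (constants 𝒜 M)) vs) ,
        ≡.cong suc (List.length-map _ vs) ,
        trans (+-cong (trans (*-identityˡ v) v≈0) (lc-zero _ vs (All.map⁺ (All.universal (λ _ → refl) vs)))) (+-identityˡ 0#) ,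
        λ all → 1≉0 (All.head all)
    ... | no v≉0 = result
      where
        y : Carrier
        y = proj₁ (inverse v v≉0)
        vy≈1 : v * y ≈ 1#
        vy≈1 = proj₂ (inverse v v≉0)
        y∈ : M.Mem y
        y∈ = M.inv-closed v∈ vy≈1
        ws : List Carrier
        ws = List.map (y *_) vs
        ws∈ : All M.Mem ws
        ws∈ = All.map⁺ (All.map (M.*-closed y∈) vs∈)
        relation : c + lc cs ws ≈ 0#
        relation = let open SetoidReasoning setoid in begin
          c + lc cs ws                ≈⟨ +-cong (trans (sym (*-identityʳ c)) (*-congˡ (sym vy≈1))) (lc-map y cs vs) ⟩
          c * (v * y) + y * lc cs vs  ≈⟨ solve 4 (λ c v y s → c :* (v :* y) :+ y :* s := y :* (c :* v :+ s)) refl c v y (lc cs vs) ⟩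
          y * (c * v + lc cs vs)      ≈⟨ trans (*-congˡ p) (zeroʳ y) ⟩
          0#                          ∎
        derived : lc cs (List.map δ ws) ≈ 0#
        derived = trans (sym (δ-lc cs ws cs∈)) (trans (sym (trans (+-congʳ (proj₂ c∈)) (+-identityˡ _)))
                    (trans (sym (δ-+ c _)) (trans (δ-cong relation) δ-0)))
        cs-ne : ¬ All (_≈ 0#) cs
        cs-ne all = ne (trans (sym (+-identityʳ c)) (trans (+-congˡ (sym (lc-zero cs ws all))) relation) ∷ all)
        len-ws : length (List.map δ ws) ≡ length vs
        len-ws = ≡.trans (List.length-map δ ws) (List.length-map (y *_) vs)
        IH : Dependent (constants 𝒜 M) (List.map δ ws)
        IH = dependent-descends n (List.map δ ws) (≡.trans len-ws (ℕ.suc-injective len))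
               (All.map⁺ (All.map M.δ-closed ws∈)) (cs , cs∈ , ≡.trans (ℕ.suc-injective e) (≡.sym len-ws) , derived , cs-ne)
        result : Dependent (constants 𝒜 M) (v ∷ vs)
        result =
          -- The sum s = Σ eᵢ wᵢ has derivative Σ eᵢ δwᵢ = 0, so it is a constant of M; multiplying
          -- by v gives -s v + Σ eᵢ vᵢ = 0.
          let es , es∈ , e′ , q , ne′ = IH
              s  = lc es ws
              s∈ = lc∈ M es ws (All.map proj₁ es∈) ws∈
              δs = trans (δ-lc es ws (All.map (λ (_ , z) → tt , z) es∈)) q
          in - s ∷ es , DifferentialSubfield.neg-closed (constants 𝒜 M) (s∈ , δs) ∷ es∈ , ≡.cong suc (≡.trans e′ len-ws) ,
             (let open SetoidReasoning setoid in begin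
               - s * v + lc es vs                 ≈⟨ +-cong (*-congʳ (-‿cong (lc-map y es vs))) (trans (sym (*-identityˡ _)) (*-congʳ (sym vy≈1))) ⟩
               - (y * lc es vs) * v + v * y * lc es vs ≈⟨ solve 3 (λ y s v → (:- (y :* s)) :* v :+ v :* y :* s := :0) refl y (lc es vs) v ⟩
               0#                                 ∎) ,
             λ { (_ ∷ all) → ne′ all }

    independent-over-constants : ∀ vs → All M.Mem vs → Independent (constants 𝒜 M) vs → Independent (C𝒜 𝒜) vs
    independent-over-constants vs vs∈ ind cs cs∈ e p = stable λ ne →
      let es , es∈ , e′ , q , ne′ = dependent-descends (length vs) vs ≡.refl vs∈ (cs , cs∈ , e , p , ne)
      in ne′ (ind es es∈ e′ q)

    independent-∷ : ∀ {v vs} → ¬ Span (constants 𝒜 M) vs v → Independent (constants 𝒜 M) vs → Independent (constants 𝒜 M) (v ∷ vs)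
    independent-∷ {v} {vs} v∉ ind (c ∷ cs) (c∈ ∷ cs∈) e p =
      let c≈0 = stable λ c≉0 →
            let y , cy≈1 = inverse c c≉0
                t = - y
                t∈ = N.neg-closed (N.inv-closed c∈ cy≈1)
            in v∉ (List.map (t *_) cs , All.map⁺ (All.map (N.*-closed t∈) cs∈) ,
                   ≡.trans (List.length-map _ cs) (ℕ.suc-injective e) ,
                   (let open SetoidReasoning setoid in begin
                     v                                  ≈⟨ *-identityˡ v ⟨
                     1# * v                             ≈⟨ *-congʳ cy≈1 ⟨
                     c * y * v                          ≈⟨ solve 4 (λ c y v s → c :* y :* v := y :* (c :* v :+ s) :+ (:- y) :* s) refl c y v (lc cs vs) ⟩
                     y * (c * v + lc cs vs) + t * lc cs vs ≈⟨ +-congʳ (trans (*-congˡ p) (zeroʳ y)) ⟩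
                     0# + t * lc cs vs                  ≈⟨ trans (+-identityˡ _) (sym (lc-mapˡ t cs vs)) ⟩
                     lc (List.map (t *_) cs) vs         ∎))
      in c≈0 ∷ ind cs cs∈ (ℕ.suc-injective e) (trans (sym (trans (+-congʳ (trans (*-congʳ c≈0) (zeroˡ v))) (+-identityˡ _))) p)
      where
        module N = DifferentialSubfield (constants 𝒜 M)
        lc-mapˡ : ∀ t cs vs → lc (List.map (t *_) cs) vs ≈ t * lc cs vs
        lc-mapˡ t []       vs       = sym (zeroʳ t)
        lc-mapˡ t (c ∷ cs) []       = sym (zeroʳ t)
        lc-mapˡ t (c ∷ cs) (v ∷ vs) = trans (+-cong (*-assoc t c v) (lc-mapˡ t cs vs)) (sym (distribˡ t _ _))

    open ConstantSpan (pairRing 𝒜)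

    -- A sum Σ aᵢ cᵢ is rewritten in terms of pairs whose first components are linearly
    -- independent over the constants of M; if its first component vanishes, so do all coefficients.
    module _ {A : Pred 𝒫.Carrier ℓ} (A-sub : IsSubring A) (A⊆M : ∀ {v} → A v → M.Mem (proj₁ v))
             (const∈A : ∀ {c} → M.Mem c → δ c ≈ 0# → A (c , c)) (A⇒ : ∀ {v} → A v → Zero₁ v → Zero₂ v) where
      private
        module A = IsSubring A-sub

        lc₁ lc₂ : List Carrier → List 𝒫.Carrier → Carrier
        lc₁ cs βs = lc cs (List.map proj₁ βs)
        lc₂ cs βs = lc cs (List.map proj₂ βs)

        lc∈A : ∀ cs βs → All (DifferentialSubfield.Mem (constants 𝒜 M)) cs → All A βs → A (lc₁ cs βs , lc₂ cs βs)
        lc∈A []       βs       _        _        = A.0∈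
        lc∈A (c ∷ cs) []       _        _        = A.0∈
        lc∈A (c ∷ cs) (β ∷ βs) ((c∈ , δc) ∷ cs∈) (β∈ ∷ βs∈) = A.+∈ (A.*∈ (const∈A c∈ δc) β∈) (lc∈A cs βs cs∈ βs∈)

        combine : ∀ c es cs (vs : List Carrier) → length es ≡ length vs → length cs ≡ length vs → All C es → C c → All C cs →
          ∃ λ ds → All C ds × length ds ≡ length vs
        combine c []       cs       []       _ _ _ _ _ = [] , [] , ≡.refl
        combine c (e ∷ es) (d ∷ cs) (v ∷ vs) p q (e∈ ∷ es∈) c∈ (d∈ ∷ ds∈) =
          let ds , ds∈′ , r = combine c es cs vs (ℕ.suc-injective p) (ℕ.suc-injective q) es∈ c∈ ds∈
          in e * c + d ∷ ds , N.+-closed (N.*-closed e∈ c∈) d∈ ∷ ds∈′ , ≡.cong suc r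
          where module N = DifferentialSubfield (C𝒜 𝒜)

        combine-lc : ∀ c es cs vs p q e∈ c∈ d∈ ws → lc (proj₁ (combine c es cs vs p q e∈ c∈ d∈)) ws ≈ lc es ws * c + lc cs ws
        combine-lc c []       []       []       p q _ _ _ ws = solve 1 (λ c → :0 := :0 :* c :+ :0) refl c
        combine-lc c (e ∷ es) (d ∷ cs) (v ∷ vs) p q (_ ∷ _) _ (_ ∷ _) [] = solve 1 (λ c → :0 := :0 :* c :+ :0) refl c
        combine-lc c (e ∷ es) (d ∷ cs) (v ∷ vs) p q (e∈ ∷ es∈) c∈ (d∈ ∷ ds∈) (w ∷ ws) =
          trans (+-congˡ (combine-lc c es cs vs _ _ es∈ c∈ ds∈ ws)) (collect e c d w (lc es ws) (lc cs ws))
          where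
            collect : ∀ e c d w s t → (e * c + d) * w + (s * c + t) ≈ (e * w + s) * c + (d * w + t)
            collect = solve 6 (λ e c d w s t → (e :* c :+ d) :* w :+ (s :* c :+ t) := (e :* w :+ s) :* c :+ (d :* w :+ t)) refl

        Reduced : 𝒫.Carrier → Set ℓ
        Reduced v = ∃ λ βs → ∃ λ cs → All A βs × Independent (constants 𝒜 M) (List.map proj₁ βs) × All C cs ×
          length cs ≡ length βs × v 𝒫.≈ (lc₁ cs βs , lc₂ cs βs)

        reduce : ∀ {v} → (A ⊗ Ĉ) v → Reduced v
        reduce (none p) = [] , [] , [] , (λ { [] _ _ _ → [] }) , [] , ≡.refl , p
        reduce (term {a} {c , c′} a∈ (c∈ , c≈c′) w∈ (p₁ , p₂)) with reduce w∈
        ... | βs , cs , βs∈ , ind , cs∈ , len , (q₁ , q₂) with decide (Span (constants 𝒜 M) (List.map proj₁ βs) (proj₁ a))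
        ...   | no a∉ = a ∷ βs , c ∷ cs , a∈ ∷ βs∈ , independent-∷ a∉ ind , c∈ ∷ cs∈ , ≡.cong suc len ,
                  ( trans p₁ (+-cong (*-comm _ _) q₁) , trans p₂ (+-cong (trans (*-congˡ (sym c≈c′)) (*-comm _ _)) q₂) )
        ...   | yes (es , es∈ , e , a≈) =
                  let e′ = ≡.trans e (List.length-map proj₁ βs)
                      es∈C = All.map (λ (_ , z) → tt , z) es∈
                      ds , ds∈ , dlen = combine c es cs (List.map proj₁ βs) e (≡.trans len (≡.sym (List.length-map proj₁ βs))) es∈C c∈ cs∈
                      dlc = combine-lc c es cs (List.map proj₁ βs) e (≡.trans len (≡.sym (List.length-map proj₁ βs))) es∈C c∈ cs∈
                      -- The pair a - Σ eᵢ βᵢ lies in A and its first component is 0, so its second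
                      -- component is 0 as well: the same coefficients express both components of a.
                      diff = A⇒ (A.+∈ a∈ (A.neg∈ (lc∈A es βs es∈ βs∈))) (trans (+-congʳ a≈) (-‿inverseʳ _))
                      a₂≈ : proj₂ a ≈ lc₂ es βs
                      a₂≈ = trans (solve 2 (λ x y → x := x :+ (:- y) :+ y) refl (proj₂ a) (lc₂ es βs)) (trans (+-congʳ diff) (+-identityˡ _))
                  in βs , ds , βs∈ , ind , ds∈ , ≡.trans dlen (List.length-map proj₁ βs) ,
                     ( trans p₁ (trans (+-cong (*-congʳ a≈) q₁) (sym (dlc (List.map proj₁ βs))))
                     , trans p₂ (trans (+-cong (*-cong a₂≈ (sym c≈c′)) q₂) (sym (dlc (List.map proj₂ βs)))) )

      linearly-disjoint : ∀ {v} → (A ⊗ Ĉ) v → Zero₁ v → Zero₂ v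
      linearly-disjoint v∈ z =
        let βs , cs , βs∈ , ind , cs∈ , len , (q₁ , q₂) = reduce v∈
            all = independent-over-constants (List.map proj₁ βs) (All.map⁺ (All.map A⊆M βs∈)) ind cs cs∈
                    (≡.trans len (≡.sym (List.length-map proj₁ βs))) (trans (sym q₁) z)
        in trans q₂ (lc-zero cs (List.map proj₂ βs) all)

-- Ring terms with parameters

rename : ∀ {p} {P : Set p} {m n} → (Fin m → Fin n) → RingTerm P m → RingTerm P n
rename r (var i)  = var (r i)
rename r (par c)  = par c
rename r 0′       = 0′
rename r 1′       = 1′
rename r (s +′ t) = rename r s +′ rename r t
rename r (s *′ t) = rename r s *′ rename r t
rename r (-′ t)   = -′ rename r t

module RingTermProperties {ℓ} (R : CommutativeRing ℓ ℓ) {p} {P : Set p} (ι : P → CommutativeRing.Carrier R) where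
  open CommutativeRing R

  eval-rename : ∀ {m n} (r : Fin m → Fin n) t v → evalRing R ι (rename r t) v ≡ evalRing R ι t (v ∘ r)
  eval-rename r (var i)  v = ≡.refl
  eval-rename r (par c)  v = ≡.refl
  eval-rename r 0′       v = ≡.refl
  eval-rename r 1′       v = ≡.refl
  eval-rename r (s +′ t) v = ≡.cong₂ _+_ (eval-rename r s v) (eval-rename r t v)
  eval-rename r (s *′ t) v = ≡.cong₂ _*_ (eval-rename r s v) (eval-rename r t v)
  eval-rename r (-′ t)   v = ≡.cong -_ (eval-rename r t v)

  eval-cong : ∀ {n} t {v w : Vector Carrier n} → (∀ i → v i ≈ w i) → evalRing R ι t v ≈ evalRing R ι t w
  eval-cong (var i)  e = e i
  eval-cong (par c)  e = refl
  eval-cong 0′       e = refl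
  eval-cong 1′       e = refl
  eval-cong (s +′ t) e = +-cong (eval-cong s e) (eval-cong t e)
  eval-cong (s *′ t) e = *-cong (eval-cong s e) (eval-cong t e)
  eval-cong (-′ t)   e = -‿cong (eval-cong t e)

  open SubringTheory R

  eval∈ : ∀ {M} → IsSubring M → (∀ c → M (ι c)) → ∀ {n} t {v : Vector Carrier n} → (∀ i → M (v i)) → M (evalRing R ι t v)
  eval∈ sub ι∈ (var i)  v∈ = v∈ i
  eval∈ sub ι∈ (par c)  v∈ = ι∈ c
  eval∈ sub ι∈ 0′       v∈ = IsSubring.0∈ sub
  eval∈ sub ι∈ 1′       v∈ = IsSubring.1∈ sub
  eval∈ sub ι∈ (s +′ t) v∈ = IsSubring.+∈ sub (eval∈ sub ι∈ s v∈) (eval∈ sub ι∈ t v∈)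
  eval∈ sub ι∈ (s *′ t) v∈ = IsSubring.*∈ sub (eval∈ sub ι∈ s v∈) (eval∈ sub ι∈ t v∈)
  eval∈ sub ι∈ (-′ t)   v∈ = IsSubring.neg∈ sub (eval∈ sub ι∈ t v∈)

  Values[_] : ∀ {n} → Vector Carrier n → Pred Carrier (ℓ ⊔ p)
  Values[ v ] x = ∃ λ t → x ≈ evalRing R ι t v

-- L is finitely generated as a field over K

module FieldGeneration (em : ∀ {a} → ExcludedMiddle a) {ℓ} (𝒜 : DifferentialField ℓ)
    (K L : DifferentialSubfield 𝒜) (charZero : CharZero 𝒜) (closed : DifferentiallyClosed 𝒜)
    (saturated : Saturated 𝒜) (K⊆L : DifferentialSubfield.Mem K ⊆ DifferentialSubfield.Mem L)
    (L-small : subsetSetoid 𝒜 (DifferentialSubfield.Mem L) ≺ DifferentialField.setoid 𝒜)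
    (normal : StronglyNormal 𝒜 K L) where
  open DifferentialField 𝒜 hiding (zero)
  open Classical em
  open DifferentialPolynomials em 𝒜
  open Pairs em 𝒜 using (module 𝒫; PartialIso)
  open Extension em 𝒜 charZero
  open Homomorphisms em 𝒜 K L charZero closed saturated K⊆L L-small
  open RingSolver commutativeRing
  open SubringTheory commutativeRing
  open BoxTheory commutativeRing
  open LinearAlgebra em 𝒜
  open FieldFractions em 𝒜
  open Exp commutativeSemiring using (_^_)
  private
    module K = DifferentialSubfield K
    module L = DifferentialSubfield L
    C = DifferentialSubfield.Mem (C𝒜 𝒜)
    L-sub = F-isSubring L
    C-sub = F-isSubring (C𝒜 𝒜)
    ρL = diagonal L
    module ⊗ = ConstantSpan (underlyingRing 𝒜)
  open ⊗ using (_⊗_)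

  -- Constants have derivative 0, so the ring of sums of products is already closed under δ and its
  -- fractions form a differential field.
  generated⊆⊗ : ∀ {A : Pred Carrier ℓ} → IsSubring A → (∀ {a} → A a → A (δ a)) → Generated 𝒜 (A ∪ C) ⊆ Fr (A ⊗ C)
  generated⊆⊗ A-sub δA = generated⊆ (Fr-isSubring sub) (Fr-div sub) (Fr-δ sub (⊆Fr sub ∘ ⊗.⊗-δ A-sub C-sub δA proj₂))
    [ ⊆Fr sub ∘ ⊗.A⊆⊗ A-sub C-sub , ⊆Fr sub ∘ ⊗.C⊆⊗ A-sub C-sub ]′
    where sub = ⊗.⊗-isSubring A-sub C-sub

  private
    PolyIn : ∀ {m} → Vector Carrier m → Pred Carrier ℓ
    PolyIn = SomeBox L-sub

    polyIn-isSubring : ∀ {m} (c : Vector Carrier m) → IsSubring (PolyIn c)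
    polyIn-isSubring = someBox-isSubring L-sub

    box-δ : ∀ {m} (c : Vector Carrier m) → (∀ i → δ (c i) ≈ 0#) → ∀ D {v} → Box L.Mem c D v → Box L.Mem c D (δ v)
    box-δ {zero}  c δc D p = L.δ-closed p
    box-δ {suc m} c δc D p = go (suc D) p
      where
        go : ∀ k {v} → Deg (Box L.Mem (c ∘ fsuc) D) (c fzero) k v → Deg (Box L.Mem (c ∘ fsuc) D) (c fzero) k (δ v)
        go zero    p = trans (δ-cong p) (DifferentialRing.δ-0 (underlyingRing 𝒜))
        go (suc k) (a , w , a∈ , w∈ , e) = δ a , δ w , box-δ (c ∘ fsuc) (δc ∘ fsuc) D a∈ , go k w∈ ,
          trans (δ-cong e) (trans (δ-+ a _) (+-congˡ (trans (δ-* _ w)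
            (trans (+-congʳ (trans (*-congʳ (δc fzero)) (zeroˡ w))) (+-identityˡ _)))))

    -- The tuple c extends a given tuple c₀, so that numerator and denominator of a fraction end up
    -- as polynomials in the same constants.
    ⊗⇒polyIn : ∀ {v} → (L.Mem ⊗ C) v → ∀ {m₀} (c₀ : Vector Carrier m₀) → (∀ i → δ (c₀ i) ≈ 0#) →
      ∃ λ m → ∃ λ (c : Vector Carrier m) → (∀ i → δ (c i) ≈ 0#) × (PolyIn c₀ ⊆ PolyIn c) × PolyIn c v
    ⊗⇒polyIn (⊗.none p) c₀ δc₀ = _ , c₀ , δc₀ , id , IsSubring.respects (polyIn-isSubring c₀) (sym p) (IsSubring.0∈ (polyIn-isSubring c₀))
    ⊗⇒polyIn (⊗.term {a} {c} a∈ (_ , δc) w∈ p) c₀ δc₀ =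
      let m , c₁ , δc₁ , inc , w∈′ = ⊗⇒polyIn w∈ c₀ δc₀
          c₂ = c Vector.∷ c₁
          sub = polyIn-isSubring c₂
          inc′ : PolyIn c₁ ⊆ PolyIn c₂
          inc′ (D , q) = D , DegProperties.deg-const (box-isSubmonoid L-sub c₁ D) c D q
      in suc m , c₂ , (λ { fzero → δc ; (fsuc i) → δc₁ i }) , inc′ ∘ inc ,
         IsSubring.respects sub (sym p) (IsSubring.+∈ sub
           (IsSubring.*∈ sub (0 , box-const L-sub c₂ 0 a∈) (1 , box-var L-sub c₂ fzero)) (inc′ w∈′))

    module _ (x : Carrier) (generic : ∀ n → Transcendental₁ ρL x n) where
      open Adjoin ρL (x , x) using (Values; values-isSubring; values-suc; û∈values; graph⊆values)

      V : ℕ → Pred Carrier ℓ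
      V n v = Values n (v , v)

      V-isSubring : ∀ n → IsSubring (V n)
      V-isSubring n = record
        { respects = λ e → P.respects (e , e) ; 0∈ = P.0∈ ; 1∈ = P.1∈ ; +∈ = P.+∈ ; *∈ = P.*∈ ; neg∈ = P.neg∈ }
        where module P = SubringTheory.IsSubring (values-isSubring n)

      V-transcendental : ∀ n {a w} → V n a → V (suc n) w → a + δ^ 𝒜 n x * w ≈ 0# → a ≈ 0# × w ≈ 0#
      V-transcendental n {a} {w} (f , p , _) (g , q , _) e =
        (stable λ ne → generic (suc n) (f ∷ g) (here (nonZero-eval n _ x λ z → ne (trans p z))) e′) ,
        (stable λ ne → generic (suc n) (f ∷ g) (there (nonZero-eval (suc n) _ x λ z → ne (trans q z))) e′)
        where
          e′ : evalPoly 𝒜 (suc n) (poly₁ ρL (suc n) (f ∷ g)) x ≈ 0#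
          e′ = trans (sym (+-cong p (*-congˡ q))) e

      lc∈V : ∀ n cs vs → All L.Mem cs → All (V n) vs → V n (lc cs vs)
      lc∈V n []       vs       _        _        = IsSubring.0∈ (V-isSubring n)
      lc∈V n (c ∷ cs) []       _        _        = IsSubring.0∈ (V-isSubring n)
      lc∈V n (c ∷ cs) (v ∷ vs) (p ∷ ps) (q ∷ qs) = IsSubring.+∈ (V-isSubring n)
        (IsSubring.*∈ (V-isSubring n) (graph⊆values n (p , refl)) q) (lc∈V n cs vs ps qs)

      powers∈V : ∀ n ws → All (V n) ws → ∀ k → All (V (suc n)) (powers ws (δ^ 𝒜 n x) k)
      powers∈V n ws ws∈ zero    = []
      powers∈V n ws ws∈ (suc k) = All.++⁺ (All.map (values-suc n) ws∈)
        (All.map⁺ (All.map (IsSubring.*∈ (V-isSubring (suc n)) (û∈values n)) (powers∈V n ws ws∈ k)))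

      -- With the first block split off, a relation reads a + δⁿx · w = 0 where a involves only
      -- lower derivatives; genericity of x makes a and w vanish separately.
      powers-independent : ∀ n ws → All (V n) ws → Independent L ws → ∀ k → Independent L (powers ws (δ^ 𝒜 n x) k)
      powers-independent n ws ws∈ ind zero    [] _ _ _ = []
      powers-independent n ws ws∈ ind (suc k) cs cs∈ len e =
        let u = δ^ 𝒜 n x
            ps = powers ws u k
            c₁ , c₂ , cs≡ , len₁ , len₂ = split-length ws (List.map (u *_) ps) cs len
            cs∈′ = ≡.subst (All L.Mem) cs≡ cs∈
            c₁∈ = All.++⁻ˡ c₁ cs∈′
            c₂∈ = All.++⁻ʳ c₁ cs∈′
            e₁ : lc c₁ ws + u * lc c₂ ps ≈ 0#
            e₁ = trans (sym (+-congˡ (lc-map u c₂ ps))) (trans (sym (lc-++ c₁ c₂ ws (List.map (u *_) ps) len₁))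
                   (trans (reflexive (≡.cong (λ l → lc l (ws ++ List.map (u *_) ps)) (≡.sym cs≡))) e))
            z₁ , z₂ = V-transcendental n (lc∈V n c₁ ws c₁∈ ws∈) (lc∈V (suc n) c₂ ps c₂∈ (powers∈V n ws ws∈ k)) e₁
        in ≡.subst (All (_≈ 0#)) (≡.sym cs≡) (All.++⁺ (ind c₁ c₁∈ len₁ z₁)
             (powers-independent n ws ws∈ ind k c₂ c₂∈ (≡.trans len₂ (List.length-map _ ps)) z₂))

      derivatives : ∀ k → Vector Carrier k
      derivatives zero    = Vector.[]
      derivatives (suc k) = δ^ 𝒜 k x Vector.∷ derivatives k

      monomials∈V : ∀ k D → All (V k) (monomials L (derivatives k) D)
      monomials∈V zero    D = IsSubring.1∈ (V-isSubring 0) ∷ []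
      monomials∈V (suc k) D = powers∈V k _ (monomials∈V k D) (suc D)

      monomials-independent : ∀ k D → Independent L (monomials L (derivatives k) D)
      monomials-independent zero    D (c ∷ []) _ _ e = trans (solve 1 (λ c → c := c :* :1 :+ :0) refl c) e ∷ []
      monomials-independent (suc k) D = powers-independent k _ (monomials∈V k D) (monomials-independent k D) (suc D)

      monomials∈box : ∀ {k} (y : Vector Carrier k) D → All (Box L.Mem y D) (monomials L y D)
      monomials∈box {zero}  y D = L.1-closed ∷ []
      monomials∈box {suc k} y D = go (suc D)
        where
          open DegProperties (box-isSubmonoid L-sub (y ∘ fsuc) D) (y fzero)
          go : ∀ k → All (Deg (Box L.Mem (y ∘ fsuc) D) (y fzero) k) (powers (monomials L (y ∘ fsuc) D) (y fzero) k)
          go zero    = []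
          go (suc k) = All.++⁺ (All.map (deg-const k) (monomials∈box (y ∘ fsuc) D)) (All.map⁺ (All.map (deg-shift k) (go k)))

      -- With m constants, the m + 1 elements x, δx, …, δᵐx of Frac(L[c]) are algebraically dependent over L.
      not-in-fractions : ∀ {m} (c : Vector Carrier m) → (∀ i → δ (c i) ≈ 0#) → ¬ Fr (PolyIn c) x
      not-in-fractions {m} c δc x∈ =
        let q , q≉0 , (D₀ , q∈) , yq∈ = common (suc m)
            κ₁ , bound = common-degree L-sub c (suc m) yq∈
        in too-many (D₀ ℕ.+ κ₁) q≉0 (box-≤ L-sub c (ℕ.m≤n⇒m≤1+n (ℕ.m≤m+n D₀ κ₁)) q∈)
             (λ i → box-≤ L-sub c (ℕ.m≤n⇒m≤1+n (ℕ.m≤n+m κ₁ D₀)) (bound i))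
        where
          sub = polyIn-isSubring c

          swap : ∀ a D κ → a ℕ.* D ℕ.* κ ≡ a ℕ.* κ ℕ.* D
          swap a D κ = ≡.trans (ℕ.*-assoc a D κ) (≡.trans (≡.cong (a ℕ.*_) (ℕ.*-comm D κ)) (≡.sym (ℕ.*-assoc a κ D)))

          ^-≉0 : ∀ {q} e → ¬ q ≈ 0# → ¬ q ^ e ≈ 0#
          ^-≉0 zero    p = 1≉0
          ^-≉0 (suc e) p = *-≉0 p (^-≉0 e p)

          y : Vector Carrier (suc m)
          y = derivatives (suc m)

          too-many : ∀ κ′ {q} → ¬ q ≈ 0# → Box L.Mem c (suc κ′) q → (∀ i → Box L.Mem c (suc κ′) (y i * q)) → ⊥
          too-many κ′ {q} q≉0 q∈ yq∈ = box-count L c (κ′ ℕ.+ m ℕ.* suc κ′) (List.map (q ^ e *_) vs)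
             (All.map⁺ (All.map clear (monomials∈box y D)))
             (≡.trans (List.length-map _ vs) (length-monomials L y D))
             (independent-scale L vs (^-≉0 e q≉0) (monomials-independent (suc m) D))
            where
              D e : ℕ
              -- For κ = (m + 1)(κ′ + 1), clearing denominators puts the (D + 1)ᵐ⁺¹ monomials in x,
              -- ..., δᵐx into degree κ D, and `box-count` asks for D = κᵐ. The argument of
              -- `box-count` above is κ - 1.
              D = (suc m ℕ.* suc κ′) ℕ.^ m
              e = suc m ℕ.* D
              vs : List Carrier
              vs = monomials L y D
              clear : ∀ {v} → Box L.Mem y D v → Box L.Mem c (suc m ℕ.* suc κ′ ℕ.* D) (q ^ e * v)
              clear {v} p = ≡.subst (λ d → Box L.Mem c d (q ^ e * v)) (swap (suc m) D (suc κ′))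
                (clear-denominators L-sub c y (suc κ′) q∈ yq∈ D p)

          δⁿx∈ : ∀ n → Fr (PolyIn c) (δ^ 𝒜 n x)
          δⁿx∈ zero    = x∈
          δⁿx∈ (suc n) = Fr-δ sub (λ (D , p) → ⊆Fr sub (D , box-δ c δc D p)) (δⁿx∈ n)

          common : ∀ k → ∃ λ q → ¬ q ≈ 0# × PolyIn c q × ∀ i → PolyIn c (derivatives k i * q)
          common zero    = 1# , 1≉0 , IsSubring.1∈ sub , λ ()
          common (suc k) =
            let q , q≉0 , q∈ , h = common k
                r , w , r∈ , w∈ , w≉0 , e = δⁿx∈ k
            in q * w , *-≉0 q≉0 w≉0 , IsSubring.*∈ sub q∈ w∈ , λ
               { fzero → IsSubring.respects sub (trans (*-congˡ (sym e)) (solve 3 (λ q x w → q :* (x :* w) := x :* (q :* w)) refl q (δ^ 𝒜 k x) w))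
                           (IsSubring.*∈ sub q∈ r∈)
               ; (fsuc i) → IsSubring.respects sub (*-assoc _ q w) (IsSubring.*∈ sub (h i) w∈) }

      generic∉⟨L,C⟩ : ¬ Generated 𝒜 (L.Mem ∪ C) x
      generic∉⟨L,C⟩ x∈ =
        let r , w , r∈ , w∈ , w≉0 , e = generated⊆⊗ L-sub L.δ-closed x∈
            m₁ , c₁ , δc₁ , _ , r∈₁ = ⊗⇒polyIn r∈ Vector.[] (λ ())
            m₂ , c₂ , δc₂ , inc , w∈₂ = ⊗⇒polyIn w∈ c₁ δc₁
        in not-in-fractions c₂ δc₂ (r , w , inc r∈₁ , w∈₂ , w≉0 , e)

  open RingTermProperties commutativeRing {P = Σ Carrier K.Mem} proj₁ public

  values-isSubring : ∀ {N} (b : Vector Carrier N) → IsSubring Values[ b ]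
  values-isSubring b = record
    { respects = λ e (t , p) → t , trans (sym e) p
    ; 0∈ = 0′ , refl
    ; 1∈ = 1′ , refl
    ; +∈ = λ (s , p) (t , q) → s +′ t , +-cong p q
    ; *∈ = λ (s , p) (t , q) → s *′ t , *-cong p q
    ; neg∈ = λ (t , p) → -′ t , -‿cong p
    }

  values-weaken : ∀ {N} (b : Vector Carrier N) z → Values[ b ] ⊆ Values[ z Vector.∷ b ]
  values-weaken b z (t , p) = rename fsuc t , trans p (sym (reflexive (eval-rename fsuc t (z Vector.∷ b))))

  -- `δ∈` makes K(b) a differential field without adding derivatives of b.
  record Generators : Set ℓ where
    field
      N  : ℕ
      b  : Vector Carrier N
      b∈ : ∀ i → L.Mem (b i)
      δ∈ : ∀ {v} → Values[ b ] v → Fr Values[ b ] (δ v)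

    K⊆ : K.Mem ⊆ Values[ b ]
    K⊆ {x} x∈ = par (x , x∈) , refl

    b∈values : ∀ i → Values[ b ] (b i)
    b∈values i = var i , refl

    E : DifferentialSubfield 𝒜
    E = subfield (values-isSubring b) δ∈

    E⊆L : Fr Values[ b ] ⊆ L.Mem
    E⊆L = Fr⊆ (λ (t , e) → L.resp (sym e) (eval∈ L-sub (K⊆L ∘ proj₂) t b∈))
      λ {_} {w} r∈ w∈ w≉0 e → let y , wy≈1 = inverse w w≉0 in
        L.resp (quotient wy≈1 e) (L.*-closed r∈ (L.inv-closed w∈ wy≈1))

  private
    diagonal≈ : ∀ M n (f : NestedPoly (Coefficient (diagonal M)) n) x →
      evalPoly 𝒜 n (poly₂ (diagonal M) n f) x ≈ evalPoly 𝒜 n (poly₁ (diagonal M) n f) x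
    diagonal≈ M zero    (_ , _ , p) x = sym p
    diagonal≈ M (suc n) []      x = refl
    diagonal≈ M (suc n) (a ∷ f) x = +-cong (diagonal≈ M n a x) (*-congˡ (diagonal≈ M (suc n) f x))

    base : Generators
    base = record { N = 0 ; b = Vector.[] ; b∈ = λ () ; δ∈ = λ (t , e) → ⊆Fr (values-isSubring Vector.[])
      ((par (_ , K.δ-closed (K.resp (sym e) (eval∈ (F-isSubring K) proj₂ t (λ ()))))) , refl) }

    adjoin : ∀ G {z} → L.Mem z → ∃ λ G′ → (Values[ Generators.b G ] ⊆ Values[ Generators.b G′ ]) × Values[ Generators.b G′ ] z
    adjoin G {z} z∈ = [ transcendental , algebraic ]′ (classify ρ z)
      where
        open Generators G
        module E = DifferentialSubfield E
        ρ = diagonal E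
        Goal = ∃ λ G′ → (Values[ b ] ⊆ Values[ Generators.b G′ ]) × Values[ Generators.b G′ ] z

        module _ (t : ∀ n → Transcendental₁ ρ z n) where
          found : ∃ λ x → (∀ n → Transcendental₂ ρ x n) × ∀ n (g : NestedPoly (Σ Carrier L.Mem) n) →
            NonZeroPoly 𝒜 n (toDiffPoly proj₁ n g) → ¬ evalPoly 𝒜 n (toDiffPoly proj₁ n g) x ≈ 0#
          found = find-transcendental ρ L.Mem L-small (λ (_ , y∈ , e) → L.resp e (E⊆L y∈))

          x : Carrier
          x = proj₁ found

          generic : ∀ n → Transcendental₁ ρL x n
          generic n f = ≡.subst (λ h → NonZeroPoly 𝒜 n h → ¬ evalPoly 𝒜 n h x ≈ 0#)
            (toDiffPoly-map proj₁ (λ ((y , _) , y∈ , _) → y , y∈) n f)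
            (proj₂ (proj₂ found) n (mapNested (λ ((y , _) , y∈ , _) → y , y∈) n f))

          ext₀ : Extended ρ z x
          ext₀ = extended ρ (E⊆L ∘ proj₁) z∈ (Adjoin.adjoin-transcendental ρ (z , x) t (proj₁ (proj₂ found)))

          hom : ∃ λ (τ : HomOver 𝒜 K L) → ∀ y {y′} → PartialIso.Graph (Extended.iso ext₀) (proj₁ y , y′) → HomOver.⟦_⟧ τ y ≈ y′
          hom = hom-extending (proj₁ normal) (Extended.iso ext₀)
            (λ k∈ → Extended.extends ext₀ (⊆Fr (values-isSubring b) (K⊆ k∈) , refl)) (Extended.domain⊆L ext₀)

          x∈ : Generated 𝒜 (HomOver.Image (proj₁ hom) ∪ C) x
          x∈ = gen (inj₁ ((z , z∈) , proj₂ hom (z , z∈) (Extended.contains ext₀)))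

          transcendental : Goal
          transcendental = contradiction (proj₂ (proj₂ (proj₂ normal (proj₁ hom))) x∈) (generic∉⟨L,C⟩ x generic)

        module _ (a : Algebraic ρ z) where
          open Algebraic a using (order)

          -- The identity of E, extended by z ↦ z. Its graph is closed under δ and generated over E
          -- by z, ..., δⁿz with n the order, so the field E(z, ..., δⁿz) is closed under δ.
          ext : Adjoin.ExtensionBy ρ (z , z) (_≤ order)
          ext = Adjoin.adjoin-algebraic ρ (z , z) a
            ( trans (diagonal≈ E (suc order) (Algebraic.minPoly a) z) (Algebraic.root a)
            , λ f f≉0 e → Algebraic.transcendental a f (nonZero₂₁ ρ order f f≉0) (trans (sym (diagonal≈ E order f z)) e))
          open Adjoin.ExtensionBy ext
          module Γ = PartialIso iso

          b⁺ : ∀ k → Vector Carrier (k ℕ.+ N)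
          b⁺ zero    = b
          b⁺ (suc k) = δ^ 𝒜 k z Vector.∷ b⁺ k

          b⊆b⁺ : ∀ k → Values[ b ] ⊆ Values[ b⁺ k ]
          b⊆b⁺ zero    p = p
          b⊆b⁺ (suc k) p = values-weaken (b⁺ k) (δ^ 𝒜 k z) (b⊆b⁺ k p)

          δⁱz∈b⁺ : ∀ k i → i < k → Values[ b⁺ k ] (δ^ 𝒜 i z)
          δⁱz∈b⁺ (suc k) i i<1+k =
            [ (λ i<k → values-weaken (b⁺ k) (δ^ 𝒜 k z) (δⁱz∈b⁺ k i i<k))
            , (λ i≡k → var fzero , reflexive (≡.cong (λ j → δ^ 𝒜 j z) i≡k)) ]′ (ℕ.m<1+n⇒m<n∨m≡n i<1+k)

          δⁿz∈L : ∀ n → L.Mem (δ^ 𝒜 n z)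
          δⁿz∈L zero    = z∈
          δⁿz∈L (suc n) = L.δ-closed (δⁿz∈L n)

          b⁺∈L : ∀ k i → L.Mem (b⁺ k i)
          b⁺∈L zero    i        = b∈ i
          b⁺∈L (suc k) fzero    = δⁿz∈L k
          b⁺∈L (suc k) (fsuc i) = b⁺∈L k i

          δⁿz∈Γ : ∀ n → Γ.Graph (δ^ 𝒜 n z , δ^ 𝒜 n z)
          δⁿz∈Γ zero    = contains
          δⁿz∈Γ (suc n) = Γ.δ∈ (δⁿz∈Γ n)

          b⁺∈Γ : ∀ k i → Γ.Graph (b⁺ k i , b⁺ k i)
          b⁺∈Γ zero    i        = extends (⊆Fr (values-isSubring b) (b∈values i) , refl)
          b⁺∈Γ (suc k) fzero    = δⁿz∈Γ k
          b⁺∈Γ (suc k) (fsuc i) = b⁺∈Γ k i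

          B = Values[ b⁺ (suc order) ]
          B-sub = values-isSubring (b⁺ (suc order))

          B⊆Γ : ∀ {v} → B v → Γ.Graph (v , v)
          B⊆Γ (t , e) = Γ.respects (sym e , sym e) (eval∈
            (record { respects = λ e → Γ.respects (e , e) ; 0∈ = Γ.0∈ ; 1∈ = Γ.1∈ ; +∈ = Γ.+∈ ; *∈ = Γ.*∈ ; neg∈ = Γ.neg∈ })
            (λ (c , c∈) → extends (⊆Fr (values-isSubring b) (K⊆ c∈) , refl)) t (b⁺∈Γ (suc order)))

          Γ⊆B : ∀ {v} → Γ.Graph v → Fr B (proj₁ v)
          Γ⊆B = generated
            (record { respects = λ (e , _) → F.respects e ; 0∈ = F.0∈ ; 1∈ = F.1∈ ; +∈ = F.+∈ ; *∈ = F.*∈ ; neg∈ = F.neg∈ })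
            (λ r∈ w∈ (w≉0 , _) (e , _) → Fr-div B-sub r∈ w∈ w≉0 e)
            (λ (x∈ , _) → Fr⊆ (⊆Fr B-sub ∘ b⊆b⁺ (suc order)) (Fr-div B-sub) x∈)
            (λ i i≤n → ⊆Fr B-sub (δⁱz∈b⁺ (suc order) i (s≤s i≤n)))
            where module F = IsSubring (Fr-isSubring B-sub)

          algebraic : Goal
          algebraic = record { N = suc order ℕ.+ N ; b = b⁺ (suc order) ; b∈ = b⁺∈L (suc order)
                             ; δ∈ = λ p → Γ⊆B (Γ.δ∈ (B⊆Γ p)) } ,
                      b⊆b⁺ (suc order) , δⁱz∈b⁺ (suc order) 0 (s≤s z≤n)

    adjoin-all : ∀ G k (a : Vector Carrier k) → (∀ i → L.Mem (a i)) →
      ∃ λ G′ → (Values[ Generators.b G ] ⊆ Values[ Generators.b G′ ]) × ∀ i → Values[ Generators.b G′ ] (a i)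
    adjoin-all G zero    a a∈ = G , id , λ ()
    adjoin-all G (suc k) a a∈ =
      let G₁ , inc₁ , p = adjoin G (a∈ fzero)
          G₂ , inc₂ , q = adjoin-all G₁ k (a ∘ fsuc) (a∈ ∘ fsuc)
      in G₂ , (λ {x} → inc₂ ∘ inc₁) , λ { fzero → inc₂ p ; (fsuc i) → q i }

  field-generators : ∃ λ G → L.Mem ⊆ Fr Values[ Generators.b G ]
  field-generators =
    let k , a , L≐ = proj₁ normal
        G , _ , a∈ = adjoin-all base k a (generator∈L (proj₁ normal))
        open Generators G
        sub = values-isSubring b
    in G , λ x∈ → generated⊆ (Fr-isSubring sub) (Fr-div sub) (Fr-δ sub δ∈)
         [ ⊆Fr sub ∘ K⊆ , (λ (i , e) → ⊆Fr sub (IsSubring.respects sub e (a∈ i))) ]′ (proj₁ L≐ x∈)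

-- Realisations of the type of b, embeddings, and rational expressions in constants

module Realisations (em : ∀ {a} → ExcludedMiddle a) {ℓ} (𝒜 : DifferentialField ℓ)
    (K L : DifferentialSubfield 𝒜) (charZero : CharZero 𝒜) (closed : DifferentiallyClosed 𝒜)
    (saturated : Saturated 𝒜) (K⊆L : DifferentialSubfield.Mem K ⊆ DifferentialSubfield.Mem L)
    (L-small : subsetSetoid 𝒜 (DifferentialSubfield.Mem L) ≺ DifferentialField.setoid 𝒜)
    (normal : StronglyNormal 𝒜 K L) where
  open DifferentialField 𝒜 hiding (zero)
  open Classical em
  open DifferentialPolynomials em 𝒜 using (*-≉0; quotient)
  open Pairs em 𝒜 using (module 𝒫; PartialIso; Zero₁; Zero₂; NonZeros; fractionIso)
  module FrP = Pairs em 𝒜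
  open Homomorphisms em 𝒜 K L charZero closed saturated K⊆L L-small
  open FieldGeneration em 𝒜 K L charZero closed saturated K⊆L L-small normal
  open RingSolver commutativeRing
  open SubringTheory commutativeRing
  open LinearAlgebra em 𝒜
  open FieldFractions em 𝒜
  private
    module K = DifferentialSubfield K
    module L = DifferentialSubfield L
    module Sub𝒫 = SubringTheory 𝒫.commutativeRing
    module ⊗ = ConstantSpan (underlyingRing 𝒜)
    C = DifferentialSubfield.Mem (C𝒜 𝒜)
    C-sub = F-isSubring (C𝒜 𝒜)
  open ⊗ using (_⊗_)

  abstract
    G : Generators
    G = proj₁ field-generators

    L⊆G : L.Mem ⊆ Fr Values[ Generators.b G ]
    L⊆G = proj₂ field-generators

  open Generators G public using (N; b; b∈)

  L⊆ : L.Mem ⊆ Fr Values[ b ]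
  L⊆ = L⊆G

  Term : Set ℓ
  Term = RingTerm (Σ Carrier K.Mem) N

  ⟦_⟧_ : Term → Vector Carrier N → Carrier
  ⟦ t ⟧ x = evalRing commutativeRing proj₁ t x

  ⟦b⟧∈L : ∀ t → L.Mem (⟦ t ⟧ b)
  ⟦b⟧∈L t = eval∈ (F-isSubring L) (K⊆L ∘ proj₂) t b∈

  private
    δb : ∀ i → Fr Values[ b ] (δ (b i))
    δb i = Generators.δ∈ G (var i , refl)

  -- δ bᵢ = δnumᵢ(b) / δdenᵢ(b)
  δnum δden : Fin N → Term
  δnum i = proj₁ (proj₁ (proj₂ (proj₂ (δb i))))
  δden i = proj₁ (proj₁ (proj₂ (proj₂ (proj₂ (δb i)))))

  δden≉0 : ∀ i → ¬ ⟦ δden i ⟧ b ≈ 0#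
  δden≉0 i z = proj₁ (proj₂ (proj₂ (proj₂ (proj₂ (δb i)))))
    (trans (proj₂ (proj₁ (proj₂ (proj₂ (proj₂ (δb i)))))) z)

  δb≈ : ∀ i → δ (b i) * ⟦ δden i ⟧ b ≈ ⟦ δnum i ⟧ b
  δb≈ i = trans (*-congˡ (sym (proj₂ (proj₁ (proj₂ (proj₂ (proj₂ (δb i))))))))
            (trans (proj₂ (proj₂ (proj₂ (proj₂ (proj₂ (δb i))))))
                   (proj₂ (proj₁ (proj₂ (proj₂ (δb i))))))

  pair-eval∈ : ∀ {M : Pred 𝒫.Carrier ℓ} → Sub𝒫.IsSubring M → ∀ {n} {v w : Vector Carrier n} →
    (∀ {k} → K.Mem k → M (k , k)) → (∀ i → M (v i , w i)) → ∀ (t : RingTerm (Σ Carrier K.Mem) n) →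
    M (evalRing commutativeRing proj₁ t v , evalRing commutativeRing proj₁ t w)
  pair-eval∈ sub k∈ v∈ (var i)  = v∈ i
  pair-eval∈ sub k∈ v∈ (par c)  = k∈ (proj₂ c)
  pair-eval∈ sub k∈ v∈ 0′       = Sub𝒫.IsSubring.0∈ sub
  pair-eval∈ sub k∈ v∈ 1′       = Sub𝒫.IsSubring.1∈ sub
  pair-eval∈ sub k∈ v∈ (s +′ t) = Sub𝒫.IsSubring.+∈ sub (pair-eval∈ sub k∈ v∈ s) (pair-eval∈ sub k∈ v∈ t)
  pair-eval∈ sub k∈ v∈ (s *′ t) = Sub𝒫.IsSubring.*∈ sub (pair-eval∈ sub k∈ v∈ s) (pair-eval∈ sub k∈ v∈ t)
  pair-eval∈ sub k∈ v∈ (-′ t)   = Sub𝒫.IsSubring.neg∈ sub (pair-eval∈ sub k∈ v∈ t)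

  PairValues : ∀ {n} → Vector Carrier n → Vector Carrier n → Pred 𝒫.Carrier ℓ
  PairValues v w p = ∃ λ (t : RingTerm (Σ Carrier K.Mem) _) →
    p 𝒫.≈ (evalRing commutativeRing proj₁ t v , evalRing commutativeRing proj₁ t w)

  pairValues-isSubring : ∀ {n} (v w : Vector Carrier n) → Sub𝒫.IsSubring (PairValues v w)
  pairValues-isSubring v w = record
    { respects = λ e (t , p) → t , 𝒫.trans (𝒫.sym e) p
    ; 0∈ = 0′ , 𝒫.refl
    ; 1∈ = 1′ , 𝒫.refl
    ; +∈ = λ (s , p) (t , q) → s +′ t , 𝒫.+-cong p q
    ; *∈ = λ (s , p) (t , q) → s *′ t , 𝒫.*-cong p q
    ; neg∈ = λ (t , p) → -′ t , 𝒫.-‿cong p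
    }

  -- x realises the quantifier-free type of b over K.
  record Real (x : Vector Carrier N) : Set ℓ where
    field
      zero⇒ : ∀ t → ⟦ t ⟧ b ≈ 0# → ⟦ t ⟧ x ≈ 0#
      zero⇐ : ∀ t → ⟦ t ⟧ x ≈ 0# → ⟦ t ⟧ b ≈ 0#
      δ≈    : ∀ i → δ (x i) * ⟦ δden i ⟧ x ≈ ⟦ δnum i ⟧ x

  module FromReal (x : Vector Carrier N) (real : Real x) where
    open Real real

    private
      A = PairValues b x
      A-sub = pairValues-isSubring b x
      module F = Sub𝒫.IsSubring (FrP.Fr-isSubring A-sub)

      k∈ : ∀ {k} → K.Mem k → A (k , k)
      k∈ {k} m = par (k , m) , 𝒫.refl

      δ-eval : ∀ t → FrP.Fr A (𝒫.δ (⟦ t ⟧ b , ⟦ t ⟧ x))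
      δ-eval (var i)  = (⟦ δnum i ⟧ b , ⟦ δnum i ⟧ x) , (⟦ δden i ⟧ b , ⟦ δden i ⟧ x) , (δnum i , 𝒫.refl) , (δden i , 𝒫.refl) ,
        (δden≉0 i , δden≉0 i ∘ zero⇐ (δden i)) , (δb≈ i , δ≈ i)
      δ-eval (par c)  = FrP.⊆Fr A-sub (k∈ (K.δ-closed (proj₂ c)))
      δ-eval 0′       = F.respects (𝒫.sym 𝒫.δ-0) F.0∈
      δ-eval 1′       = F.respects (DifferentialRing.δ-cong (pairRing 𝒜) 𝒫.refl) (FrP.⊆Fr A-sub (k∈ (K.δ-closed K.1-closed)))
      δ-eval (s +′ t) = F.respects (𝒫.sym (𝒫.δ-+ (⟦ s ⟧ b , ⟦ s ⟧ x) (⟦ t ⟧ b , ⟦ t ⟧ x))) (F.+∈ (δ-eval s) (δ-eval t))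
      δ-eval (s *′ t) = F.respects (𝒫.sym (𝒫.δ-* (⟦ s ⟧ b , ⟦ s ⟧ x) (⟦ t ⟧ b , ⟦ t ⟧ x)))
        (F.+∈ (F.*∈ (δ-eval s) (FrP.⊆Fr A-sub (t , 𝒫.refl))) (F.*∈ (FrP.⊆Fr A-sub (s , 𝒫.refl)) (δ-eval t)))
      δ-eval (-′ t)   = F.respects (𝒫.sym (𝒫.δ-neg (⟦ t ⟧ b , ⟦ t ⟧ x))) (F.neg∈ (δ-eval t))

    -- The map t(b) / s(b) ↦ t(x) / s(x). The condition `δ≈` makes it respect derivatives, and its
    -- domain contains L because L is the fraction field of K[b].
    iso : PartialIso
    iso = fractionIso A-sub
      (λ (t , p , q) z → trans q (zero⇒ t (trans (sym p) z)))
      (λ (t , p , q) z → trans p (zero⇐ t (trans (sym q) z)))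
      (λ (t , e) → F.respects (𝒫.δ-cong (𝒫.sym e)) (δ-eval t))

    private
      module Γ = PartialIso iso

      k∈Γ : ∀ {k} → K.Mem k → Γ.Graph (k , k)
      k∈Γ = FrP.⊆Fr A-sub ∘ k∈

      total : L.Mem ⊆ Domain iso
      total l∈ = Fr⊆ {M = Domain iso} (λ (t , e) → ⟦ t ⟧ x , Γ.respects (sym e , refl) (FrP.⊆Fr A-sub (t , 𝒫.refl)))
        (λ {z} {w} (r′ , r∈) (w′ , w∈) w≉0 e →
          let w′≉0 : ¬ w′ ≈ 0#
              w′≉0 z = w≉0 (Γ.zero⇐ w∈ z)
              y , w′y≈1 = inverse w′ w′≉0
          in r′ * y , Γ.div∈ r∈ w∈ (w≉0 , w′≉0) (e ,
               trans (solve 3 (λ r y w → r :* y :* w := r :* (w :* y)) refl r′ y w′) (trans (*-congˡ w′y≈1) (*-identityʳ r′))))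
        (L⊆ l∈)

    hom : HomOver 𝒜 K L
    hom = homOver iso k∈Γ total

    hom-b : ∀ i → HomOver.⟦_⟧ hom (b i , b∈ i) ≈ x i
    hom-b i = functional iso (homOver-graph iso k∈Γ total (b i , b∈ i)) (FrP.⊆Fr A-sub (var i , 𝒫.refl)) refl

  module _ (M : DifferentialSubfield 𝒜) (τ : Embedding (toField 𝒜 M) 𝒜) where
    private
      module M = DifferentialSubfield M
      module τ = Embedding τ
    open IsRingMonomorphism τ.isRingMonomorphism using (⟦⟧-cong; +-homo; *-homo; 0#-homo; 1#-homo; -‿homo) renaming (injective to τ-injective)

    embedding-graph : PartialIso
    embedding-graph = record
      { Graph = λ (x , y) → ∃ λ l → proj₁ l ≈ x × τ.⟦ l ⟧ ≈ y
      ; isSubring = record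
        { respects = λ (e , e′) (l , p , q) → l , trans p e , trans q e′
        ; 0∈ = (0# , M.0-closed) , refl , 0#-homo
        ; 1∈ = (1# , M.1-closed) , refl , 1#-homo
        ; +∈ = λ (l , p , q) (l′ , p′ , q′) → (_ , M.+-closed (proj₂ l) (proj₂ l′)) , +-cong p p′ , trans (+-homo l l′) (+-cong q q′)
        ; *∈ = λ (l , p , q) (l′ , p′ , q′) → (_ , M.*-closed (proj₂ l) (proj₂ l′)) , *-cong p p′ , trans (*-homo l l′) (*-cong q q′)
        ; neg∈ = λ (l , p , q) → (_ , M.neg-closed (proj₂ l)) , -‿cong p , trans (-‿homo l) (-‿cong q)
        }
      ; δ∈ = λ (l , p , q) → (_ , M.δ-closed (proj₂ l)) , δ-cong p , trans (τ.δ-homo l) (δ-cong q)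
      ; div∈ = λ { {z , z′} {w , w′} {r , r′} (lr , p , q) (lw , p′ , q′) (w≉0 , w′≉0) (e , e′) →
          let y , ly≈1 = inverse (proj₁ lw) (λ z → w≉0 (trans (sym p′) z))
              ly : Σ Carrier M.Mem
              ly = y , M.inv-closed (proj₂ lw) ly≈1
              one : τ.⟦ lw ⟧ * τ.⟦ ly ⟧ ≈ 1#
              one = trans (sym (*-homo lw ly)) (trans (⟦⟧-cong ly≈1) 1#-homo)
          in (_ , M.*-closed (proj₂ lr) (proj₂ ly)) ,
             quotient (trans (*-congʳ (sym p′)) ly≈1) (trans e (sym p)) ,
             trans (*-homo lr ly) (quotient (trans (*-congʳ (sym q′)) one) (trans e′ (sym q))) }
      ; zero⇒ = λ (l , p , q) z → trans (sym q) (trans (⟦⟧-cong {l} {0# , M.0-closed} (trans p z)) 0#-homo)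
      ; zero⇐ = λ (l , p , q) z → trans (sym p) (τ-injective {l} {0# , M.0-closed} (trans (trans q z) (sym 0#-homo)))
      }

  module _ (τ : HomOver 𝒜 K L) where
    private module τ = HomOver τ

    hom-graph : PartialIso
    hom-graph = embedding-graph L τ.embedding

    private module Γ = PartialIso hom-graph

    hom-graph-K : ∀ {k} → K.Mem k → Γ.Graph (k , k)
    hom-graph-K {k} k∈ = (k , K⊆L k∈) , refl , τ.fixes (k , K⊆L k∈) k∈

    image : Vector Carrier N
    image i = τ.⟦ b i , b∈ i ⟧

    hom-graph-eval : ∀ t → Γ.Graph (⟦ t ⟧ b , ⟦ t ⟧ image)
    hom-graph-eval = pair-eval∈ Γ.isSubring hom-graph-K (λ i → (b i , b∈ i) , refl , refl)

    -- An embedding over K preserves and reflects the polynomial relations of b and carries the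
    -- expressions for δbᵢ along; with `hom` this matches embeddings and realisations.
    image-real : Real image
    image-real = record
      { zero⇒ = λ t → Γ.zero⇒ (hom-graph-eval t)
      ; zero⇐ = λ t → Γ.zero⇐ (hom-graph-eval t)
      ; δ≈ = λ i → functional hom-graph (Γ.*∈ (Γ.δ∈ ((b i , b∈ i) , refl , refl)) (hom-graph-eval (δden i))) (hom-graph-eval (δnum i)) (δb≈ i)
      }

  -- Terms in m constants whose coefficients are terms in a realisation x.
  evalAt : ∀ {m} → RingTerm Term m → Vector Carrier N → Vector Carrier m → Carrier
  evalAt P x c = evalRing commutativeRing (λ t → ⟦ t ⟧ x) P c

  -- Coefficients are terms over K, not elements of L, so that one expression can be evaluated both
  -- at b and at a realisation x.
  record Family : Set ℓ where
    field
      m     : ℕ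
      P P′  : Fin N → RingTerm Term m
      Q Q′  : RingTerm Term m

  record Covers (κ : Family) (x : Vector Carrier N) (c : Vector Carrier (Family.m κ)) : Set ℓ where
    open Family κ
    field
      constant : ∀ j → δ (c j) ≈ 0#
      Q≉0      : ¬ evalAt Q b c ≈ 0#
      x≈       : ∀ i → x i * evalAt Q b c ≈ evalAt (P i) b c
      Q′≉0     : ¬ evalAt Q′ x c ≈ 0#
      b≈       : ∀ i → b i * evalAt Q′ x c ≈ evalAt (P′ i) x c

  private
    At : Vector Carrier N → ∀ {m} → Vector Carrier m → Pred Carrier ℓ
    At y c v = ∃ λ P → v ≈ evalAt P y c

    at-isSubring : ∀ y {m} (c : Vector Carrier m) → IsSubring (At y c)
    at-isSubring y c = record
      { respects = λ e (t , p) → t , trans (sym e) p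
      ; 0∈ = 0′ , refl
      ; 1∈ = 1′ , refl
      ; +∈ = λ (s , p) (t , q) → s +′ t , +-cong p q
      ; *∈ = λ (s , p) (t , q) → s *′ t , *-cong p q
      ; neg∈ = λ (t , p) → -′ t , -‿cong p
      }

    at-weaken : ∀ y {m} (c : Vector Carrier m) z → At y c ⊆ At y (z Vector.∷ c)
    at-weaken y c z (t , p) = rename fsuc t , trans p (sym (reflexive
      (RingTermProperties.eval-rename commutativeRing (λ t → ⟦ t ⟧ y) fsuc t (z Vector.∷ c))))

    -- The inclusion `inc` holds at every y: the constants expressing x through b must survive when
    -- those expressing b through x are added.
    record Extends {m₀} (c₀ : Vector Carrier m₀) : Set (lsuc ℓ) where
      field
        m   : ℕ
        c   : Vector Carrier m
        δc  : ∀ j → δ (c j) ≈ 0#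
        inc : ∀ y → At y c₀ ⊆ At y c

    ⊗⇒at : ∀ y {v} → (Values[ y ] ⊗ C) v → ∀ {m₀} (c₀ : Vector Carrier m₀) → (∀ j → δ (c₀ j) ≈ 0#) →
      Σ (Extends c₀) λ X → At y (Extends.c X) v
    ⊗⇒at y (⊗.none p) c₀ δc₀ = record { c = c₀ ; δc = δc₀ ; inc = λ _ → id } , 0′ , p
    ⊗⇒at y (⊗.term {a} {c} (t , a≈) (_ , δc) w∈ p) c₀ δc₀ =
      record { c = c Vector.∷ X.c ; δc = λ { fzero → δc ; (fsuc j) → X.δc j } ; inc = λ y → at-weaken y X.c c ∘ X.inc y } ,
      S.respects (sym p) (S.+∈ (S.*∈ (par t , a≈) (var fzero , refl)) (at-weaken y X.c c (proj₂ rec)))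
      where
        rec = ⊗⇒at y w∈ c₀ δc₀
        module X = Extends (proj₁ rec)
        module S = IsSubring (at-isSubring y (c Vector.∷ X.c))

    common : ∀ y k (v : Vector Carrier k) → (∀ i → Fr (Values[ y ] ⊗ C) (v i)) →
      ∀ {m₀} (c₀ : Vector Carrier m₀) → (∀ j → δ (c₀ j) ≈ 0#) →
      Σ (Extends c₀) λ X → ∃ λ q → At y (Extends.c X) q × ¬ q ≈ 0# × ∀ i → At y (Extends.c X) (v i * q)
    common y zero v v∈ c₀ δc₀ = record { c = c₀ ; δc = δc₀ ; inc = λ _ → id } , 1# , (1′ , refl) , 1≉0 , λ ()
    common y (suc k) v v∈ c₀ δc₀ =
      record { c = X₂.c ; δc = X₂.δc ; inc = λ y → X₂.inc y ∘ X₁.inc y ∘ X₀.inc y } ,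
      q * w , S.*∈ q∈ w∈ , *-≉0 q≉0 w≉0 , λ
        { fzero → S.respects (trans (*-congˡ (sym e)) (solve 3 (λ q x w → q :* (x :* w) := x :* (q :* w)) refl q (v fzero) w)) (S.*∈ q∈ r∈)
        ; (fsuc i) → S.respects (*-assoc (v (fsuc i)) q w) (S.*∈ (X₂.inc y (X₁.inc y (vq∈ i))) w∈) }
      where
        rec = common y k (v ∘ fsuc) (v∈ ∘ fsuc) c₀ δc₀
        module X₀ = Extends (proj₁ rec)
        q = proj₁ (proj₂ rec)
        q≉0 = proj₁ (proj₂ (proj₂ (proj₂ rec)))
        vq∈ = proj₂ (proj₂ (proj₂ (proj₂ rec)))
        frac = v∈ fzero
        w = proj₁ (proj₂ frac)
        w≉0 = proj₁ (proj₂ (proj₂ (proj₂ (proj₂ frac))))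
        e = proj₂ (proj₂ (proj₂ (proj₂ (proj₂ frac))))
        rec₁ = ⊗⇒at y (proj₁ (proj₂ (proj₂ frac))) X₀.c X₀.δc
        module X₁ = Extends (proj₁ rec₁)
        rec₂ = ⊗⇒at y (proj₁ (proj₂ (proj₂ (proj₂ frac)))) X₁.c X₁.δc
        module X₂ = Extends (proj₁ rec₂)
        module S = IsSubring (at-isSubring y X₂.c)
        q∈ = X₂.inc y (X₁.inc y (proj₁ (proj₂ (proj₂ rec))))
        r∈ = X₂.inc y (proj₂ rec₁)
        w∈ = proj₂ rec₂

  -- Serves twice: with S = L and y = b, and with S the image of L under an embedding and y = x.
  generated⊆at : ∀ y {S : Pred Carrier ℓ} → S ⊆ Fr Values[ y ] → (∀ t → S (δ (⟦ t ⟧ y))) → Generated 𝒜 (S ∪ C) ⊆ Fr (Values[ y ] ⊗ C)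
  generated⊆at y {S} S⊆ δ∈S = generated⊆ (Fr-isSubring sub) (Fr-div sub) (Fr-δ sub δ⊗)
    [ inc ∘ S⊆ , ⊆Fr sub ∘ ⊗.C⊆⊗ V-sub C-sub ]′
    where
      V-sub = values-isSubring y
      sub = ⊗.⊗-isSubring V-sub C-sub
      module F = IsSubring (Fr-isSubring sub)
      inc : Fr Values[ y ] ⊆ Fr (Values[ y ] ⊗ C)
      inc = Fr⊆ (⊆Fr sub ∘ ⊗.A⊆⊗ V-sub C-sub) (Fr-div sub)
      δ⊗ : ∀ {v} → (Values[ y ] ⊗ C) v → Fr (Values[ y ] ⊗ C) (δ v)
      δ⊗ (⊗.none p) = F.respects (trans (sym (DifferentialRing.δ-0 (underlyingRing 𝒜))) (δ-cong (sym p))) F.0∈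
      δ⊗ (⊗.term {a} {c} {_} {w} (t , a≈) c∈ w∈ p) = F.respects
        (trans (sym (trans (δ-+ (a * c) w) (+-congʳ (trans (δ-* a c) (trans (+-congˡ (trans (*-congˡ (proj₂ c∈)) (zeroʳ a))) (+-identityʳ _))))))
               (δ-cong (sym p)))
        (F.+∈ (F.*∈ (F.respects (δ-cong (sym a≈)) (inc (S⊆ (δ∈S t)))) (⊆Fr sub (⊗.C⊆⊗ V-sub C-sub c∈))) (δ⊗ w∈))

  -- Strength of the embedding b ↦ x places x in ⟨ L , C ⟩ and b in the field generated by the image
  -- of L and C. Each tuple is written with one common denominator, both over the same constants.
  covered : ∀ {x} → Real x → ∃ λ κ → ∃ λ c → Covers κ x c
  covered {x} real = record { m = X₂.m ; P = λ i → proj₁ (xq i) ; P′ = λ i → proj₁ (bq i) ; Q = proj₁ q∈ ; Q′ = proj₁ q′∈ } ,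
    X₂.c , record
      { constant = X₂.δc
      ; Q≉0  = λ z → q≉0 (trans (proj₂ q∈) z)
      ; x≈   = λ i → trans (*-congˡ (sym (proj₂ q∈))) (proj₂ (xq i))
      ; Q′≉0 = λ z → q′≉0 (trans (proj₂ q′∈) z)
      ; b≈   = λ i → trans (*-congˡ (sym (proj₂ q′∈))) (proj₂ (bq i))
      }
    where
      open FromReal x real
      module τ = HomOver hom
      module Γ = PartialIso (hom-graph hom)
      eval-graph : ∀ t → Γ.Graph (⟦ t ⟧ b , ⟦ t ⟧ x)
      eval-graph t = Γ.respects (refl , eval-cong t hom-b) (hom-graph-eval hom t)

      image⊆ : τ.Image ⊆ Fr Values[ x ]
      image⊆ {y} (l , e) =
        let r , w , (R , r≈) , (W , w≈) , w≉0 , lw≈r = L⊆ (proj₂ l)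
        in ⟦ R ⟧ x , ⟦ W ⟧ x , (R , refl) , (W , refl) , (λ z → w≉0 (trans w≈ (Γ.zero⇐ (eval-graph W) z))) ,
           functional (hom-graph hom) (Γ.*∈ (l , refl , e) (eval-graph W)) (eval-graph R) (trans (*-congˡ (sym w≈)) (trans lw≈r r≈))

      δ∈image : ∀ t → τ.Image (δ (⟦ t ⟧ x))
      δ∈image t = let l , _ , e = Γ.δ∈ (eval-graph t) in l , e

      strong = proj₂ (proj₂ normal hom)

      x∈ : ∀ i → Fr (Values[ b ] ⊗ C) (x i)
      x∈ i = generated⊆at b L⊆ (λ t → L.δ-closed (⟦b⟧∈L t)) (proj₂ strong (gen (inj₁ ((b i , b∈ i) , hom-b i))))

      b∈C : ∀ i → Fr (Values[ x ] ⊗ C) (b i)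
      b∈C i = generated⊆at x image⊆ δ∈image (proj₁ strong (gen (inj₁ (b∈ i))))

      com₁ = common b N x x∈ Vector.[] (λ ())
      module X₁ = Extends (proj₁ com₁)
      com₂ = common x N b b∈C X₁.c X₁.δc
      module X₂ = Extends (proj₁ com₂)
      q≉0 = proj₁ (proj₂ (proj₂ (proj₂ com₁)))
      q∈ = X₂.inc b (proj₁ (proj₂ (proj₂ com₁)))
      xq = λ i → X₂.inc b (proj₂ (proj₂ (proj₂ (proj₂ com₁))) i)
      q′∈ = proj₁ (proj₂ (proj₂ com₂))
      q′≉0 = proj₁ (proj₂ (proj₂ (proj₂ com₂)))
      bq = proj₂ (proj₂ (proj₂ (proj₂ com₂)))

-- Concatenation by recursion on the first vector, so that putting a new entry in front of
-- `join c v` computes to the assignment that an existential quantifier creates.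
join : ∀ {a} {A : Set a} {m n} → Vector A m → Vector A n → Vector A (m ℕ.+ n)
join {m = zero}  c v = v
join {m = suc m} c v = c fzero Vector.∷ join (c ∘ fsuc) v

join-↑ˡ : ∀ {a} {A : Set a} {m n} (c : Vector A m) (v : Vector A n) i → join c v (i ↑ˡ n) ≡ c i
join-↑ˡ c v fzero    = ≡.refl
join-↑ˡ c v (fsuc i) = join-↑ˡ (c ∘ fsuc) v i

join-↑ʳ : ∀ {a} {A : Set a} {m n} (c : Vector A m) (v : Vector A n) i → join c v (m ↑ʳ i) ≡ v i
join-↑ʳ {m = zero}  c v i = ≡.refl
join-↑ʳ {m = suc m} c v i = join-↑ʳ (c ∘ fsuc) v i

join-all : ∀ {a p} {A : Set a} {P : Pred A p} {m n} {c : Vector A m} {v : Vector A n} →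
           (∀ i → P (c i)) → (∀ i → P (v i)) → ∀ i → P (join c v i)
join-all {m = zero}  p q i        = q i
join-all {m = suc m} p q fzero    = p fzero
join-all {P = P} {m = suc m} {c = c} {v} p q (fsuc i) = join-all {P = P} {m = m} {c = c ∘ fsuc} {v} (p ∘ fsuc) q i

-- One pair of rational expressions for all realisations

module Uniformity (em : ∀ {a} → ExcludedMiddle a) {ℓ} (𝒜 : DifferentialField ℓ)
    (K L : DifferentialSubfield 𝒜) (charZero : CharZero 𝒜) (closed : DifferentiallyClosed 𝒜)
    (saturated : Saturated 𝒜) (K⊆L : DifferentialSubfield.Mem K ⊆ DifferentialSubfield.Mem L)
    (L-small : subsetSetoid 𝒜 (DifferentialSubfield.Mem L) ≺ DifferentialField.setoid 𝒜)
    (normal : StronglyNormal 𝒜 K L) where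
  open DifferentialField 𝒜 hiding (zero)
  open Classical em
  open Realisations em 𝒜 K L charZero closed saturated K⊆L L-small normal
  open RingSolver commutativeRing
  private
    module K = DifferentialSubfield K
    module L = DifferentialSubfield L
    module C = DifferentialSubfield (C𝒜 𝒜)

  evalAt-cong : ∀ {m} (P : RingTerm Term m) y {c c′ : Vector Carrier m} → (∀ j → c j ≈ c′ j) → evalAt P y c ≈ evalAt P y c′
  evalAt-cong P y = RingTermProperties.eval-cong commutativeRing (λ t → ⟦ t ⟧ y) P

  evalAt-rename : ∀ {m n} (r : Fin m → Fin n) P y c → evalAt (rename r P) y c ≡ evalAt P y (c ∘ r)
  evalAt-rename r P y c = RingTermProperties.eval-rename commutativeRing (λ t → ⟦ t ⟧ y) r P c

  -- The first new variable selects one of two families.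
  module _ (κ₁ κ₂ : Family) where
    private
      module κ₁ = Family κ₁
      module κ₂ = Family κ₂
      m = suc (κ₁.m ℕ.+ κ₂.m)

      r₁ : Fin κ₁.m → Fin m
      r₁ i = fsuc (i ↑ˡ κ₂.m)
      r₂ : Fin κ₂.m → Fin m
      r₂ i = fsuc (κ₁.m ↑ʳ i)

      select : RingTerm Term κ₁.m → RingTerm Term κ₂.m → RingTerm Term m
      select P₁ P₂ = (var fzero *′ rename r₁ P₁) +′ ((1′ +′ (-′ var fzero)) *′ rename r₂ P₂)

      select₁ : ∀ P₁ P₂ y c₁ c₂ → evalAt (select P₁ P₂) y (1# Vector.∷ join c₁ c₂) ≈ evalAt P₁ y c₁
      select₁ P₁ P₂ y c₁ c₂ = trans (solve 2 (λ p q → :1 :* p :+ (:1 :+ (:- :1)) :* q := p) refl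
          (evalAt (rename r₁ P₁) y (1# Vector.∷ join c₁ c₂)) (evalAt (rename r₂ P₂) y (1# Vector.∷ join c₁ c₂)))
        (trans (reflexive (evalAt-rename r₁ P₁ y (1# Vector.∷ join c₁ c₂)))
               (evalAt-cong P₁ y (λ j → reflexive (join-↑ˡ c₁ c₂ j))))

      select₂ : ∀ P₁ P₂ y c₁ c₂ → evalAt (select P₁ P₂) y (0# Vector.∷ join c₁ c₂) ≈ evalAt P₂ y c₂
      select₂ P₁ P₂ y c₁ c₂ = trans (solve 2 (λ p q → :0 :* p :+ (:1 :+ (:- :0)) :* q := q) refl
          (evalAt (rename r₁ P₁) y (0# Vector.∷ join c₁ c₂)) (evalAt (rename r₂ P₂) y (0# Vector.∷ join c₁ c₂)))
        (trans (reflexive (evalAt-rename r₂ P₂ y (0# Vector.∷ join c₁ c₂)))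
               (evalAt-cong P₂ y (λ j → reflexive (join-↑ʳ c₁ c₂ j))))

    merge : Family
    merge = record { m = m ; P = λ i → select (κ₁.P i) (κ₂.P i) ; P′ = λ i → select (κ₁.P′ i) (κ₂.P′ i)
                   ; Q = select κ₁.Q κ₂.Q ; Q′ = select κ₁.Q′ κ₂.Q′ }

    merge₁ : ∀ {x} → ∃ (Covers κ₁ x) → ∃ (Covers merge x)
    merge₁ {x} (c , cov) = 1# Vector.∷ join c (const 0#) , record
      { constant = λ { fzero → proj₂ C.1-closed ; (fsuc j) → join-all {P = λ z → δ z ≈ 0#} constant (λ _ → proj₂ C.0-closed) j }
      ; Q≉0  = λ z → Q≉0 (trans (sym (s κ₁.Q κ₂.Q b)) z)
      ; x≈   = λ i → trans (*-congˡ (s κ₁.Q κ₂.Q b)) (trans (x≈ i) (sym (s (κ₁.P i) (κ₂.P i) b)))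
      ; Q′≉0 = λ z → Q′≉0 (trans (sym (s κ₁.Q′ κ₂.Q′ x)) z)
      ; b≈   = λ i → trans (*-congˡ (s κ₁.Q′ κ₂.Q′ x)) (trans (b≈ i) (sym (s (κ₁.P′ i) (κ₂.P′ i) x)))
      }
      where
        open Covers cov
        s = λ P₁ P₂ y → select₁ P₁ P₂ y c (const 0#)

    merge₂ : ∀ {x} → ∃ (Covers κ₂ x) → ∃ (Covers merge x)
    merge₂ {x} (c , cov) = 0# Vector.∷ join (const 0#) c , record
      { constant = λ { fzero → proj₂ C.0-closed ; (fsuc j) → join-all {P = λ z → δ z ≈ 0#} {c = λ (_ : Fin κ₁.m) → 0#} (λ _ → proj₂ C.0-closed) constant j }
      ; Q≉0  = λ z → Q≉0 (trans (sym (s κ₁.Q κ₂.Q b)) z)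
      ; x≈   = λ i → trans (*-congˡ (s κ₁.Q κ₂.Q b)) (trans (x≈ i) (sym (s (κ₁.P i) (κ₂.P i) b)))
      ; Q′≉0 = λ z → Q′≉0 (trans (sym (s κ₁.Q′ κ₂.Q′ x)) z)
      ; b≈   = λ i → trans (*-congˡ (s κ₁.Q′ κ₂.Q′ x)) (trans (b≈ i) (sym (s (κ₁.P′ i) (κ₂.P′ i) x)))
      }
      where
        open Covers cov
        s = λ P₁ P₂ y → select₂ P₁ P₂ y (const 0#) c

  merge-all : ∀ κs → ∃ λ κ → 1 ≤ Family.m κ × ∀ x → Any (λ κ′ → ∃ (Covers κ′ x)) κs → ∃ (Covers κ x)
  -- One variable, so that the dimension is at least 1; with denominator 0 this family covers
  -- nothing.
  merge-all []       = record { m = 1 ; P = λ _ → 0′ ; P′ = λ _ → 0′ ; Q = 0′ ; Q′ = 0′ } , s≤s z≤n , λ x ()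
  merge-all (κ ∷ κs) =
    let κ′ , _ , h = merge-all κs
    in merge κ κ′ , s≤s z≤n , λ { x (here p) → merge₁ κ κ′ p ; x (there p) → merge₂ κ κ′ (h x p) }

  private
    Param : Set ℓ
    Param = Σ Carrier L.Mem

    embed : ∀ {m n} → (Fin m → Fin n) → RingTerm (Σ Carrier K.Mem) m → DiffTerm Param n
    embed r (var i)  = var (r i)
    embed r (par (c , c∈)) = par (c , K⊆L c∈)
    embed r 0′       = 0′
    embed r 1′       = 1′
    embed r (s +′ t) = embed r s +′ embed r t
    embed r (s *′ t) = embed r s *′ embed r t
    embed r (-′ t)   = -′ embed r t

    eval-embed : ∀ {m n} (r : Fin m → Fin n) t v → evalDiff 𝒜 proj₁ (embed r t) v ≡ evalRing commutativeRing proj₁ t (v ∘ r)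
    eval-embed r (var i)  v = ≡.refl
    eval-embed r (par c)  v = ≡.refl
    eval-embed r 0′       v = ≡.refl
    eval-embed r 1′       v = ≡.refl
    eval-embed r (s +′ t) v = ≡.cong₂ _+_ (eval-embed r s v) (eval-embed r t v)
    eval-embed r (s *′ t) v = ≡.cong₂ _*_ (eval-embed r s v) (eval-embed r t v)
    eval-embed r (-′ t)   v = ≡.cong -_ (eval-embed r t v)

    module _ {m n} (h : Term → DiffTerm Param (m ℕ.+ n)) where
      translate : RingTerm Term m → DiffTerm Param (m ℕ.+ n)
      translate (var j)  = var (j ↑ˡ n)
      translate (par t)  = h t
      translate 0′       = 0′
      translate 1′       = 1′
      translate (s +′ t) = translate s +′ translate t
      translate (s *′ t) = translate s *′ translate t
      translate (-′ t)   = -′ translate t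

      eval-translate : ∀ y c (v : Vector Carrier n) → (∀ t → evalDiff 𝒜 proj₁ (h t) (join c v) ≈ ⟦ t ⟧ y) →
        ∀ P → evalDiff 𝒜 proj₁ (translate P) (join c v) ≈ evalAt P y c
      eval-translate y c v e (var j)  = reflexive (join-↑ˡ c v j)
      eval-translate y c v e (par t)  = e t
      eval-translate y c v e 0′       = refl
      eval-translate y c v e 1′       = refl
      eval-translate y c v e (s +′ t) = +-cong (eval-translate y c v e s) (eval-translate y c v e t)
      eval-translate y c v e (s *′ t) = *-cong (eval-translate y c v e s) (eval-translate y c v e t)
      eval-translate y c v e (-′ t)   = -‿cong (eval-translate y c v e t)

    conj : ∀ k {n} → (Fin k → DiffFormula Param n) → DiffFormula Param n
    conj zero    φ = 0′ ≈′ 0′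
    conj (suc k) φ = φ fzero ∧′ conj k (φ ∘ fsuc)

    conj⇒ : ∀ k {n} (φ : Fin k → DiffFormula Param n) v → Sat 𝒜 proj₁ (conj k φ) v → ∀ i → Sat 𝒜 proj₁ (φ i) v
    conj⇒ (suc k) φ v (p , q) fzero    = p
    conj⇒ (suc k) φ v (p , q) (fsuc i) = conj⇒ k (φ ∘ fsuc) v q i

    conj⇐ : ∀ k {n} (φ : Fin k → DiffFormula Param n) v → (∀ i → Sat 𝒜 proj₁ (φ i) v) → Sat 𝒜 proj₁ (conj k φ) v
    conj⇐ zero    φ v p = refl
    conj⇐ (suc k) φ v p = p fzero , conj⇐ k (φ ∘ fsuc) v (p ∘ fsuc)

    exists : ∀ m {n} → DiffFormula Param (m ℕ.+ n) → DiffFormula Param n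
    exists zero    φ = φ
    exists (suc m) φ = exists m (∃′ φ)

    exists⇒ : ∀ m {n} (φ : DiffFormula Param (m ℕ.+ n)) v → Sat 𝒜 proj₁ (exists m φ) v → ∃ λ c → Sat 𝒜 proj₁ φ (join {m = m} c v)
    exists⇒ zero    φ v p = Vector.[] , p
    exists⇒ (suc m) φ v p = let c , y , q = exists⇒ m (∃′ φ) v p in y Vector.∷ c , q

    exists⇐ : ∀ m {n} (φ : DiffFormula Param (m ℕ.+ n)) v c → Sat 𝒜 proj₁ φ (join {m = m} c v) → Sat 𝒜 proj₁ (exists m φ) v
    exists⇐ zero    φ v c p = p
    exists⇐ (suc m) φ v c p = exists⇐ m (∃′ φ) v (c ∘ fsuc) (c fzero , p)

    module _ (κ : Family) where
      open Family κ

      at-b at-x : RingTerm Term m → DiffTerm Param (m ℕ.+ N)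
      at-b = translate (λ t → par (⟦ t ⟧ b , ⟦b⟧∈L t))
      at-x = translate (λ t → embed (m ↑ʳ_) t)

      eval-b : ∀ c x P → evalDiff 𝒜 proj₁ (at-b P) (join c x) ≈ evalAt P b c
      eval-b c x = eval-translate _ b c x (λ _ → refl)

      eval-x : ∀ c x P → evalDiff 𝒜 proj₁ (at-x P) (join c x) ≈ evalAt P x c
      eval-x c x = eval-translate _ x c x λ t → trans (reflexive (eval-embed (m ↑ʳ_) t (join c x)))
        (RingTermProperties.eval-cong commutativeRing proj₁ t (λ i → reflexive (join-↑ʳ c x i)))

      body : DiffFormula Param (m ℕ.+ N)
      body = conj m (λ j → (δ′ var (j ↑ˡ N)) ≈′ 0′)
          ∧′ ((¬′ (at-b Q ≈′ 0′)) ∧′ (conj N (λ i → (var (m ↑ʳ i) *′ at-b Q) ≈′ at-b (P i))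
          ∧′ ((¬′ (at-x Q′ ≈′ 0′)) ∧′ conj N (λ i → (par (b i , b∈ i) *′ at-x Q′) ≈′ at-x (P′ i)))))

      covering : DiffFormula Param N
      covering = exists m body

      covering⇒ : ∀ x → Sat 𝒜 proj₁ covering x → ∃ (Covers κ x)
      covering⇒ x s =
        let c , p₁ , p₂ , p₃ , p₄ , p₅ = exists⇒ m body x s
        in c , record
          { constant = λ j → trans (δ-cong (sym (reflexive (join-↑ˡ c x j)))) (conj⇒ m (λ j → (δ′ var (j ↑ˡ N)) ≈′ 0′) (join c x) p₁ j)
          ; Q≉0 = λ z → p₂ (trans (eval-b c x Q) z)
          ; x≈ = λ i → trans (sym (*-cong (reflexive (join-↑ʳ c x i)) (eval-b c x Q)))
                   (trans (conj⇒ N (λ i → (var (m ↑ʳ i) *′ at-b Q) ≈′ at-b (P i)) (join c x) p₃ i) (eval-b c x (P i)))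
          ; Q′≉0 = λ z → p₄ (trans (eval-x c x Q′) z)
          ; b≈ = λ i → trans (sym (*-congˡ (eval-x c x Q′)))
                   (trans (conj⇒ N (λ i → (par (b i , b∈ i) *′ at-x Q′) ≈′ at-x (P′ i)) (join c x) p₅ i) (eval-x c x (P′ i)))
          }

      covering⇐ : ∀ x → ∃ (Covers κ x) → Sat 𝒜 proj₁ covering x
      covering⇐ x (c , cov) = exists⇐ m body x c
        ( conj⇐ m (λ j → (δ′ var (j ↑ˡ N)) ≈′ 0′) (join c x) (λ j → trans (δ-cong (reflexive (join-↑ˡ c x j))) (constant j))
        , (λ z → Q≉0 (trans (sym (eval-b c x Q)) z))
        , conj⇐ N (λ i → (var (m ↑ʳ i) *′ at-b Q) ≈′ at-b (P i)) (join c x)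
            (λ i → trans (*-cong (reflexive (join-↑ʳ c x i)) (eval-b c x Q)) (trans (x≈ i) (sym (eval-b c x (P i)))))
        , (λ z → Q′≉0 (trans (sym (eval-x c x Q′)) z))
        , conj⇐ N (λ i → (par (b i , b∈ i) *′ at-x Q′) ≈′ at-x (P′ i)) (join c x)
            (λ i → trans (*-congˡ (eval-x c x Q′)) (trans (b≈ i) (sym (eval-x c x (P′ i))))))
        where open Covers cov

    ⌜_⌝ : Term → DiffTerm Param N
    ⌜ t ⌝ = embed id t

    eval-⌜⌝ : ∀ t x → evalDiff 𝒜 proj₁ ⌜ t ⌝ x ≈ ⟦ t ⟧ x
    eval-⌜⌝ t x = reflexive (eval-embed id t x)

    -- The type over L of a realisation covered by no family. By `covered` nothing satisfies it, so
    -- by saturation some finite part is inconsistent, and the families occurring in that part cover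
    -- every realisation between them.
    data Condition : DiffFormula Param N → Set ℓ where
      vanishes : ∀ t → ⟦ t ⟧ b ≈ 0# → Condition (⌜ t ⌝ ≈′ 0′)
      nonzero  : ∀ t → ¬ ⟦ t ⟧ b ≈ 0# → Condition (¬′ (⌜ t ⌝ ≈′ 0′))
      derivative : ∀ i → Condition (((δ′ var i) *′ ⌜ δden i ⌝) ≈′ ⌜ δnum i ⌝)
      uncovered  : ∀ κ → Condition (¬′ covering κ)

    satisfies⇒real : ∀ x → (∀ φ → Condition φ → Sat 𝒜 proj₁ φ x) → Real x
    satisfies⇒real x sat = record
      { zero⇒ = λ t z → trans (sym (eval-⌜⌝ t x)) (sat _ (vanishes t z))
      ; zero⇐ = λ t z → stable λ ne → sat _ (nonzero t ne) (trans (eval-⌜⌝ t x) z)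
      ; δ≈ = λ i → trans (*-congˡ (sym (eval-⌜⌝ (δden i) x))) (trans (sat _ (derivative i)) (eval-⌜⌝ (δnum i) x))
      }

    families : ∀ φs → All Condition φs → List Family
    families []       []                 = []
    families (_ ∷ φs) (uncovered κ ∷ ps) = κ ∷ families φs ps
    families (_ ∷ φs) (_ ∷ ps)           = families φs ps

    real⇒satisfies : ∀ x → Real x → ∀ φs (ps : All Condition φs) → ¬ Any (λ κ → ∃ (Covers κ x)) (families φs ps) →
                     All (λ φ → Sat 𝒜 proj₁ φ x) φs
    real⇒satisfies x r []       []                  ne = []
    real⇒satisfies x r (_ ∷ φs) (vanishes t z ∷ ps) ne = trans (eval-⌜⌝ t x) (Real.zero⇒ r t z) ∷ real⇒satisfies x r φs ps ne
    real⇒satisfies x r (_ ∷ φs) (nonzero t z ∷ ps)  ne = (λ e → z (Real.zero⇐ r t (trans (sym (eval-⌜⌝ t x)) e))) ∷ real⇒satisfies x r φs ps ne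
    real⇒satisfies x r (_ ∷ φs) (derivative i ∷ ps) ne =
      trans (*-congˡ (eval-⌜⌝ (δden i) x)) (trans (Real.δ≈ r i) (sym (eval-⌜⌝ (δnum i) x))) ∷ real⇒satisfies x r φs ps ne
    real⇒satisfies x r (_ ∷ φs) (uncovered κ ∷ ps)  ne =
      (λ s → ne (here (covering⇒ κ x s))) ∷ real⇒satisfies x r φs ps (ne ∘ there)

    inconsistent : ∃ λ φs → All Condition φs × ¬ ∃ λ v → All (λ φ → Sat 𝒜 proj₁ φ v) φs
    inconsistent = stable λ ¬∃ →
      let x , sat = saturated L.Mem L-small N Condition (λ φs ps → stable λ ne → ¬∃ (φs , ps , ne))
          κ , c , cov = covered (satisfies⇒real x sat)
      in sat _ (uncovered κ) (covering⇐ κ x (c , cov))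

    merged : ∃ λ κ → 1 ≤ Family.m κ × ∀ x → Any (λ κ′ → ∃ (Covers κ′ x)) (families (proj₁ inconsistent) (proj₁ (proj₂ inconsistent))) → ∃ (Covers κ x)
    merged = merge-all (families (proj₁ inconsistent) (proj₁ (proj₂ inconsistent)))

  abstract
    family : Family
    family = proj₁ merged

    1≤family : 1 ≤ Family.m family
    1≤family = proj₁ (proj₂ merged)

    uniformly-covered : ∀ {x} → Real x → ∃ (Covers family x)
    uniformly-covered {x} r = proj₂ (proj₂ merged) x (stable λ ne →
      proj₂ (proj₂ inconsistent) (x , real⇒satisfies x r (proj₁ inconsistent) (proj₁ (proj₂ inconsistent)) ne))

-- Triangular sets, and exclusion of proper specialisations

module Genericity (em : ∀ {a} → ExcludedMiddle a) {ℓ} (𝒜 : DifferentialField ℓ)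
    (K L : DifferentialSubfield 𝒜) (charZero : CharZero 𝒜) (closed : DifferentiallyClosed 𝒜)
    (saturated : Saturated 𝒜) (K⊆L : DifferentialSubfield.Mem K ⊆ DifferentialSubfield.Mem L)
    (L-small : subsetSetoid 𝒜 (DifferentialSubfield.Mem L) ≺ DifferentialField.setoid 𝒜)
    (normal : StronglyNormal 𝒜 K L) where
  open DifferentialField 𝒜 hiding (zero)
  open Classical em
  open DifferentialPolynomials em 𝒜 using (integral; *-≉0)
  open Pairs em 𝒜 using (module 𝒫; Zero₁; Zero₂; zero₁-prime; zero₂-prime)
  open Homomorphisms em 𝒜 K L charZero closed saturated K⊆L L-small using (constants⊆K)
  open FieldGeneration em 𝒜 K L charZero closed saturated K⊆L L-small normal using (generated⊆⊗; eval-rename; eval-cong)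
  open Realisations em 𝒜 K L charZero closed saturated K⊆L L-small normal
  open RingSolver commutativeRing
  open SubringTheory commutativeRing
  open BoxTheory commutativeRing
  open LinearAlgebra em 𝒜
  open LinearDisjointness em 𝒜 using (Ĉ; Ĉ-isSubring; linearly-disjoint)
  open Exp commutativeSemiring using (_^_)
  private
    module K = DifferentialSubfield K
    module L = DifferentialSubfield L
    module Sub𝒫 = SubringTheory 𝒫.commutativeRing
    module Exp𝒫 = Exp 𝒫.commutativeSemiring
    module S𝒫 = RingSolver 𝒫.commutativeRing
    C = DifferentialSubfield.Mem (C𝒜 𝒜)

    KTerm : ℕ → Set ℓ
    KTerm = RingTerm (Σ Carrier K.Mem)

    eval : ∀ {n} → KTerm n → Vector Carrier n → Carrier
    eval = evalRing commutativeRing proj₁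

  -- The equations are minimal polynomials of each entry over the field of the following ones, the
  -- inequations their leading coefficients. They take the place of a finite basis of the ideal of
  -- relations of b.
  record TriangularSet {n} (b : Vector Carrier n) : Set ℓ where
    field
      eqs neqs : List (KTerm n)
      eqs∋b    : All (λ t → eval t b ≈ 0#) eqs
      neqs∋b   : All (λ t → ¬ eval t b ≈ 0#) neqs
      vanishes : ∀ x → All (λ t → eval t x ≈ 0#) eqs → All (λ t → ¬ eval t x ≈ 0#) neqs →
                 ∀ t → eval t b ≈ 0# → eval t x ≈ 0#

  private
    horner : ∀ {n} → List (KTerm n) → KTerm (suc n)
    horner []       = 0′
    horner (g ∷ gs) = rename fsuc g +′ (var fzero *′ horner gs)

    module _ {n} (b x : Vector Carrier (suc n)) where
      private
        b′ x′ : Vector Carrier n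
        b′ = b ∘ fsuc
        x′ = x ∘ fsuc

      A : Pred 𝒫.Carrier ℓ
      A = PairValues b′ x′

      A-sub : Sub𝒫.IsSubring A
      A-sub = pairValues-isSubring b′ x′

      û : 𝒫.Carrier
      û = b fzero , x fzero

      ⟪_⟫ : KTerm n → 𝒫.Carrier
      ⟪ t ⟫ = eval t b′ , eval t x′

      H : List (KTerm n) → 𝒫.Carrier
      H gs = eval (horner gs) b , eval (horner gs) x

      H-∷ : ∀ g gs → H (g ∷ gs) 𝒫.≈ ⟪ g ⟫ 𝒫.+ û 𝒫.* H gs
      H-∷ g gs = +-congʳ (reflexive (eval-rename fsuc g b)) , +-congʳ (reflexive (eval-rename fsuc g x))

      toDeg : ∀ gs → Sub𝒫.Deg A û (length gs) (H gs)
      toDeg []       = 𝒫.refl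
      toDeg (g ∷ gs) = ⟪ g ⟫ , H gs , (g , 𝒫.refl) , toDeg gs , H-∷ g gs

      fromDeg : ∀ k {v} → Sub𝒫.Deg A û k v → ∃ λ gs → length gs ≡ k × v 𝒫.≈ H gs
      fromDeg zero    p = [] , ≡.refl , p
      fromDeg (suc k) (a , w , (t , p) , q , e) =
        let gs , len , e′ = fromDeg k q
        in t ∷ gs , ≡.cong suc len , 𝒫.trans e (𝒫.trans (𝒫.+-cong p (𝒫.*-congˡ {x = û} e′)) (𝒫.sym (H-∷ t gs)))

      H-snoc : ∀ gs l → H (gs ++ l ∷ []) 𝒫.≈ H gs 𝒫.+ ⟪ l ⟫ 𝒫.* û Exp𝒫.^ length gs
      H-snoc []       l = 𝒫.trans (H-∷ l []) (lemma ⟪ l ⟫ û)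
        where
          lemma : ∀ l u → l 𝒫.+ u 𝒫.* 𝒫.0# 𝒫.≈ 𝒫.0# 𝒫.+ l 𝒫.* 𝒫.1#
          lemma = S𝒫.solve 2 (λ l u → l S𝒫.:+ u S𝒫.:* S𝒫.:0 S𝒫.:= S𝒫.:0 S𝒫.:+ l S𝒫.:* S𝒫.:1) 𝒫.refl
      H-snoc (g ∷ gs) l = 𝒫.trans (H-∷ g (gs ++ l ∷ [])) (𝒫.trans (𝒫.+-congˡ {⟪ g ⟫} (𝒫.*-congˡ {û} (H-snoc gs l)))
        (𝒫.trans (lemma ⟪ g ⟫ û (H gs) ⟪ l ⟫ (û Exp𝒫.^ length gs)) (𝒫.+-congʳ {⟪ l ⟫ 𝒫.* û Exp𝒫.^ suc (length gs)} (𝒫.sym (H-∷ g gs)))))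
        where
          lemma : ∀ a u g l p → a 𝒫.+ u 𝒫.* (g 𝒫.+ l 𝒫.* p) 𝒫.≈ (a 𝒫.+ u 𝒫.* g) 𝒫.+ l 𝒫.* (u 𝒫.* p)
          lemma = S𝒫.solve 5 (λ a u g l p → a S𝒫.:+ u S𝒫.:* (g S𝒫.:+ l S𝒫.:* p) S𝒫.:= (a S𝒫.:+ u S𝒫.:* g) S𝒫.:+ l S𝒫.:* (u S𝒫.:* p)) 𝒫.refl

      eval∈A[û] : ∀ t → (A Sub𝒫.[ û ]) (eval t b , eval t x)
      eval∈A[û] = pair-eval∈ sub (λ {k} k∈ → Sub𝒫.A⊆A[u] A-sub û (par (k , k∈) , 𝒫.refl))
        λ { fzero → Sub𝒫.u∈A[u] A-sub û ; (fsuc i) → Sub𝒫.A⊆A[u] A-sub û (var i , 𝒫.refl) }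
        where sub = Sub𝒫.[u]-isSubring A-sub û

    AlgebraicOf : ∀ {n} → Vector Carrier (suc n) → ℕ → Set ℓ
    AlgebraicOf {n} b d = ∃ λ (gs : List (KTerm n)) → ∃ λ (l : KTerm n) →
      length gs ≡ d × ¬ eval l (b ∘ fsuc) ≈ 0# × eval (horner (gs ++ l ∷ [])) b ≈ 0#

    minimal : ∀ {n} (b x : Vector Carrier (suc n)) d → (∀ j → j < d → ¬ AlgebraicOf b j) →
              Sub𝒫.Minimal (A-sub b x) (û b x) Zero₁ d
    minimal b x d below j j<d w∈ (l , l≈) p = stable λ ne →
      let gs , len , g≈ = fromDeg b x j w∈
      in below j j<d (gs , l , len , (λ z → ne (trans (proj₁ l≈) z)) ,
           trans (trans (proj₁ (H-snoc b x gs l)) (sym (proj₁ (𝒫.+-cong g≈ (𝒫.*-cong l≈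
             (𝒫.reflexive (≡.cong (û b x Exp𝒫.^_) (≡.sym len)))))))) p)

  triangularSet : ∀ {n} (b : Vector Carrier n) → TriangularSet b
  triangularSet {zero}  b = record { eqs = [] ; neqs = [] ; eqs∋b = [] ; neqs∋b = []
                                   ; vanishes = λ x _ _ t z → trans (eval-cong t (λ ())) z }
  triangularSet {suc n} b = [ algebraic , transcendental ]′ cases
    where
      open TriangularSet (triangularSet (b ∘ fsuc))
        renaming (eqs to eqs′; neqs to neqs′; eqs∋b to eqs∋b′; neqs∋b to neqs∋b′; vanishes to vanishes′)

      ↑ : List (KTerm n) → List (KTerm (suc n))
      ↑ = List.map (rename fsuc)

      up≈ : ∀ {y ts} → All (λ t → eval t (y ∘ fsuc) ≈ 0#) ts → All (λ t → eval t y ≈ 0#) (↑ ts)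
      up≈ {y} ps = All.map⁺ (All.map (λ {t} p → trans (reflexive (eval-rename fsuc t y)) p) ps)
      up≉ : ∀ {y ts} → All (λ t → ¬ eval t (y ∘ fsuc) ≈ 0#) ts → All (λ t → ¬ eval t y ≈ 0#) (↑ ts)
      up≉ {y} ps = All.map⁺ (All.map (λ {t} p z → p (trans (sym (reflexive (eval-rename fsuc t y))) z)) ps)
      down≈ : ∀ {y ts} → All (λ t → eval t y ≈ 0#) (↑ ts) → All (λ t → eval t (y ∘ fsuc) ≈ 0#) ts
      down≈ {y} ps = All.map (λ {t} p → trans (sym (reflexive (eval-rename fsuc t y))) p) (All.map⁻ ps)
      down≉ : ∀ {y ts} → All (λ t → ¬ eval t y ≈ 0#) (↑ ts) → All (λ t → ¬ eval t (y ∘ fsuc) ≈ 0#) ts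
      down≉ {y} ps = All.map (λ {t} p z → p (trans (reflexive (eval-rename fsuc t y)) z)) (All.map⁻ ps)

      A⇒ : ∀ x → All (λ t → eval t x ≈ 0#) (↑ eqs′) → All (λ t → ¬ eval t x ≈ 0#) (↑ neqs′) →
           ∀ {v} → A b x v → Zero₁ v → Zero₂ v
      A⇒ x es ns (t , p , q) z = trans q (vanishes′ (x ∘ fsuc) (down≈ es) (down≉ ns) t (trans (sym p) z))

      Least : Set ℓ
      Least = ∃ λ d → AlgebraicOf b d × ∀ j → j < d → ¬ AlgebraicOf b j

      cases : Least ⊎ (∀ j → ¬ AlgebraicOf b j)
      cases with decide (∃ (AlgebraicOf b))
      ... | yes p = inj₁ (least (AlgebraicOf b) p)
      ... | no ¬p = inj₂ λ j a → ¬p (j , a)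

      transcendental : (∀ j → ¬ AlgebraicOf b j) → TriangularSet b
      -- No equation is added: a relation of b has all its coefficients vanishing at the remaining
      -- entries, where the induction applies.
      transcendental none-alg = record
        { eqs = ↑ eqs′ ; neqs = ↑ neqs′ ; eqs∋b = up≈ eqs∋b′ ; neqs∋b = up≉ neqs∋b′
        ; vanishes = λ x es ns t →
            Sub𝒫.minimal-small (A-sub b x) (û b x) zero₁-prime zero₂-prime (A⇒ x es ns) (proj₁ (eval∈A[û] b x t))
              (minimal b x _ (λ j _ → none-alg j)) (proj₂ (eval∈A[û] b x t))
        }

      algebraic : Least → TriangularSet b
      algebraic (d , (gs , l , len , l≉0 , root) , below) = record
        { eqs = horner (gs ++ l ∷ []) ∷ ↑ eqs′ ; neqs = rename fsuc l ∷ ↑ neqs′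
        ; eqs∋b = root ∷ up≈ eqs∋b′
        ; neqs∋b = (λ z → l≉0 (trans (sym (reflexive (eval-rename fsuc l b))) z)) ∷ up≉ neqs∋b′
        ; vanishes = vanishing
        }
        where
          vanishing : ∀ x → All (λ t → eval t x ≈ 0#) (horner (gs ++ l ∷ []) ∷ ↑ eqs′) →
                      All (λ t → ¬ eval t x ≈ 0#) (rename fsuc l ∷ ↑ neqs′) → ∀ t → eval t b ≈ 0# → eval t x ≈ 0#
          -- The added inequation keeps the leading coefficient l nonzero at x, which is what
          -- reduction by the minimal polynomial requires there.
          vanishing x (e ∷ es) (ne ∷ ns) t =
            Sub𝒫.vanishing-reduces (A-sub b x) (û b x) zero₁-prime zero₂-prime d {⟪_⟫ b x l} {H b x gs}
              (Sub𝒫.minimal-small (A-sub b x) (û b x) zero₁-prime zero₂-prime (A⇒ x es ns) d (minimal b x d below))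
              (l , 𝒫.refl) (λ z → ne (trans (reflexive (eval-rename fsuc l x)) z))
              (≡.subst (λ k → Sub𝒫.Deg (A b x) (û b x) k (H b x gs)) len (toDeg b x gs))
              (trans (sym (proj₁ F≈)) root) (trans (sym (proj₂ F≈)) e)
              (eval∈A[û] b x t)
            where
              F≈ : H b x (gs ++ l ∷ []) 𝒫.≈ H b x gs 𝒫.+ ⟪_⟫ b x l 𝒫.* û b x Exp𝒫.^ d
              F≈ = ≡.subst (λ k → H b x (gs ++ l ∷ []) 𝒫.≈ H b x gs 𝒫.+ ⟪_⟫ b x l 𝒫.* û b x Exp𝒫.^ k) len (H-snoc b x gs l)

  private
    F : DifferentialSubfield 𝒜
    F = ⟨_,_⟩ 𝒜 K.Mem C
    module F = DifferentialSubfield F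
    F-sub = F-isSubring F
    module ⊗𝒫 = ConstantSpan (pairRing 𝒜)
    module ⊗𝒜 = ConstantSpan (underlyingRing 𝒜)

  -- b is a rational function of its specialisation x over F = ⟨ K , C ⟩.  If t₀(x) = 0 and t₀(b) ≠ 0, then
  -- an F-independent family in F[b] yields one in F[x], hence by specialisation a family ws in F[b] that is
  -- independent modulo t₀(b); the products t₀(b)ʲ w, j ≤ D, are independent too.  After N + 1 rounds there
  -- are more of them than monomials of the degree reached.
  module _ {x : Vector Carrier N} (specialises : ∀ t → ⟦ t ⟧ b ≈ 0# → ⟦ t ⟧ x ≈ 0#)
           {q : Carrier} (q≉0 : ¬ q ≈ 0#) (q∈ : SomeBox F-sub x q) (bq∈ : ∀ i → SomeBox F-sub x (b i * q)) where
    private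
      V = PairValues b x
      V-sub = pairValues-isSubring b x
      V⊗Ĉ-sub = ⊗𝒫.⊗-isSubring V-sub Ĉ-isSubring

      -- The graph of the specialisation b ↦ x, taken to be the identity on constants and extended
      -- to quotients whose denominators do not specialise to 0.
      Hull : Pred 𝒫.Carrier ℓ
      Hull = FrP.Fr (V ⊗𝒫.⊗ Ĉ)
      Hull-sub : Sub𝒫.IsSubring Hull
      Hull-sub = FrP.Fr-isSubring V⊗Ĉ-sub
      module Hull = Sub𝒫.IsSubring Hull-sub

      -- The specialisation is given over K only. Constants of L lie in K, so linear disjointness
      -- carries it over to coefficients from all of C.
      hull⇒ : ∀ {v} → Hull v → Zero₁ v → Zero₂ v
      hull⇒ = FrP.Fr-zero⇒ (linearly-disjoint L V-sub
        (λ (t , p , _) → L.resp (sym p) (⟦b⟧∈L t))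
        (λ {c} c∈ δc → par (c , constants⊆K (proj₁ normal) (proj₂ normal) c∈ δc) , 𝒫.refl)
        (λ (t , p , e) z → trans e (specialises t (trans (sym p) z))))

      value∈ : ∀ t → Hull (⟦ t ⟧ b , ⟦ t ⟧ x)
      value∈ t = FrP.⊆Fr V⊗Ĉ-sub (⊗𝒫.A⊆⊗ V-sub Ĉ-isSubring (t , 𝒫.refl))

      diagonal∈ : ∀ {f} → F.Mem f → Hull (f , f)
      diagonal∈ f∈ =
        let r , w , r∈ , w∈ , w≉0 , e = generated⊆⊗ (F-isSubring K) K.δ-closed f∈
        in (r , r) , (w , w) , double r∈ , double w∈ , (w≉0 , w≉0) , (e , e)
        where
          double : ∀ {v} → (K.Mem ⊗𝒜.⊗ C) v → (V ⊗𝒫.⊗ Ĉ) (v , v)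
          double (⊗𝒜.none p) = ⊗𝒫.none (p , p)
          double (⊗𝒜.term {a} {c} a∈ c∈ w∈ p) = ⊗𝒫.term {a = a , a} {c = c , c} (par (a , a∈) , 𝒫.refl) (c∈ , refl) (double w∈) (p , p)

      -- Replaces w by v in a polynomial and keeps its coefficients, since `diagonal∈` puts the
      -- elements of F on the diagonal of `Hull`.
      lift : ∀ {n} (v w : Vector Carrier n) → (∀ i → Hull (v i , w i)) → ∀ D {y} → Box F.Mem w D y →
             ∃ λ z → Box F.Mem v D z × Hull (z , y)
      lift {zero}  v w vw∈ D {y} p = y , p , diagonal∈ p
      lift {suc n} v w vw∈ D p = go (suc D) p
        where
          go : ∀ k {y} → Deg (Box F.Mem (w ∘ fsuc) D) (w fzero) k y →
               ∃ λ z → Deg (Box F.Mem (v ∘ fsuc) D) (v fzero) k z × Hull (z , y)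
          go zero    p = 0# , refl , Hull.respects (refl , sym p) Hull.0∈
          go (suc k) (a , y′ , a∈ , y∈ , e) =
            let a₁ , a₁∈ , ha = lift (v ∘ fsuc) (w ∘ fsuc) (vw∈ ∘ fsuc) D a∈
                z , z∈ , hz = go k y∈
            in a₁ + v fzero * z , (a₁ , z , a₁∈ , z∈ , refl) , Hull.respects (refl , sym e) (Hull.+∈ ha (Hull.*∈ (vw∈ fzero) hz))

      lift-list : ∀ D ws → All (Box F.Mem x D) ws →
        ∃ λ us → List.map proj₂ us ≡ ws × All (λ u → Box F.Mem b D (proj₁ u)) us × All Hull us
      lift-list D []       []       = [] , ≡.refl , [] , []
      lift-list D (w ∷ ws) (p ∷ ps) =
        let z , z∈ , h = lift b x (λ i → value∈ (var i)) D p
            us , e , all , hs = lift-list D ws ps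
        in (z , w) ∷ us , ≡.cong (w ∷_) e , z∈ ∷ all , h ∷ hs

      lc-hull : ∀ cs us → All F.Mem cs → All Hull us → Hull (lc cs (List.map proj₁ us) , lc cs (List.map proj₂ us))
      lc-hull []       us       _        _        = Hull.0∈
      lc-hull (c ∷ cs) []       _        _        = Hull.0∈
      lc-hull (c ∷ cs) (u ∷ us) (p ∷ ps) (h ∷ hs) = Hull.+∈ (Hull.*∈ (diagonal∈ p) h) (lc-hull cs us ps hs)

      InHull : Pred Carrier ℓ
      InHull v = ∃ λ w → Hull (v , w)

      lc-inHull : ∀ cs vs → All F.Mem cs → All InHull vs → InHull (lc cs vs)
      lc-inHull []       vs       _        _        = 0# , Hull.0∈
      lc-inHull (c ∷ cs) []       _        _        = 0# , Hull.0∈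
      lc-inHull (c ∷ cs) (v ∷ vs) (p ∷ ps) ((w , h) ∷ hs) =
        let w′ , h′ = lc-inHull cs vs ps hs in c * w + w′ , Hull.+∈ (Hull.*∈ (diagonal∈ p) h) h′

      module _ (t₀ : Term) (t₀b≉0 : ¬ ⟦ t₀ ⟧ b ≈ 0#) (t₀x≈0 : ⟦ t₀ ⟧ x ≈ 0#) where
        u₀ : Carrier
        u₀ = ⟦ t₀ ⟧ b

        powers-inHull : ∀ ws → All InHull ws → ∀ k → All InHull (powers ws u₀ k)
        powers-inHull ws hs zero    = []
        powers-inHull ws hs (suc k) = All.++⁺ hs (All.map⁺ (All.map (λ (w , h) → ⟦ t₀ ⟧ x * w , Hull.*∈ (value∈ t₀) h) (powers-inHull ws hs k)))

        first-inHull : ∀ us → All Hull us → All InHull (List.map proj₁ us)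
        first-inHull us hs = All.map⁺ (All.map (λ {u} h → proj₂ u , h) hs)

        -- Specialising a relation kills every term with a positive power of `u₀`, because t₀(x) =
        -- 0; independence of the specialised family then removes the block without `u₀`, and the
        -- rest is divided by `u₀`, which is nonzero.
        powers-independent : ∀ us → All Hull us → Independent F (List.map proj₂ us) → ∀ k → Independent F (powers (List.map proj₁ us) u₀ k)
        powers-independent us hs ind zero    [] _ _ _ = []
        powers-independent us hs ind (suc k) cs cs∈ len e =
          ≡.subst (All (_≈ 0#)) (≡.sym cs≡) (All.++⁺ c₁≈0
            (powers-independent us hs ind k c₂ c₂∈ (≡.trans len₂ (List.length-map (u₀ *_) ps)) rest≈0))
          where
            ws ps : List Carrier
            ws = List.map proj₁ us
            ps = powers ws u₀ k
            split = split-length ws (List.map (u₀ *_) ps) cs len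
            c₁ = proj₁ split
            c₂ = proj₁ (proj₂ split)
            cs≡ : cs ≡ c₁ ++ c₂
            cs≡ = proj₁ (proj₂ (proj₂ split))
            len₁ : length c₁ ≡ length ws
            len₁ = proj₁ (proj₂ (proj₂ (proj₂ split)))
            len₂ : length c₂ ≡ length (List.map (u₀ *_) ps)
            len₂ = proj₂ (proj₂ (proj₂ (proj₂ split)))
            cs∈′ : All F.Mem (c₁ ++ c₂)
            cs∈′ = ≡.subst (All F.Mem) cs≡ cs∈
            c₁∈ : All F.Mem c₁
            c₁∈ = All.++⁻ˡ c₁ cs∈′
            c₂∈ : All F.Mem c₂
            c₂∈ = All.++⁻ʳ c₁ cs∈′
            e₁ : lc c₁ ws + u₀ * lc c₂ ps ≈ 0#
            e₁ = trans (sym (+-congˡ (lc-map u₀ c₂ ps))) (trans (sym (lc-++ c₁ c₂ ws (List.map (u₀ *_) ps) len₁))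
                   (trans (reflexive (≡.cong (λ l → lc l (ws ++ List.map (u₀ *_) ps)) (≡.sym cs≡))) e))
            rest : InHull (lc c₂ ps)
            rest = lc-inHull c₂ ps c₂∈ (powers-inHull ws (first-inHull us hs) k)
            second≈0 : lc c₁ (List.map proj₂ us) + ⟦ t₀ ⟧ x * proj₁ rest ≈ 0#
            second≈0 = hull⇒ (Hull.+∈ (lc-hull c₁ us c₁∈ hs) (Hull.*∈ (value∈ t₀) (proj₂ rest))) e₁
            c₁≈0 : All (_≈ 0#) c₁
            c₁≈0 = ind c₁ c₁∈ (≡.trans len₁ (≡.trans (List.length-map proj₁ us) (≡.sym (List.length-map proj₂ us))))
              (trans (sym (trans (+-congˡ (trans (*-congʳ t₀x≈0) (zeroˡ (proj₁ rest)))) (+-identityʳ _))) second≈0)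
            rest≈0 : lc c₂ ps ≈ 0#
            rest≈0 = [ (λ z → contradiction z t₀b≉0) , id ]′ (integral (trans (sym (trans (+-congʳ (lc-zero c₁ ws c₁≈0)) (+-identityˡ _))) e₁))

        powers-box : ∀ {ws D e} → All (Box F.Mem b D) ws → Box F.Mem b e u₀ → ∀ k → All (Box F.Mem b (D ℕ.+ k ℕ.* e)) (powers ws u₀ (suc k))
        powers-box {ws} {D} {e} ws∈ u∈ zero = All.++⁺ (All.map (box-≤ F-sub b (ℕ.m≤m+n D 0)) ws∈) []
        powers-box {ws} {D} {e} ws∈ u∈ (suc k) = All.++⁺ (All.map (box-≤ F-sub b (ℕ.m≤m+n D (suc k ℕ.* e))) ws∈)
          (All.map⁺ (All.map (λ {v} p → ≡.subst (λ d → Box F.Mem b d (u₀ * v)) (shuffle e D (k ℕ.* e)) (box-* F-sub b u∈ p)) (powers-box ws∈ u∈ k)))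
          where
            shuffle : ∀ e D f → e ℕ.+ (D ℕ.+ f) ≡ D ℕ.+ (e ℕ.+ f)
            shuffle e D f = ≡.trans (≡.sym (ℕ.+-assoc e D f)) (≡.trans (≡.cong (ℕ._+ f) (ℕ.+-comm e D)) (ℕ.+-assoc D e f))

        module _ (κ e₀ : ℕ) (q∈κ : Box F.Mem x κ q) (bq∈κ : ∀ i → Box F.Mem x κ (b i * q)) (u₀∈ : Box F.Mem b e₀ u₀) where
          -- The degree after s rounds, in units of D: clearing denominators multiplies it by N κ,
          -- and powers of `u₀` up to D add e₀ D. It stays linear in D while the number of elements
          -- is (D + 1)ˢ.
          μ : ℕ → ℕ
          μ zero    = 0
          μ (suc s) = N ℕ.* μ s ℕ.* κ ℕ.+ e₀

          record IndependentFamily (D s : ℕ) : Set ℓ where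
            field
              vs          : List Carrier
              length-vs   : length vs ≡ suc D ℕ.^ s
              vs∈         : All (Box F.Mem b (μ s ℕ.* D)) vs
              independent : Independent F vs

          ^-≉0 : ∀ e → ¬ q ^ e ≈ 0#
          ^-≉0 zero    = 1≉0
          ^-≉0 (suc e) = *-≉0 q≉0 (^-≉0 e)

          independent-family : ∀ D s → IndependentFamily D s
          independent-family D zero = record
            { vs = 1# ∷ [] ; length-vs = ≡.refl ; vs∈ = box-const F-sub b 0 F.1-closed ∷ []
            ; independent = λ { (c ∷ []) _ _ e → trans (solve 1 (λ c → c := c :* :1 :+ :0) refl c) e ∷ [] } }
          independent-family D (suc s) = record
            { vs          = powers (List.map proj₁ us) u₀ (suc D)
            ; length-vs   = ≡.trans (length-powers (List.map proj₁ us) u₀ (suc D))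
                (≡.cong (suc D ℕ.*_) (≡.trans (List.length-map proj₁ us) (≡.trans (≡.sym (List.length-map proj₂ us))
                  (≡.trans (≡.cong length us≡) (≡.trans (List.length-map (q ^ e *_) vs) length-vs)))))
            ; vs∈         = All.map (λ {v} → ≡.subst (λ d → Box F.Mem b d v) degree≡) (powers-box (All.map⁺ us∈) u₀∈ D)
            ; independent = powers-independent us us-hull (≡.subst (Independent F) (≡.sym us≡) (independent-scale F vs (^-≉0 e) independent)) (suc D)
            }
            where
              open IndependentFamily (independent-family D s)
              e : ℕ
              e = N ℕ.* (μ s ℕ.* D)
              -- Since each bᵢ q is a polynomial in x, so is qᵉ v. The lift is an element of F[b]
              -- that specialises to it.
              lifted = lift-list (e ℕ.* κ) (List.map (q ^ e *_) vs)
                (All.map⁺ (All.map (clear-denominators F-sub x b κ q∈κ bq∈κ (μ s ℕ.* D)) vs∈))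
              us : List 𝒫.Carrier
              us = proj₁ lifted
              us≡ : List.map proj₂ us ≡ List.map (q ^ e *_) vs
              us≡ = proj₁ (proj₂ lifted)
              us∈ : All (λ u → Box F.Mem b (e ℕ.* κ) (proj₁ u)) us
              us∈ = proj₁ (proj₂ (proj₂ lifted))
              us-hull : All Hull us
              us-hull = proj₂ (proj₂ (proj₂ lifted))
              degree≡ : e ℕ.* κ ℕ.+ D ℕ.* e₀ ≡ μ (suc s) ℕ.* D
              degree≡ = begin
                N ℕ.* (μ s ℕ.* D) ℕ.* κ ℕ.+ D ℕ.* e₀ ≡⟨ ≡.cong₂ ℕ._+_ (≡.cong (ℕ._* κ) (≡.sym (ℕ.*-assoc N (μ s) D))) (ℕ.*-comm D e₀) ⟩
                N ℕ.* μ s ℕ.* D ℕ.* κ ℕ.+ e₀ ℕ.* D   ≡⟨ ≡.cong (ℕ._+ e₀ ℕ.* D) (≡.trans (ℕ.*-assoc (N ℕ.* μ s) D κ)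
                                                          (≡.trans (≡.cong (N ℕ.* μ s ℕ.*_) (ℕ.*-comm D κ)) (≡.sym (ℕ.*-assoc (N ℕ.* μ s) κ D)))) ⟩
                N ℕ.* μ s ℕ.* κ ℕ.* D ℕ.+ e₀ ℕ.* D   ≡⟨ ℕ.*-distribʳ-+ D (N ℕ.* μ s ℕ.* κ) e₀ ⟨
                μ (suc s) ℕ.* D                      ∎
                where open ≡.≡-Reasoning

          absurd : ⊥
          absurd = box-count F b (μ (suc N)) vs (All.map (box-≤ F-sub b (ℕ.m≤n+m (μ (suc N) ℕ.* D) D)) vs∈) length-vs independent
            where
              D : ℕ
              -- The choice of `box-count` for κ = 1 + μ(N + 1) and N variables: N + 1 rounds give
              -- (D + 1)ᴺ⁺¹ independent elements of degree at most κ D.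
              D = suc (μ (suc N)) ℕ.^ N
              open IndependentFamily (independent-family D (suc N))

    term∈box : ∀ {y : Vector Carrier N} t → SomeBox F-sub y (⟦ t ⟧ y)
    term∈box {y} t = RingTermProperties.eval∈ commutativeRing proj₁ (someBox-isSubring F-sub y)
      (λ c → 0 , box-const F-sub y 0 (gen (inj₁ (proj₂ c)))) t (λ i → 1 , box-var F-sub y i)

    generic : ∀ t → ⟦ t ⟧ x ≈ 0# → ⟦ t ⟧ b ≈ 0#
    generic t tx≈0 = stable λ tb≉0 →
      let κ₁ , q∈₁ = q∈
          κ₂ , bq∈₂ = common-degree F-sub x N bq∈
          e₀ , u₀∈ = term∈box t
      in absurd t tb≉0 tx≈0 (κ₁ ℕ.+ κ₂) e₀ (box-≤ F-sub x (ℕ.m≤m+n κ₁ κ₂) q∈₁)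
           (λ i → box-≤ F-sub x (ℕ.m≤n+m κ₂ κ₁) (bq∈₂ i)) u₀∈

  evalAt∈box : ∀ {m} (P : RingTerm Term m) x c → (∀ j → δ (c j) ≈ 0#) → SomeBox F-sub x (evalAt P x c)
  evalAt∈box P x c δc = RingTermProperties.eval∈ commutativeRing (λ t → ⟦ t ⟧ x) (someBox-isSubring F-sub x)
    (λ t → RingTermProperties.eval∈ commutativeRing proj₁ (someBox-isSubring F-sub x)
      (λ c → 0 , box-const F-sub x 0 (gen (inj₁ (proj₂ c)))) t (λ i → 1 , box-var F-sub x i))
    P (λ j → 0 , box-const F-sub x 0 (gen (inj₂ (tt , δc j))))

  abstract
    triangular : TriangularSet b
    triangular = triangularSet b

  open TriangularSet triangular public using (eqs; neqs; eqs∋b; neqs∋b)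

  covered⇒real : ∀ {κ x c} → Covers κ x c → All (λ t → ⟦ t ⟧ x ≈ 0#) eqs → All (λ t → ¬ ⟦ t ⟧ x ≈ 0#) neqs →
                 (∀ i → δ (x i) * ⟦ δden i ⟧ x ≈ ⟦ δnum i ⟧ x) → Real x
  covered⇒real {κ} {x} {c} cov es ns δx = record
    { zero⇒ = specialises
    ; zero⇐ = generic specialises Q′≉0 (evalAt∈box Q′ x c constant)
        (λ i → IsSubring.respects (someBox-isSubring F-sub x) (sym (b≈ i)) (evalAt∈box (P′ i) x c constant))
    ; δ≈ = δx
    }
    where
      open Covers cov
      open Family κ
      specialises : ∀ t → ⟦ t ⟧ b ≈ 0# → ⟦ t ⟧ x ≈ 0#
      specialises = TriangularSet.vanishes triangular x es ns

-- Realisations and elements of the Galois group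

module GaloisElements (em : ∀ {a} → ExcludedMiddle a) {ℓ} (𝒜 : DifferentialField ℓ)
    (K L : DifferentialSubfield 𝒜) (charZero : CharZero 𝒜) (closed : DifferentiallyClosed 𝒜)
    (saturated : Saturated 𝒜) (K⊆L : DifferentialSubfield.Mem K ⊆ DifferentialSubfield.Mem L)
    (L-small : subsetSetoid 𝒜 (DifferentialSubfield.Mem L) ≺ DifferentialField.setoid 𝒜)
    (normal : StronglyNormal 𝒜 K L) where
  open DifferentialField 𝒜 hiding (zero)
  open DifferentialPolynomials em 𝒜 using (quotient)
  open Pairs em 𝒜 using (module 𝒫; PartialIso; Zero₁; Zero₂; fractionIso)
  open Homomorphisms em 𝒜 K L charZero closed saturated K⊆L L-small
  open FieldGeneration em 𝒜 K L charZero closed saturated K⊆L L-small normal using (values-isSubring; Values[_]; eval∈)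
  open Realisations em 𝒜 K L charZero closed saturated K⊆L L-small normal
  open LinearDisjointness em 𝒜 using (Ĉ; Ĉ-isSubring; linearly-disjoint)
  open FieldFractions em 𝒜
  private
    module K = DifferentialSubfield K
    module L = DifferentialSubfield L
    module C = DifferentialSubfield (C𝒜 𝒜)
    module Sub𝒫 = SubringTheory 𝒫.commutativeRing
    module Sub = SubringTheory commutativeRing
    module ⊗ = ConstantSpan (pairRing 𝒜)

  LC KC : DifferentialSubfield 𝒜
  LC = ⟨_,_⟩ 𝒜 L.Mem C.Mem
  KC = ⟨_,_⟩ 𝒜 K.Mem C.Mem

  private
    module LC = DifferentialSubfield LC
    module KC = DifferentialSubfield KC

  swapIso : PartialIso → PartialIso
  swapIso ρ = record
    { Graph = λ (x , y) → ρ.Graph (y , x)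
    ; isSubring = record { respects = λ (e , e′) → ρ.respects (e′ , e) ; 0∈ = ρ.0∈ ; 1∈ = ρ.1∈ ; +∈ = ρ.+∈ ; *∈ = ρ.*∈ ; neg∈ = ρ.neg∈ }
    ; δ∈ = ρ.δ∈
    ; div∈ = λ r∈ w∈ (n , n′) (e , e′) → ρ.div∈ r∈ w∈ (n′ , n) (e′ , e)
    ; zero⇒ = ρ.zero⇐
    ; zero⇐ = ρ.zero⇒
    }
    where module ρ = PartialIso ρ

  domainField : PartialIso → DifferentialSubfield 𝒜
  domainField ρ = record
    { Mem = Domain ρ
    ; resp = λ e p → closed∈ (resp e (gen p))
    ; 0-closed = closed∈ nil
    ; 1-closed = closed∈ one
    ; +-closed = λ p q → closed∈ (add (gen p) (gen q))
    ; *-closed = λ p q → closed∈ (mul (gen p) (gen q))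
    ; neg-closed = λ p → closed∈ (neg (gen p))
    ; inv-closed = λ p e → closed∈ (inv (gen p) e)
    ; δ-closed = λ p → closed∈ (der (gen p))
    }
    where
      closed∈ : Generated 𝒜 (Domain ρ) ⊆ Domain ρ
      closed∈ = domain-generated ρ id

  subfield-div : ∀ (M : DifferentialSubfield 𝒜) → DivisionClosed (DifferentialSubfield.Mem M)
  subfield-div M {_} {w} r∈ w∈ w≉0 e = let y , wy≈1 = inverse w w≉0 in
    DifferentialSubfield.resp M (quotient wy≈1 e)
      (DifferentialSubfield.*-closed M r∈ (DifferentialSubfield.inv-closed M w∈ wy≈1))

  module Prolong (τ : HomOver 𝒜 K L) where
    private
      module τ = HomOver τ
      fixes-constants = proj₁ (proj₂ normal τ)
      same-field = proj₂ (proj₂ normal τ)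
      module Γ₀ = PartialIso (hom-graph τ)
      A : Pred 𝒫.Carrier ℓ
      A = Γ₀.Graph

      sub : Sub𝒫.IsSubring (A ⊗.⊗ Ĉ)
      sub = ⊗.⊗-isSubring Γ₀.isSubring Ĉ-isSubring

      -- A constant of the image of τ comes from a constant of L, and τ is the identity on those.
      fixed : ∀ {x y} → A (x , y) → δ y ≈ 0# → A (y , y)
      fixed {x} {y} g@(l , p , q) δy≈0 = Γ₀.respects (trans (sym p) (trans (sym l-fixed) q) , refl) g
        where
          δl≈0 : δ (proj₁ l) ≈ 0#
          δl≈0 = trans (δ-cong p) (Γ₀.zero⇐ (Γ₀.δ∈ g) δy≈0)
          l-fixed : τ.⟦ l ⟧ ≈ proj₁ l
          l-fixed = fixes-constants l (proj₂ l , δl≈0)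

      -- The extension of τ by the identity on C is well defined on sums Σ l c: L and C are linearly
      -- disjoint over the constants of L, which τ fixes.
      ⊗⇒ : ∀ {v} → (A ⊗.⊗ Ĉ) v → Zero₁ v → Zero₂ v
      ⊗⇒ = linearly-disjoint L Γ₀.isSubring (λ (l , p , _) → L.resp p (proj₂ l))
        (λ {c} c∈ δc → (c , c∈) , refl , fixes-constants (c , c∈) (c∈ , δc)) Γ₀.zero⇒

      module Γ₀ˢ = PartialIso (swapIso (hom-graph τ))

      swap⊗ : ∀ {x y} → (A ⊗.⊗ Ĉ) (x , y) → (Γ₀ˢ.Graph ⊗.⊗ Ĉ) (y , x)
      swap⊗ (⊗.none (p , q)) = ⊗.none (q , p)
      swap⊗ (⊗.term {a , a′} {c , c′} {_} {w , w′} a∈ (c∈ , e) w∈ (p , q)) =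
        ⊗.term {a = a′ , a} {c = c′ , c} {w = w′ , w} a∈ (C.resp e c∈ , sym e) (swap⊗ w∈) (q , p)

      -- Injectivity is well-definedness of the inverse, with the image of τ in the role of L;
      -- `fixed` provides its constants.
      ⊗⇐ : ∀ {v} → (A ⊗.⊗ Ĉ) v → Zero₂ v → Zero₁ v
      ⊗⇐ v∈ = linearly-disjoint (domainField (swapIso (hom-graph τ))) Γ₀ˢ.isSubring (λ {v} g → proj₂ v , g)
        (λ (x , g) δy → fixed g δy) Γ₀ˢ.zero⇒ (swap⊗ v∈)

    iso : PartialIso
    iso = fractionIso sub ⊗⇒ ⊗⇐ (FrP.⊆Fr sub ∘ ⊗.⊗-δ Γ₀.isSubring Ĉ-isSubring Γ₀.δ∈
      (λ { ((_ , δc) , e) → δc , trans (δ-cong (sym e)) δc }))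

    private
      module Γ = PartialIso iso

    graph-L : ∀ l → Γ.Graph (proj₁ l , τ.⟦ l ⟧)
    graph-L l = FrP.⊆Fr sub (⊗.A⊆⊗ Γ₀.isSubring Ĉ-isSubring (l , refl , refl))

    graph-C : ∀ {c} → C.Mem c → Γ.Graph (c , c)
    graph-C c∈ = FrP.⊆Fr sub (⊗.C⊆⊗ Γ₀.isSubring Ĉ-isSubring (c∈ , refl))

    private
      total : LC.Mem ⊆ Domain iso
      total = domain-generated iso λ { {x} (inj₁ l∈) → τ.⟦ x , l∈ ⟧ , graph-L (x , l∈) ; (inj₂ c∈) → _ , graph-C c∈ }

      -- This is where strength enters: ⟨ L , C ⟩ is contained in the field generated by the image
      -- of τ and C. The opposite inclusion gives `image⊆`.
      onto : LC.Mem ⊆ Domain (swapIso iso)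
      onto y∈ = domain-generated (swapIso iso)
        [ (λ { (l , e) → proj₁ l , Γ.respects (refl , e) (graph-L l) }) , (λ c∈ → _ , graph-C c∈) ]′ (proj₁ same-field y∈)

      image⊆ : ∀ {v} → Γ.Graph v → LC.Mem (proj₂ v)
      image⊆ g = proj₂ same-field (FrP.Fr⊆ {M = Generated 𝒜 (τ.Image ∪ C.Mem) ∘ proj₂} go
        (λ r∈ w∈ (_ , w≉0) (_ , e) → subfield-div (⟨_,_⟩ 𝒜 τ.Image C.Mem) r∈ w∈ w≉0 e) g)
        where
          go : ∀ {v} → (A ⊗.⊗ Ĉ) v → Generated 𝒜 (τ.Image ∪ C.Mem) (proj₂ v)
          go (⊗.none (_ , p)) = resp (sym p) nil
          go (⊗.term (l , _ , q) (c∈ , e) w∈ (_ , p)) =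
            resp (sym p) (add (mul (gen (inj₁ (l , q))) (gen (inj₂ (C.resp e c∈)))) (go w∈))

      source⊆ : ∀ {v} → Γ.Graph v → LC.Mem (proj₁ v)
      source⊆ g = FrP.Fr⊆ {M = LC.Mem ∘ proj₁} go (λ r∈ w∈ (w≉0 , _) (e , _) → subfield-div LC r∈ w∈ w≉0 e) g
        where
          go : ∀ {v} → (A ⊗.⊗ Ĉ) v → LC.Mem (proj₁ v)
          go (⊗.none (p , _)) = resp (sym p) nil
          go (⊗.term (l , q , _) (c∈ , e) w∈ (p , _)) =
            resp (sym p) (add (mul (gen (inj₁ (L.resp q (proj₂ l)))) (gen (inj₂ c∈))) (go w∈))

      map : Σ Carrier LC.Mem → Σ Carrier LC.Mem
      map (x , x∈) = proj₁ (total x∈) , image⊆ (proj₂ (total x∈))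

      graph : ∀ x → Γ.Graph (proj₁ x , proj₁ (map x))
      graph (x , x∈) = proj₂ (total x∈)

    automorphism : Automorphism (toField 𝒜 LC)
    automorphism = record
      { ⟦_⟧ = map
      ; isRingIsomorphism = record
        { isRingMonomorphism = record
          { isRingHomomorphism = record
            { isSemiringHomomorphism = record
              { isNearSemiringHomomorphism = record
                { +-isMonoidHomomorphism = record
                  { isMagmaHomomorphism = record
                    { isRelHomomorphism = record { cong = λ {x} {y} → functional iso (graph x) (graph y) }
                    ; homo = λ x y → functional iso (graph (proj₁ x + proj₁ y , add (proj₂ x) (proj₂ y))) (Γ.+∈ (graph x) (graph y)) refl
                    }
                  ; ε-homo = functional iso (graph (0# , nil)) Γ.0∈ refl
                  }
                ; *-homo = λ x y → functional iso (graph (proj₁ x * proj₁ y , mul (proj₂ x) (proj₂ y))) (Γ.*∈ (graph x) (graph y)) refl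
                }
              ; 1#-homo = functional iso (graph (1# , one)) Γ.1∈ refl
              }
            ; -‿homo = λ x → functional iso (graph (- proj₁ x , neg (proj₂ x))) (Γ.neg∈ (graph x)) refl
            }
          ; injective = λ {x} {y} → injective iso (graph x) (graph y)
          }
        ; surjective = λ (y , y∈) → (proj₁ (onto y∈) , source⊆ (proj₂ (onto y∈))) ,
            λ {z} e → functional iso (graph z) (proj₂ (onto y∈)) e
        }
      ; δ-homo = λ x → functional iso (graph (δ (proj₁ x) , der (proj₂ x))) (Γ.δ∈ (graph x)) refl
      }

    galois : Group.Carrier (Gal 𝒜 K L)
    galois = automorphism , λ x x∈ → functional iso (graph x) (diag x∈) refl
      where
        diag : ∀ {x} → KC.Mem x → Γ.Graph (x , x)
        diag = generated⊆ {M = λ x → Γ.Graph (x , x)}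
          (record { respects = λ e → Γ.respects (e , e) ; 0∈ = Γ.0∈ ; 1∈ = Γ.1∈ ; +∈ = Γ.+∈ ; *∈ = Γ.*∈ ; neg∈ = Γ.neg∈ })
          (λ r∈ w∈ w≉0 e → Γ.div∈ r∈ w∈ (w≉0 , w≉0) (e , e)) Γ.δ∈
          λ { {k} (inj₁ k∈) → Γ.respects (refl , τ.fixes (k , K⊆L k∈) k∈) (graph-L (k , K⊆L k∈)) ; (inj₂ c∈) → graph-C c∈ }

    galois-L : ∀ l → proj₁ (Automorphism.⟦_⟧ automorphism (proj₁ l , gen (inj₁ (proj₂ l)))) ≈ τ.⟦ l ⟧
    galois-L l = functional iso (graph (proj₁ l , gen (inj₁ (proj₂ l)))) (graph-L l) refl

  module _ (σ : Group.Carrier (Gal 𝒜 K L)) where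
    private
      module σ = Automorphism (proj₁ σ)

      embedding : Embedding (toField 𝒜 LC) 𝒜
      embedding = record
        { ⟦_⟧ = proj₁ ∘ σ.⟦_⟧
        ; isRingMonomorphism = record
          { isRingHomomorphism = record
            { isSemiringHomomorphism = record
              { isNearSemiringHomomorphism = record
                { +-isMonoidHomomorphism = record
                  { isMagmaHomomorphism = record
                    { isRelHomomorphism = record { cong = λ {x} {y} → σ.⟦⟧-cong {x} {y} }
                    ; homo = σ.+-homo
                    }
                  ; ε-homo = σ.0#-homo
                  }
                ; *-homo = σ.*-homo
                }
              ; 1#-homo = σ.1#-homo
              }
            ; -‿homo = σ.-‿homo
            }
          ; injective = λ {x} {y} → σ.injective {x} {y}
          }
        ; δ-homo = σ.δ-homo
        }

    gal-graph : PartialIso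
    gal-graph = embedding-graph LC embedding

    private module Γ = PartialIso gal-graph

    gal-graph-K : ∀ {k} → K.Mem k → Γ.Graph (k , k)
    gal-graph-K {k} k∈ = (k , gen (inj₁ (K⊆L k∈))) , refl , proj₂ σ (k , gen (inj₁ (K⊆L k∈))) (gen (inj₁ k∈))

    gal-graph-C : ∀ {c} → C.Mem c → Γ.Graph (c , c)
    gal-graph-C {c} c∈ = (c , gen (inj₂ c∈)) , refl , proj₂ σ (c , gen (inj₂ c∈)) (gen (inj₂ c∈))

    restriction : HomOver 𝒜 K L
    restriction = homOver gal-graph gal-graph-K
      (λ {x} x∈ → proj₁ (σ.⟦ x , gen (inj₁ x∈) ⟧) , (x , gen (inj₁ x∈)) , refl , refl)

    gal-image : Vector Carrier N
    gal-image i = proj₁ (σ.⟦ b i , gen (inj₁ (b∈ i)) ⟧)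

    gal-image-real : Real gal-image
    gal-image-real = image-real restriction

    gal-graph-b : ∀ i → Γ.Graph (b i , gal-image i)
    gal-graph-b i = (b i , gen (inj₁ (b∈ i))) , refl , refl

    gal-graph-evalAt : ∀ {m} (P : RingTerm Term m) {c} → (∀ j → C.Mem (c j)) → Γ.Graph (evalAt P b c , evalAt P gal-image c)
    gal-graph-evalAt (var j)  c∈ = gal-graph-C (c∈ j)
    gal-graph-evalAt (par t)  c∈ = pair-eval∈ Γ.isSubring gal-graph-K gal-graph-b t
    gal-graph-evalAt 0′       c∈ = Γ.0∈
    gal-graph-evalAt 1′       c∈ = Γ.1∈
    gal-graph-evalAt (s +′ t) c∈ = Γ.+∈ (gal-graph-evalAt s c∈) (gal-graph-evalAt t c∈)
    gal-graph-evalAt (s *′ t) c∈ = Γ.*∈ (gal-graph-evalAt s c∈) (gal-graph-evalAt t c∈)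
    gal-graph-evalAt (-′ t)   c∈ = Γ.neg∈ (gal-graph-evalAt t c∈)

  -- The elements on which σ and σ′ agree form a differential field containing K, C and b, hence
  -- everything.
  gal-determined : ∀ σ σ′ → (∀ i → gal-image σ i ≈ gal-image σ′ i) → Group._≈_ (Gal 𝒜 K L) σ σ′
  gal-determined σ σ′ e (x , x∈) =
    let y , g , g′ = agree x∈
    in trans (functional (gal-graph σ) ((x , x∈) , refl , refl) g refl)
             (functional (gal-graph σ′) g′ ((x , x∈) , refl , refl) refl)
    where
      module Γ = PartialIso (gal-graph σ)
      module Γ′ = PartialIso (gal-graph σ′)
      E : Pred Carrier ℓ
      E x = ∃ λ y → Γ.Graph (x , y) × Γ′.Graph (x , y)
      E-sub : Sub.IsSubring E
      E-sub = record
        { respects = λ e (y , g , g′) → y , Γ.respects (e , refl) g , Γ′.respects (e , refl) g′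
        ; 0∈ = _ , Γ.0∈ , Γ′.0∈ ; 1∈ = _ , Γ.1∈ , Γ′.1∈
        ; +∈ = λ (_ , g , g′) (_ , h , h′) → _ , Γ.+∈ g h , Γ′.+∈ g′ h′
        ; *∈ = λ (_ , g , g′) (_ , h , h′) → _ , Γ.*∈ g h , Γ′.*∈ g′ h′
        ; neg∈ = λ (_ , g , g′) → _ , Γ.neg∈ g , Γ′.neg∈ g′
        }
      E-div : DivisionClosed E
      E-div {z} {w} {r} (r₁ , g , g′) (w₁ , h , h′) w≉0 zw≈r =
        let w₁≉0 : ¬ w₁ ≈ 0#
            w₁≉0 z = w≉0 (Γ.zero⇐ h z)
            y , wy≈1 = inverse w₁ w₁≉0
            eq = trans (*-assoc r₁ y w₁) (trans (*-congˡ (trans (*-comm y w₁) wy≈1)) (*-identityʳ r₁))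
        in r₁ * y , Γ.div∈ g h (w≉0 , w₁≉0) (zw≈r , eq) , Γ′.div∈ g′ h′ (w≉0 , w₁≉0) (zw≈r , eq)
      agree : LC.Mem ⊆ E
      agree = generated⊆ E-sub E-div (λ (_ , g , g′) → _ , Γ.δ∈ g , Γ′.δ∈ g′)
        [ (λ l∈ → Fr⊆ (λ (t , p) → Sub.IsSubring.respects E-sub (sym p) (eval∈ E-sub
              (λ c → _ , gal-graph-K σ (proj₂ c) , gal-graph-K σ′ (proj₂ c)) t
              (λ i → _ , gal-graph-b σ i , Γ′.respects (refl , sym (e i)) (gal-graph-b σ′ i)))) E-div (L⊆ l∈))
        , (λ c∈ → _ , gal-graph-C σ c∈ , gal-graph-C σ′ c∈) ]′

  abstract
    real⇒galois : ∀ {x} → Real x → ∃ λ σ → ∀ i → gal-image σ i ≈ x i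
    real⇒galois {x} r = Prolong.galois hom , λ i → trans (Prolong.galois-L hom (b i , b∈ i)) (hom-b i)
      where open FromReal x r

-- Equations over L in constants as formulas over the constants of K

module Definability (em : ∀ {a} → ExcludedMiddle a) {ℓ} (𝒜 : DifferentialField ℓ) (K L : DifferentialSubfield 𝒜)
    (constants⊆ : ∀ {c} → DifferentialSubfield.Mem L c → DifferentialField._≈_ 𝒜 (DifferentialField.δ 𝒜 c) (DifferentialField.0# 𝒜) →
                  DifferentialSubfield.Mem K c) where
  open DifferentialField 𝒜 hiding (zero)
  open Classical em
  open DifferentialPolynomials em 𝒜 using (integral; *-≉0)
  open DifferentialRing (underlyingRing 𝒜) using (δ-0; δ-neg)
  open RingSolver commutativeRing
  open LinearAlgebra em 𝒜
  open LinearDisjointness em 𝒜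
  private
    module L = DifferentialSubfield L
    module C = DifferentialSubfield (C𝒜 𝒜)

  constantRing : CommutativeRing ℓ ℓ
  constantRing = DifferentialField.commutativeRing (toField 𝒜 (C𝒜 𝒜))

  Constant : Set ℓ
  Constant = CommutativeRing.Carrier constantRing

  Param : Set ℓ
  Param = Σ Constant (λ c → DifferentialSubfield.Mem (constants 𝒜 K) (proj₁ c))

  evC : ∀ {m} → RingTerm Param m → Vector Constant m → Carrier
  evC T c = proj₁ (evalRing constantRing proj₁ T c)

  Satisfies : ∀ {m} → QFRingFormula Param m → Vector Constant m → Set ℓ
  Satisfies = SatQF constantRing proj₁

  record Definable m (S : Vector Constant m → Set ℓ) : Set ℓ where
    field
      formula  : QFRingFormula Param m
      sound    : ∀ {c} → Satisfies formula c → S c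
      complete : ∀ {c} → S c → Satisfies formula c
  open Definable

  definable-× : ∀ {m S T} → Definable m S → Definable m T → Definable m (λ c → S c × T c)
  definable-× D E = record
    { formula = formula D ∧′ formula E
    ; sound = λ (p , q) → sound D p , sound E q
    ; complete = λ (p , q) → complete D p , complete E q }

  definable-¬ : ∀ {m S} → Definable m S → Definable m (λ c → ¬ S c)
  definable-¬ D = record { formula = ¬′ formula D ; sound = λ p q → p (complete D q) ; complete = λ p q → p (sound D q) }

  definable-All : ∀ {m} {X : Set ℓ} {S : X → Vector Constant m → Set ℓ} → (∀ x → Definable m (S x)) →
                  ∀ xs → Definable m (λ c → All (λ x → S x c) xs)
  definable-All D []       = record { formula = 0′ ≈′ 0′ ; sound = λ _ → [] ; complete = λ _ → refl }
  definable-All D (x ∷ xs) = record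
    { formula = formula (D x) ∧′ formula (definable-All D xs)
    ; sound = λ (p , q) → sound (D x) p ∷ sound (definable-All D xs) q
    ; complete = λ { (p ∷ q) → complete (D x) p , complete (definable-All D xs) q } }

  definable-∀ : ∀ {m} k {S : Fin k → Vector Constant m → Set ℓ} → (∀ i → Definable m (S i)) → Definable m (λ c → ∀ i → S i c)
  definable-∀ zero    D = record { formula = 0′ ≈′ 0′ ; sound = λ _ () ; complete = λ _ → refl }
  definable-∀ (suc k) D = record
    { formula = formula (D fzero) ∧′ formula E
    ; sound = λ { (p , q) fzero → sound (D fzero) p ; (p , q) (fsuc i) → sound E q i }
    ; complete = λ p → complete (D fzero) (p fzero) , complete E (p ∘ fsuc) }
    where E = definable-∀ k (D ∘ fsuc)

  -- A list of pairs (lᵢ , Tᵢ) stands for the function c ↦ Σ lᵢ Tᵢ(c) of m constants.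
  Combination : ℕ → Set ℓ
  Combination m = List (Σ Carrier L.Mem × RingTerm Param m)

  val : ∀ {m} → Combination m → Vector Constant m → Carrier
  val []            c = 0#
  val ((l , T) ∷ f) c = proj₁ l * evC T c + val f c

  val-++ : ∀ {m} (f g : Combination m) c → val (f ++ g) c ≈ val f c + val g c
  val-++ []            g c = sym (+-identityˡ _)
  val-++ ((l , T) ∷ f) g c = trans (+-congˡ (val-++ f g c)) (sym (+-assoc _ _ _))

  private
    scale : ∀ {m} → Σ Carrier L.Mem → RingTerm Param m → Combination m → Combination m
    scale (l , l∈) T = List.map λ { ((l′ , l′∈) , T′) → (l * l′ , L.*-closed l∈ l′∈) , T *′ T′ }

    val-scale : ∀ {m} l (T : RingTerm Param m) f c → val (scale l T f) c ≈ proj₁ l * evC T c * val f c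
    val-scale l T []              c = sym (zeroʳ _)
    val-scale l T ((l′ , T′) ∷ f) c = trans (+-congˡ (val-scale l T f c)) (collect (proj₁ l) (proj₁ l′) (evC T c) (evC T′ c) (val f c))
      where
        collect : ∀ l k s t v → l * k * (s * t) + l * s * v ≈ l * s * (k * t + v)
        collect = solve 5 (λ l k s t v → l :* k :* (s :* t) :+ l :* s :* v := l :* s :* (k :* t :+ v)) refl

  mulC : ∀ {m} → Combination m → Combination m → Combination m
  mulC []            g = []
  mulC ((l , T) ∷ f) g = scale l T g ++ mulC f g

  val-* : ∀ {m} (f g : Combination m) c → val (mulC f g) c ≈ val f c * val g c
  val-* []            g c = sym (zeroˡ _)
  val-* ((l , T) ∷ f) g c = trans (val-++ (scale l T g) (mulC f g) c)
    (trans (+-cong (val-scale l T g c) (val-* f g c)) (sym (distribʳ (val g c) _ _)))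

  negC : ∀ {m} → Combination m → Combination m
  negC = List.map λ { ((l , l∈) , T) → (- l , L.neg-closed l∈) , T }

  val-neg : ∀ {m} (f : Combination m) c → val (negC f) c ≈ - val f c
  val-neg []            c = solve 0 (:0 := :- :0) refl
  val-neg ((l , T) ∷ f) c = trans (+-congˡ (val-neg f c)) (collect (proj₁ l) (evC T c) (val f c))
    where
      collect : ∀ l t v → - l * t + - v ≈ - (l * t + v)
      collect = solve 3 (λ l t v → (:- l) :* t :+ (:- v) := :- (l :* t :+ v)) refl

  δC : ∀ {m} → Combination m → Combination m
  δC = List.map λ { ((l , l∈) , T) → (δ l , L.δ-closed l∈) , T }

  evC-constant : ∀ {m} (T : RingTerm Param m) c → C.Mem (evC T c)
  evC-constant T c = proj₂ (evalRing constantRing proj₁ T c)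

  -- The values of the Tᵢ are constants, so δ acts on the coefficients from L alone. This makes
  -- conditions on derivatives of x polynomial in c.
  val-δ : ∀ {m} (f : Combination m) c → val (δC f) c ≈ δ (val f c)
  val-δ []            c = sym δ-0
  val-δ ((l , T) ∷ f) c = sym (trans (δ-+ _ _) (+-cong
    (trans (δ-* (proj₁ l) (evC T c)) (trans (+-congˡ (trans (*-congˡ (proj₂ (evC-constant T c))) (zeroʳ _))) (+-identityʳ _)))
    (sym (val-δ f c))))

  renameC : ∀ {m n} → (Fin m → Fin n) → Combination m → Combination n
  renameC r = List.map λ { (l , T) → l , rename r T }

  val-rename : ∀ {m n} (r : Fin m → Fin n) f c → val (renameC r f) c ≈ val f (c ∘ r)
  val-rename r []            c = refl
  val-rename r ((l , T) ∷ f) c = +-cong (*-congˡ (reflexive (≡.cong proj₁ (RingTermProperties.eval-rename constantRing proj₁ r T c)))) (val-rename r f c)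

  val-cong : ∀ {m} (f : Combination m) {c c′} → (∀ i → proj₁ (c i) ≈ proj₁ (c′ i)) → val f c ≈ val f c′
  val-cong []            e = refl
  val-cong ((l , T) ∷ f) e = +-cong (*-congˡ (RingTermProperties.eval-cong constantRing proj₁ T e)) (val-cong f e)

  private
    values : ∀ {m} → List (RingTerm Param m) → Vector Constant m → List Carrier
    values Ts c = List.map (λ T → evC T c) Ts

    record Reduced {m} (f : Combination m) : Set ℓ where
      field
        βs   : List Carrier
        Ts   : List (RingTerm Param m)
        len  : length Ts ≡ length βs
        βs∈  : All L.Mem βs
        ind  : Independent (constants 𝒜 L) βs
        val≈ : ∀ c → val f c ≈ lc (values Ts c) βs

    module _ {m} (T : RingTerm Param m) where
      param : ∀ {e} → DifferentialSubfield.Mem (constants 𝒜 L) e → Param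
      param {e} (e∈ , δe) = (e , tt , δe) , constants⊆ e∈ δe , δe

      -- Substituting l = Σ eᵢ βᵢ into l T adds eᵢ T to the i-th coefficient. The eᵢ are constants
      -- of L, hence of K, and so become parameters.
      combine : ∀ es → All (DifferentialSubfield.Mem (constants 𝒜 L)) es → List (RingTerm Param m) → List (RingTerm Param m)
      combine (e ∷ es) (e∈ ∷ es∈) (S ∷ Ss) = ((par (param e∈) *′ T) +′ S) ∷ combine es es∈ Ss
      combine _        _          _        = []

      length-combine : ∀ es es∈ Ss → length es ≡ length Ss → length (combine es es∈ Ss) ≡ length Ss
      length-combine []       []         []       e = ≡.refl
      length-combine (_ ∷ es) (_ ∷ es∈) (_ ∷ Ss) e = ≡.cong suc (length-combine es es∈ Ss (ℕ.suc-injective e))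

      lc-combine : ∀ es es∈ Ss βs → length es ≡ length Ss → ∀ c → lc (values (combine es es∈ Ss) c) βs ≈ lc es βs * evC T c + lc (values Ss c) βs
      lc-combine []       []         []       βs       e c = solve 1 (λ t → :0 := :0 :* t :+ :0) refl (evC T c)
      lc-combine (_ ∷ es) (_ ∷ es∈) (_ ∷ Ss) []       e c = solve 1 (λ t → :0 := :0 :* t :+ :0) refl (evC T c)
      lc-combine (a ∷ es) (a∈ ∷ es∈) (S ∷ Ss) (β ∷ βs) e c =
        trans (+-congˡ (lc-combine es es∈ Ss βs (ℕ.suc-injective e) c)) (collect a (evC T c) (evC S c) β (lc es βs) (lc (values Ss c) βs))
        where
          collect : ∀ a t s β u v → (a * t + s) * β + (u * t + v) ≈ (a * β + u) * t + (s * β + v)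
          collect = solve 6 (λ a t s β u v → (a :* t :+ s) :* β :+ (u :* t :+ v) := (a :* β :+ u) :* t :+ (s :* β :+ v)) refl

    reduce : ∀ {m} (f : Combination m) → Reduced f
    reduce [] = record { βs = [] ; Ts = [] ; len = ≡.refl ; βs∈ = [] ; ind = λ { [] _ _ _ → [] } ; val≈ = λ _ → refl }
    reduce ((l , T) ∷ f) = [ dependent , independent ]′ cases
      where
        open Reduced (reduce f)
        cases : Span (constants 𝒜 L) βs (proj₁ l) ⊎ ¬ Span (constants 𝒜 L) βs (proj₁ l)
        cases with decide (Span (constants 𝒜 L) βs (proj₁ l))
        ... | yes p = inj₁ p
        ... | no ¬p = inj₂ ¬p

        independent : ¬ Span (constants 𝒜 L) βs (proj₁ l) → Reduced ((l , T) ∷ f)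
        independent l∉ = record
          { βs = proj₁ l ∷ βs ; Ts = T ∷ Ts ; len = ≡.cong suc len ; βs∈ = proj₂ l ∷ βs∈ ; ind = independent-∷ L l∉ ind
          ; val≈ = λ c → +-cong (*-comm _ _) (val≈ c) }

        dependent : Span (constants 𝒜 L) βs (proj₁ l) → Reduced ((l , T) ∷ f)
        dependent (es , es∈ , e , l≈) = record
          { βs = βs ; Ts = combine T es es∈ Ts ; len = ≡.trans (length-combine T es es∈ Ts e′) len ; βs∈ = βs∈ ; ind = ind
          ; val≈ = λ c → trans (+-cong (*-congʳ l≈) (val≈ c)) (sym (lc-combine T es es∈ Ts βs e′ c)) }
          where
            e′ : length es ≡ length Ts
            e′ = ≡.trans e (≡.sym len)

  abstract
    -- After rewriting, the coefficients βᵢ are independent over the constants of L, hence over all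
    -- of C; so the sum vanishes exactly when each Tᵢ(c) does, and the parameters of the Tᵢ lie in
    -- the constants of K.
    definable-zero : ∀ {m} (f : Combination m) → Definable m (λ c → val f c ≈ 0#)
    definable-zero {m} f = record
      { formula = formula all
      ; sound = λ {c} s → trans (val≈ c) (lc-zero (values Ts c) βs (All.map⁺ (sound all s)))
      ; complete = λ {c} z → complete all (All.map⁻ (independent-over-constants L βs βs∈ ind (values Ts c)
          (All.map⁺ (All.universal (λ T → evC-constant T c) Ts)) (≡.trans (List.length-map _ Ts) len) (trans (sym (val≈ c)) z)))
      }
      where
        open Reduced (reduce f)
        all : Definable m (λ c → All (λ T → evC T c ≈ 0#) Ts)
        all = definable-All (λ T → record { formula = T ≈′ 0′ ; sound = id ; complete = id }) Ts

  Fraction : ℕ → Set ℓ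
  Fraction m = Combination m × Combination m

  -- The value v is a rational function of c with denominator nonzero at c. Then v = 0 amounts to
  -- the vanishing of the numerator, a condition for `definable-zero`.
  Represents : ∀ {m} → Vector Constant m → Fraction m → Carrier → Set ℓ
  Represents c (n , d) v = ¬ val d c ≈ 0# × v * val d c ≈ val n c

  constF : ∀ {m} → Σ Carrier L.Mem → Fraction m
  constF l = (l , 1′) ∷ [] , ((1# , L.1-closed) , 1′) ∷ []

  varF : ∀ {m} → Fin m → Fraction m
  varF j = ((1# , L.1-closed) , var j) ∷ [] , ((1# , L.1-closed) , 1′) ∷ []

  addF mulF divF : ∀ {m} → Fraction m → Fraction m → Fraction m
  addF (n , d) (n′ , d′) = mulC n d′ ++ mulC n′ d , mulC d d′
  mulF (n , d) (n′ , d′) = mulC n n′ , mulC d d′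
  divF (n , d) (n′ , d′) = mulC n d′ , mulC d n′

  negF δF : ∀ {m} → Fraction m → Fraction m
  negF (n , d) = negC n , d
  δF (n , d) = mulC (δC n) d ++ negC (mulC n (δC d)) , mulC d d

  renameF : ∀ {m n} → (Fin m → Fin n) → Fraction m → Fraction n
  renameF r (n , d) = renameC r n , renameC r d

  module _ {m} {c : Vector Constant m} where
    private
      one≈ : val {m} (((1# , L.1-closed) , 1′) ∷ []) c ≈ 1#
      one≈ = solve 0 (:1 :* :1 :+ :0 := :1) refl

    constF-represents : ∀ l → Represents c (constF l) (proj₁ l)
    constF-represents l = (λ z → 1≉0 (trans (sym one≈) z)) , solve 1 (λ l → l :* (:1 :* :1 :+ :0) := l :* :1 :+ :0) refl (proj₁ l)

    varF-represents : ∀ j → Represents c (varF j) (proj₁ (c j))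
    varF-represents j = (λ z → 1≉0 (trans (sym one≈) z)) , solve 1 (λ l → l :* (:1 :* :1 :+ :0) := :1 :* l :+ :0) refl (proj₁ (c j))

    private
      den-* : ∀ d d′ → ¬ val d c ≈ 0# → ¬ val d′ c ≈ 0# → ¬ val (mulC d d′) c ≈ 0#
      den-* d d′ p q z = *-≉0 p q (trans (sym (val-* d d′ c)) z)

    addF-represents : ∀ {f g v w} → Represents c f v → Represents c g w → Represents c (addF f g) (v + w)
    addF-represents {n , d} {n′ , d′} {v} {w} (p , e) (p′ , e′) = den-* d d′ p p′ , (begin
      (v + w) * val (mulC d d′) c                          ≈⟨ *-congˡ (val-* d d′ c) ⟩
      (v + w) * (val d c * val d′ c)                       ≈⟨ solve 4 (λ v w x y → (v :+ w) :* (x :* y) := v :* x :* y :+ w :* y :* x) refl v w (val d c) (val d′ c) ⟩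
      v * val d c * val d′ c + w * val d′ c * val d c      ≈⟨ +-cong (*-congʳ e) (*-congʳ e′) ⟩
      val n c * val d′ c + val n′ c * val d c              ≈⟨ +-cong (val-* n d′ c) (val-* n′ d c) ⟨
      val (mulC n d′) c + val (mulC n′ d) c                ≈⟨ val-++ (mulC n d′) (mulC n′ d) c ⟨
      val (mulC n d′ ++ mulC n′ d) c                       ∎)
      where open SetoidReasoning setoid

    mulF-represents : ∀ {f g v w} → Represents c f v → Represents c g w → Represents c (mulF f g) (v * w)
    mulF-represents {n , d} {n′ , d′} {v} {w} (p , e) (p′ , e′) = den-* d d′ p p′ , (begin
      v * w * val (mulC d d′) c           ≈⟨ *-congˡ (val-* d d′ c) ⟩
      v * w * (val d c * val d′ c)        ≈⟨ solve 4 (λ v w x y → v :* w :* (x :* y) := (v :* x) :* (w :* y)) refl v w (val d c) (val d′ c) ⟩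
      v * val d c * (w * val d′ c)        ≈⟨ *-cong e e′ ⟩
      val n c * val n′ c                  ≈⟨ val-* n n′ c ⟨
      val (mulC n n′) c                   ∎)
      where open SetoidReasoning setoid

    negF-represents : ∀ {f v} → Represents c f v → Represents c (negF f) (- v)
    negF-represents {n , d} {v} (p , e) = p , trans (solve 2 (λ v d → (:- v) :* d := :- (v :* d)) refl v (val d c))
      (trans (-‿cong e) (sym (val-neg n c)))

    divF-represents : ∀ {f g v w z} → Represents c f v → Represents c g w → ¬ w ≈ 0# → z * w ≈ v → Represents c (divF f g) z
    divF-represents {n , d} {n′ , d′} {v} {w} {z} (p , e) (p′ , e′) w≉0 zw≈v =
      den-* d n′ p (λ q → *-≉0 w≉0 p′ (trans e′ q)) , (begin
        z * val (mulC d n′) c             ≈⟨ *-congˡ (trans (val-* d n′ c) (*-congˡ (sym e′))) ⟩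
        z * (val d c * (w * val d′ c))    ≈⟨ solve 4 (λ z x w y → z :* (x :* (w :* y)) := z :* w :* x :* y) refl z (val d c) w (val d′ c) ⟩
        z * w * val d c * val d′ c        ≈⟨ *-congʳ (trans (*-congʳ zw≈v) e) ⟩
        val n c * val d′ c                ≈⟨ val-* n d′ c ⟨
        val (mulC n d′) c                 ∎)
      where open SetoidReasoning setoid

    δF-represents : ∀ {f v} → Represents c f v → Represents c (δF f) (δ v)
    δF-represents {n , d} {v} (p , e) = den-* d d p p , (begin
      δ v * val (mulC d d) c                                   ≈⟨ *-congˡ (val-* d d c) ⟩
      δ v * (val d c * val d c)                                ≈⟨ solve 4 (λ x v d y → x :* (d :* d) := (x :* d :+ v :* y) :* d :+ (:- (v :* d :* y))) refl (δ v) v (val d c) (δ (val d c)) ⟩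
      (δ v * val d c + v * δ (val d c)) * val d c + - (v * val d c * δ (val d c))
        ≈⟨ +-cong (*-congʳ (trans (sym (δ-* v (val d c))) (δ-cong e))) (-‿cong (*-congʳ e)) ⟩
      δ (val n c) * val d c + - (val n c * δ (val d c))        ≈⟨ +-cong (*-congʳ (val-δ n c)) (-‿cong (*-congˡ (val-δ d c))) ⟨
      val (δC n) c * val d c + - (val n c * val (δC d) c)      ≈⟨ +-cong (val-* (δC n) d c) (trans (val-neg (mulC n (δC d)) c) (-‿cong (val-* n (δC d) c))) ⟨
      val (mulC (δC n) d) c + val (negC (mulC n (δC d))) c     ≈⟨ val-++ (mulC (δC n) d) (negC (mulC n (δC d))) c ⟨
      val (mulC (δC n) d ++ negC (mulC n (δC d))) c            ∎)
      where open SetoidReasoning setoid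

    represents-zero⇒ : ∀ {f v} → Represents c f v → val (proj₁ f) c ≈ 0# → v ≈ 0#
    represents-zero⇒ (p , e) z = [ id , (λ q → contradiction q p) ]′ (integral (trans e z))

    represents-zero⇐ : ∀ {f v} → Represents c f v → v ≈ 0# → val (proj₁ f) c ≈ 0#
    represents-zero⇐ (p , e) z = trans (sym e) (trans (*-congʳ z) (zeroˡ _))

  renameF-represents : ∀ {m n} (r : Fin m → Fin n) f {v : Vector Constant n} {c w} → (∀ i → proj₁ (v (r i)) ≈ proj₁ (c i)) →
    Represents c f w → Represents v (renameF r f) w
  renameF-represents r (n , d) {v} {c} e (p , q) =
    (λ z → p (trans (sym (same d)) z)) , trans (*-congˡ (same d)) (trans q (sym (same n)))
    where
      same : ∀ f → val (renameC r f) v ≈ val f c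
      same f = trans (val-rename r f v) (val-cong f e)

  -- Evaluation in the arithmetic of fractions. It can be iterated: terms in x are interpreted first
  -- and serve as coefficients of terms in the constants.
  interpret : ∀ {p m n} {P : Set p} → (P → Fraction m) → (Fin n → Fraction m) → RingTerm P n → Fraction m
  interpret π ν (var i)  = ν i
  interpret π ν (par c)  = π c
  interpret π ν 0′       = constF (0# , L.0-closed)
  interpret π ν 1′       = constF (1# , L.1-closed)
  interpret π ν (s +′ t) = addF (interpret π ν s) (interpret π ν t)
  interpret π ν (s *′ t) = mulF (interpret π ν s) (interpret π ν t)
  interpret π ν (-′ t)   = negF (interpret π ν t)

  interpret-represents : ∀ {p m n} {P : Set p} {π : P → Fraction m} {ν : Fin n → Fraction m} {c} {ι : P → Carrier} {v : Vector Carrier n} →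
    (∀ k → Represents c (π k) (ι k)) → (∀ i → Represents c (ν i) (v i)) →
    ∀ t → Represents c (interpret π ν t) (evalRing commutativeRing ι t v)
  interpret-represents π∈ ν∈ (var i)  = ν∈ i
  interpret-represents π∈ ν∈ (par c)  = π∈ c
  interpret-represents {c = c} π∈ ν∈ 0′ = constF-represents {c = c} (0# , L.0-closed)
  interpret-represents {c = c} π∈ ν∈ 1′ = constF-represents {c = c} (1# , L.1-closed)
  interpret-represents {π = π} {ν} π∈ ν∈ (s +′ t) = addF-represents {f = interpret π ν s} {g = interpret π ν t} (interpret-represents π∈ ν∈ s) (interpret-represents π∈ ν∈ t)
  interpret-represents {π = π} {ν} π∈ ν∈ (s *′ t) = mulF-represents {f = interpret π ν s} {g = interpret π ν t} (interpret-represents π∈ ν∈ s) (interpret-represents π∈ ν∈ t)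
  interpret-represents {π = π} {ν} π∈ ν∈ (-′ t)   = negF-represents {f = interpret π ν t} (interpret-represents π∈ ν∈ t)

-- The interpreted group

module Interpretation (em : ∀ {a} → ExcludedMiddle a) {ℓ} (𝒜 : DifferentialField ℓ)
    (K L : DifferentialSubfield 𝒜) (charZero : CharZero 𝒜) (closed : DifferentiallyClosed 𝒜)
    (saturated : Saturated 𝒜) (K⊆L : DifferentialSubfield.Mem K ⊆ DifferentialSubfield.Mem L)
    (L-small : subsetSetoid 𝒜 (DifferentialSubfield.Mem L) ≺ DifferentialField.setoid 𝒜)
    (normal : StronglyNormal 𝒜 K L) where
  open DifferentialField 𝒜 hiding (zero)
  open DifferentialPolynomials em 𝒜 using (integral)
  open Pairs em 𝒜 using (PartialIso)
  open Homomorphisms em 𝒜 K L charZero closed saturated K⊆L L-small using (constants⊆K; functional)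
  open Realisations em 𝒜 K L charZero closed saturated K⊆L L-small normal
  open Uniformity em 𝒜 K L charZero closed saturated K⊆L L-small normal
  open Genericity em 𝒜 K L charZero closed saturated K⊆L L-small normal using (eqs; neqs; eqs∋b; neqs∋b; covered⇒real)
  open GaloisElements em 𝒜 K L charZero closed saturated K⊆L L-small normal
  open Definability em 𝒜 K L (constants⊆K (proj₁ normal) (proj₂ normal))
  open RingSolver commutativeRing
  open Family family renaming (m to d)
  private
    module K = DifferentialSubfield K
    module C = DifferentialSubfield (C𝒜 𝒜)
    module Galois = Group (Gal 𝒜 K L)

  ⌊_⌋ : ∀ {n} → Vector Constant n → Vector Carrier n
  ⌊ c ⌋ j = proj₁ (c j)

  record Solution (c : Vector Constant d) (x : Vector Carrier N) : Set ℓ where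
    field
      Q≉0 : ¬ evalAt Q b ⌊ c ⌋ ≈ 0#
      x≈  : ∀ i → x i * evalAt Q b ⌊ c ⌋ ≈ evalAt (P i) b ⌊ c ⌋

  cancel : ∀ {x y q} → ¬ q ≈ 0# → x * q ≈ y * q → x ≈ y
  cancel {x} {y} {q} q≉0 e = trans (solve 2 (λ x y → x := (x :+ (:- y)) :+ y) refl x y)
    (trans (+-congʳ ([ id , (λ z → contradiction z q≉0) ]′ (integral
      (trans (solve 3 (λ x y q → (x :+ (:- y)) :* q := x :* q :+ (:- (y :* q))) refl x y q) (trans (+-congʳ e) (-‿inverseʳ (y * q)))))))
      (+-identityˡ y))

  solution-unique : ∀ {c x y} → Solution c x → Solution c y → ∀ i → x i ≈ y i
  solution-unique s t i = cancel (Solution.Q≉0 s) (trans (Solution.x≈ s i) (sym (Solution.x≈ t i)))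

  private
    _−_ : ∀ {m} → Fraction m → Fraction m → Fraction m
    f − g = addF f (negF g)

    −⇒ : ∀ {m} {c : Vector Constant m} f g {v w} → Represents c f v → Represents c g w → val (proj₁ (f − g)) c ≈ 0# → v ≈ w
    −⇒ {c = c} f g {v} {w} p q z = trans (solve 2 (λ v w → v := (v :+ (:- w)) :+ w) refl v w)
      (trans (+-congʳ (represents-zero⇒ {f = f − g} (addF-represents {f = f} {g = negF g} p (negF-represents {f = g} q)) z)) (+-identityˡ w))

    −⇐ : ∀ {m} {c : Vector Constant m} f g {v w} → Represents c f v → Represents c g w → v ≈ w → val (proj₁ (f − g)) c ≈ 0#
    −⇐ {c = c} f g {v} {w} p q e = represents-zero⇐ {f = f − g} (addF-represents {f = f} {g = negF g} p (negF-represents {f = g} q))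
      (trans (+-congʳ e) (-‿inverseʳ w))

    at-b : RingTerm Term d → Fraction d
    at-b = interpret (λ t → constF (⟦ t ⟧ b , ⟦b⟧∈L t)) varF

    at-b-represents : ∀ c R → Represents c (at-b R) (evalAt R b ⌊ c ⌋)
    at-b-represents c = interpret-represents {c = c} (λ t → constF-represents {c = c} (⟦ t ⟧ b , ⟦b⟧∈L t)) (varF-represents {c = c})

    X : Fin N → Fraction d
    X i = divF (at-b (P i)) (at-b Q)

    term-x : Term → Fraction d
    term-x = interpret (λ (k , k∈) → constF (k , K⊆L k∈)) X

    at-x : RingTerm Term d → Fraction d
    at-x = interpret term-x varF

    module _ {c : Vector Constant d} {x : Vector Carrier N} (s : Solution c x) where
      open Solution s

      X-represents : ∀ i → Represents c (X i) (x i)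
      X-represents i = divF-represents {f = at-b (P i)} {g = at-b Q} (at-b-represents c (P i)) (at-b-represents c Q) Q≉0 (x≈ i)

      term-x-represents : ∀ t → Represents c (term-x t) (⟦ t ⟧ x)
      term-x-represents = interpret-represents {c = c} (λ (k , k∈) → constF-represents {c = c} (k , K⊆L k∈)) X-represents

      at-x-represents : ∀ R → Represents c (at-x R) (evalAt R x ⌊ c ⌋)
      at-x-represents = interpret-represents {c = c} term-x-represents (varF-represents {c = c})

    δlhs : Fin N → Fraction d
    δlhs i = mulF (δF (X i)) (term-x (δden i))

    b-lhs : Fin N → Fraction d
    b-lhs i = mulF (constF (b i , b∈ i)) (at-x Q′)

    -- The hypotheses of `covered⇒real` for x = P(b, c) / Q(b, c), as conditions on numerators: Q
    -- does not vanish, the triangular equations and inequations hold, so do the equations for δx,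
    -- Q′ does not vanish, and b = P′(x, c) / Q′(x, c).
    Domain : Vector Constant d → Set ℓ
    Domain c = ¬ val (proj₁ (at-b Q)) c ≈ 0#
             × All (λ t → val (proj₁ (term-x t)) c ≈ 0#) eqs
             × All (λ t → ¬ val (proj₁ (term-x t)) c ≈ 0#) neqs
             × (∀ i → val (proj₁ (δlhs i − term-x (δnum i))) c ≈ 0#)
             × ¬ val (proj₁ (at-x Q′)) c ≈ 0#
             × (∀ i → val (proj₁ (b-lhs i − at-x (P′ i))) c ≈ 0#)

  abstract
    domain-definable : Definable d Domain
    domain-definable =
      definable-× (definable-¬ (definable-zero (proj₁ (at-b Q))))
      (definable-× (definable-All (λ t → definable-zero (proj₁ (term-x t))) eqs)
      (definable-× (definable-All (λ t → definable-¬ (definable-zero (proj₁ (term-x t)))) neqs)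
      (definable-× (definable-∀ N (λ i → definable-zero (proj₁ (δlhs i − term-x (δnum i)))))
      (definable-× (definable-¬ (definable-zero (proj₁ (at-x Q′))))
                   (definable-∀ N (λ i → definable-zero (proj₁ (b-lhs i − at-x (P′ i)))))))))

  private
    module _ {c : Vector Constant d} {x : Vector Carrier N} (s : Solution c x) where
      δlhs-represents : ∀ i → Represents c (δlhs i) (δ (x i) * ⟦ δden i ⟧ x)
      δlhs-represents i = mulF-represents {f = δF (X i)} {g = term-x (δden i)}
        (δF-represents {f = X i} (X-represents s i)) (term-x-represents s (δden i))

      b-lhs-represents : ∀ i → Represents c (b-lhs i) (b i * evalAt Q′ x ⌊ c ⌋)
      b-lhs-represents i = mulF-represents {f = constF (b i , b∈ i)} {g = at-x Q′} (constF-represents {c = c} (b i , b∈ i)) (at-x-represents s Q′)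

  abstract
    domain⇒ : ∀ {c} → Domain c → ∃ λ x → Solution c x × Real x
    domain⇒ {c} (q , es , ns , δs , q′ , bs) = x , sol , covered⇒real {κ = family} {c = ⌊ c ⌋}
        (record { constant = λ j → proj₂ (proj₂ (c j)) ; Q≉0 = Q≉0 ; x≈ = Solution.x≈ sol
                ; Q′≉0 = λ z → q′ (represents-zero⇐ {f = at-x Q′} (at-x-represents sol Q′) z)
                ; b≈ = λ i → −⇒ (b-lhs i) (at-x (P′ i)) (b-lhs-represents sol i) (at-x-represents sol (P′ i)) (bs i) })
        (All.map (λ {t} → represents-zero⇒ {f = term-x t} (term-x-represents sol t)) es)
        (All.map (λ {t} ne z → ne (represents-zero⇐ {f = term-x t} (term-x-represents sol t) z)) ns)
        (λ i → −⇒ (δlhs i) (term-x (δnum i)) (δlhs-represents sol i) (term-x-represents sol (δnum i)) (δs i))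
      where
        Q≉0 : ¬ evalAt Q b ⌊ c ⌋ ≈ 0#
        Q≉0 z = q (represents-zero⇐ {f = at-b Q} (at-b-represents c Q) z)
        y : Carrier
        y = proj₁ (inverse (evalAt Q b ⌊ c ⌋) Q≉0)
        x : Vector Carrier N
        x i = evalAt (P i) b ⌊ c ⌋ * y
        sol : Solution c x
        sol = record { Q≉0 = Q≉0 ; x≈ = λ i → trans (*-assoc _ y _) (trans (*-congˡ (trans (*-comm y _) (proj₂ (inverse (evalAt Q b ⌊ c ⌋) Q≉0)))) (*-identityʳ _)) }

  domain⇐ : ∀ {c x} → Real x → Covers family x ⌊ c ⌋ → Domain c
  domain⇐ {c} {x} r cov =
    (λ z → cov.Q≉0 (represents-zero⇒ {f = at-b Q} (at-b-represents c Q) z)) ,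
    All.map (λ {t} z → represents-zero⇐ {f = term-x t} (term-x-represents sol t) (Real.zero⇒ r t z)) eqs∋b ,
    All.map (λ {t} ne z → ne (Real.zero⇐ r t (represents-zero⇒ {f = term-x t} (term-x-represents sol t) z))) neqs∋b ,
    (λ i → −⇐ (δlhs i) (term-x (δnum i)) (δlhs-represents sol i) (term-x-represents sol (δnum i)) (Real.δ≈ r i)) ,
    (λ z → cov.Q′≉0 (represents-zero⇒ {f = at-x Q′} (at-x-represents sol Q′) z)) ,
    (λ i → −⇐ (b-lhs i) (at-x (P′ i)) (b-lhs-represents sol i) (at-x-represents sol (P′ i)) (cov.b≈ i))
    where
      module cov = Covers cov
      sol : Solution c x
      sol = record { Q≉0 = cov.Q≉0 ; x≈ = cov.x≈ }

  private
    Equal : Vector Constant (d ℕ.+ d) → Set ℓ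
    Equal v = ∀ i → val (proj₁ (renameF (_↑ˡ d) (X i) − renameF (d ↑ʳ_) (X i))) v ≈ 0#

  abstract
    equal-definable : Definable (d ℕ.+ d) Equal
    equal-definable = definable-∀ N (λ i → definable-zero (proj₁ (renameF (_↑ˡ d) (X i) − renameF (d ↑ʳ_) (X i))))

  private
    module _ {c₁ c₂ : Vector Constant d} {x₁ x₂ : Vector Carrier N} (s₁ : Solution c₁ x₁) (s₂ : Solution c₂ x₂) where
      left-represents : ∀ i → Represents (c₁ Vector.++ c₂) (renameF (_↑ˡ d) (X i)) (x₁ i)
      left-represents i = renameF-represents (_↑ˡ d) (X i) (λ j → reflexive (≡.cong proj₁ (Vector.lookup-++ˡ c₁ c₂ j))) (X-represents s₁ i)

      right-represents : ∀ i → Represents (c₁ Vector.++ c₂) (renameF (d ↑ʳ_) (X i)) (x₂ i)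
      right-represents i = renameF-represents (d ↑ʳ_) (X i) (λ j → reflexive (≡.cong proj₁ (Vector.lookup-++ʳ c₁ c₂ j))) (X-represents s₂ i)

      equal⇒ : Equal (c₁ Vector.++ c₂) → ∀ i → x₁ i ≈ x₂ i
      equal⇒ e i = −⇒ (renameF (_↑ˡ d) (X i)) (renameF (d ↑ʳ_) (X i)) (left-represents i) (right-represents i) (e i)

      equal⇐ : (∀ i → x₁ i ≈ x₂ i) → Equal (c₁ Vector.++ c₂)
      equal⇐ e i = −⇐ (renameF (_↑ˡ d) (X i)) (renameF (d ↑ʳ_) (X i)) (left-represents i) (right-represents i) (e i)

    r₁ r₂ r₃ : Fin d → Fin (d ℕ.+ (d ℕ.+ d))
    r₁ j = j ↑ˡ (d ℕ.+ d)
    r₂ j = d ↑ʳ (j ↑ˡ d)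
    r₃ j = d ↑ʳ (d ↑ʳ j)

    -- The value at (x₁, c₂) of a term in x and c.
    mixed : RingTerm Term d → Fraction (d ℕ.+ (d ℕ.+ d))
    mixed = interpret (λ t → renameF r₁ (term-x t)) (λ j → varF (r₂ j))

    mul-lhs : Fin N → Fraction (d ℕ.+ (d ℕ.+ d))
    mul-lhs i = mulF (renameF r₃ (X i)) (mixed Q)

    -- With σ₁ the automorphism b ↦ x₁, which fixes c₂, applying σ₁ to x₂ = P(b, c₂) / Q(b, c₂)
    -- replaces b by x₁. So the product has x₃ = P(x₁, c₂) / Q(x₁, c₂), and x₁ and x₃ are fractions
    -- in c₁ and c₃.
    Product : Vector Constant (d ℕ.+ (d ℕ.+ d)) → Set ℓ
    Product v = ∀ i → val (proj₁ (mul-lhs i − mixed (P i))) v ≈ 0#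

  abstract
    product-definable : Definable (d ℕ.+ (d ℕ.+ d)) Product
    product-definable = definable-∀ N (λ i → definable-zero (proj₁ (mul-lhs i − mixed (P i))))

  private
    module _ {c₁ c₂ c₃ : Vector Constant d} {x₁ x₃ : Vector Carrier N} (s₁ : Solution c₁ x₁) (s₃ : Solution c₃ x₃) where
      v : Vector Constant (d ℕ.+ (d ℕ.+ d))
      v = c₁ Vector.++ (c₂ Vector.++ c₃)

      at₁ : ∀ j → proj₁ (v (r₁ j)) ≈ proj₁ (c₁ j)
      at₁ j = reflexive (≡.cong proj₁ (Vector.lookup-++ˡ c₁ (c₂ Vector.++ c₃) j))
      at₂ : ∀ j → proj₁ (v (r₂ j)) ≈ proj₁ (c₂ j)
      at₂ j = reflexive (≡.cong proj₁ (≡.trans (Vector.lookup-++ʳ c₁ (c₂ Vector.++ c₃) (j ↑ˡ d)) (Vector.lookup-++ˡ c₂ c₃ j)))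
      at₃ : ∀ j → proj₁ (v (r₃ j)) ≈ proj₁ (c₃ j)
      at₃ j = reflexive (≡.cong proj₁ (≡.trans (Vector.lookup-++ʳ c₁ (c₂ Vector.++ c₃) (d ↑ʳ j)) (Vector.lookup-++ʳ c₂ c₃ j)))

      mixed-represents : ∀ R → Represents v (mixed R) (evalAt R x₁ (⌊ v ⌋ ∘ r₂))
      mixed-represents = interpret-represents {c = v} (λ t → renameF-represents r₁ (term-x t) at₁ (term-x-represents s₁ t))
        (λ j → varF-represents {c = v} (r₂ j))

      lhs-represents : ∀ i → Represents v (mul-lhs i) (x₃ i * evalAt Q x₁ (⌊ v ⌋ ∘ r₂))
      lhs-represents i = mulF-represents {f = renameF r₃ (X i)} {g = mixed Q}
        (renameF-represents r₃ (X i) at₃ (X-represents s₃ i)) (mixed-represents Q)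

      product⇒ : Product v → ∀ i → x₃ i * evalAt Q x₁ ⌊ c₂ ⌋ ≈ evalAt (P i) x₁ ⌊ c₂ ⌋
      product⇒ p i = trans (*-congˡ (sym (evalAt-cong Q x₁ at₂)))
        (trans (−⇒ (mul-lhs i) (mixed (P i)) (lhs-represents i) (mixed-represents (P i)) (p i)) (evalAt-cong (P i) x₁ at₂))

      product⇐ : (∀ i → x₃ i * evalAt Q x₁ ⌊ c₂ ⌋ ≈ evalAt (P i) x₁ ⌊ c₂ ⌋) → Product v
      product⇐ p i = −⇐ (mul-lhs i) (mixed (P i)) (lhs-represents i) (mixed-represents (P i))
        (trans (*-congˡ (evalAt-cong Q x₁ at₂)) (trans (p i) (sym (evalAt-cong (P i) x₁ at₂))))

  Dom : Set ℓ
  Dom = Σ (Vector Constant d) (Satisfies (Definable.formula domain-definable))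

  point : Dom → Vector Carrier N
  point (c , s) = proj₁ (domain⇒ (Definable.sound domain-definable s))

  point-solution : ∀ u → Solution (proj₁ u) (point u)
  point-solution (c , s) = proj₁ (proj₂ (domain⇒ (Definable.sound domain-definable s)))

  toGalois : Dom → Galois.Carrier
  toGalois (c , s) = proj₁ (real⇒galois (proj₂ (proj₂ (domain⇒ (Definable.sound domain-definable s)))))

  toGalois-image : ∀ u i → gal-image (toGalois u) i ≈ point u i
  toGalois-image (c , s) = proj₂ (real⇒galois (proj₂ (proj₂ (domain⇒ (Definable.sound domain-definable s)))))

  abstract
    -- A section of `toGalois`: it picks some tuple of constants covering σ(b). Nothing makes the
    -- tuple unique, whence the quotient by `_∼_`.
    fromGalois : Galois.Carrier → Dom
    fromGalois σ = c , Definable.complete domain-definable (domain⇐ (gal-image-real σ) cov)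
      where
        cover : ∃ (Covers family (gal-image σ))
        cover = uniformly-covered (gal-image-real σ)
        cov : Covers family (gal-image σ) (proj₁ cover)
        cov = proj₂ cover
        c : Vector Constant d
        c j = proj₁ cover j , tt , Covers.constant cov j

    fromGalois-solution : ∀ σ → Solution (proj₁ (fromGalois σ)) (gal-image σ)
    fromGalois-solution σ = record { Q≉0 = Covers.Q≉0 cov ; x≈ = Covers.x≈ cov }
      where
        cov : Covers family (gal-image σ) (proj₁ (uniformly-covered (gal-image-real σ)))
        cov = proj₂ (uniformly-covered (gal-image-real σ))

  toGalois-fromGalois : ∀ σ → toGalois (fromGalois σ) Galois.≈ σ
  toGalois-fromGalois σ = gal-determined (toGalois (fromGalois σ)) σ λ i → trans (toGalois-image (fromGalois σ) i)
    (solution-unique (point-solution (fromGalois σ)) (fromGalois-solution σ) i)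

  image-cong : ∀ {σ σ′} → σ Galois.≈ σ′ → ∀ i → gal-image σ i ≈ gal-image σ′ i
  image-cong e i = e (b i , gen (inj₁ (b∈ i)))

  _∼_ : Dom → Dom → Set ℓ
  (c , _) ∼ (c′ , _) = Satisfies (Definable.formula equal-definable) (c Vector.++ c′)

  ∼⇒ : ∀ {u v} → u ∼ v → toGalois u Galois.≈ toGalois v
  ∼⇒ {u} {v} s = gal-determined (toGalois u) (toGalois v) λ i → trans (toGalois-image u i)
    (trans (equal⇒ (point-solution u) (point-solution v) (Definable.sound equal-definable s) i) (sym (toGalois-image v i)))

  ∼⇐ : ∀ {u v} → toGalois u Galois.≈ toGalois v → u ∼ v
  ∼⇐ {u} {v} e = Definable.complete equal-definable (equal⇐ (point-solution u) (point-solution v)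
    λ i → trans (sym (toGalois-image u i)) (trans (image-cong {toGalois u} {toGalois v} e i) (toGalois-image v i)))

  -- Applying σ to xᵢ Q(b, c) = Pᵢ(b, c).
  composite-image : ∀ σ τ {c x} → Solution c x → (∀ i → gal-image τ i ≈ x i) →
    ∀ i → gal-image (σ Galois.∙ τ) i * evalAt Q (gal-image σ) ⌊ c ⌋ ≈ evalAt (P i) (gal-image σ) ⌊ c ⌋
  composite-image σ τ {c} {x} s e i = functional (gal-graph σ)
    (Γ.*∈ τb∈ (gal-graph-evalAt σ Q constant)) (gal-graph-evalAt σ (P i) constant)
    (trans (*-congʳ (e i)) (Solution.x≈ s i))
    where
      module Γ = PartialIso (gal-graph σ)
      constant : ∀ j → C.Mem (⌊ c ⌋ j)
      constant j = proj₂ (c j)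
      τb∈ : Γ.Graph (gal-image τ i , gal-image (σ Galois.∙ τ) i)
      τb∈ = Automorphism.⟦_⟧ (proj₁ τ) (b i , gen (inj₁ (b∈ i))) , refl , refl

  Mul : Dom → Dom → Dom → Set ℓ
  Mul (c₁ , _) (c₂ , _) (c₃ , _) = Satisfies (Definable.formula product-definable) (c₁ Vector.++ (c₂ Vector.++ c₃))

  private
    module _ (u v w : Dom) where
      σ τ υ : Galois.Carrier
      σ = toGalois u
      τ = toGalois v
      υ = toGalois w

      at-cong : ∀ (R : RingTerm Term d) c → evalAt R (gal-image σ) c ≈ evalAt R (point u) c
      at-cong R c = go R
        where
          go : ∀ (R : RingTerm Term d) → evalAt R (gal-image σ) c ≈ evalAt R (point u) c
          go (var j)  = refl
          go (par t)  = RingTermProperties.eval-cong commutativeRing proj₁ t (toGalois-image u)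
          go 0′       = refl
          go 1′       = refl
          go (s +′ t) = +-cong (go s) (go t)
          go (s *′ t) = *-cong (go s) (go t)
          go (-′ t)   = -‿cong (go t)

      composite≈ : ∀ i → gal-image (σ Galois.∙ τ) i * evalAt Q (point u) ⌊ proj₁ v ⌋ ≈ evalAt (P i) (point u) ⌊ proj₁ v ⌋
      composite≈ i = trans (*-congˡ (sym (at-cong Q ⌊ proj₁ v ⌋))) (trans (composite-image σ τ (point-solution v) (toGalois-image v) i) (at-cong (P i) ⌊ proj₁ v ⌋))

      -- Q(x₁, c₂) is the image of Q(b, c₂) under σ, and the latter is nonzero.
      denominator≉0 : ¬ evalAt Q (point u) ⌊ proj₁ v ⌋ ≈ 0#
      denominator≉0 z = Solution.Q≉0 (point-solution v)
        (PartialIso.zero⇐ (gal-graph σ) (gal-graph-evalAt σ Q (λ j → proj₂ (proj₁ v j))) (trans (at-cong Q ⌊ proj₁ v ⌋) z))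

    mul⇒ : ∀ u v w → Mul u v w → (toGalois u Galois.∙ toGalois v) Galois.≈ toGalois w
    mul⇒ u v w s = gal-determined (toGalois u Galois.∙ toGalois v) (toGalois w) λ i → trans
      (cancel (denominator≉0 u v w) (trans (composite≈ u v w i)
        (sym (product⇒ (point-solution u) (point-solution w) (Definable.sound product-definable s) i))))
      (sym (toGalois-image w i))

    mul⇐ : ∀ u v w → (toGalois u Galois.∙ toGalois v) Galois.≈ toGalois w → Mul u v w
    mul⇐ u v w e = Definable.complete product-definable (product⇐ (point-solution u) (point-solution w)
      λ i → trans (*-congʳ (trans (sym (toGalois-image w i))
        (sym (image-cong {toGalois u Galois.∙ toGalois v} {toGalois w} e i)))) (composite≈ u v w i))

  -- The operations are transported from the Galois group along `toGalois` and its section, so the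
  -- group laws follow from those of the Galois group; that `Mul` is the graph of the product is
  -- proved separately by `mul⇒` and `mul⇐`.
  rawGroup : RawGroup ℓ ℓ
  rawGroup = record
    { Carrier = Dom
    ; _≈_ = _∼_
    ; _∙_ = λ u v → fromGalois (toGalois u Galois.∙ toGalois v)
    ; ε = fromGalois Galois.ε
    ; _⁻¹ = λ u → fromGalois (toGalois u Galois.⁻¹)
    }

  isGroupIsomorphism : IsGroupIsomorphism rawGroup Galois.rawGroup toGalois
  isGroupIsomorphism = record
    { isGroupMonomorphism = record
      { isGroupHomomorphism = record
        { isMonoidHomomorphism = record
          { isMagmaHomomorphism = record
            { isRelHomomorphism = record { cong = λ {u} {v} → ∼⇒ {u} {v} }
            ; homo = λ u v → toGalois-fromGalois (toGalois u Galois.∙ toGalois v)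
            }
          ; ε-homo = toGalois-fromGalois Galois.ε
          }
        ; ⁻¹-homo = λ u → toGalois-fromGalois (toGalois u Galois.⁻¹)
        }
      ; injective = λ {u} {v} → ∼⇐ {u} {v}
      }
    ; surjective = λ σ → fromGalois σ , λ {u} e →
        Galois.trans {toGalois u} {toGalois (fromGalois σ)} {σ} (∼⇒ {u} {fromGalois σ} e) (toGalois-fromGalois σ)
    }

  interpretation : QFInterpretation constantRing (λ c → DifferentialSubfield.Mem (constants 𝒜 K) (proj₁ c)) (Gal 𝒜 K L)
  interpretation = record
    { d = d
    ; 1≤d = 1≤family
    ; domF = Definable.formula domain-definable
    ; eqF = Definable.formula equal-definable
    ; mulF = Definable.formula product-definable
    ; _∙_ = RawGroup._∙_ rawGroup
    ; ε = RawGroup.ε rawGroup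
    ; _⁻¹ = RawGroup._⁻¹ rawGroup
    ; isGroup = GroupMonomorphism.isGroup (IsGroupIsomorphism.isGroupMonomorphism isGroupIsomorphism) Galois.isGroup
    ; graph = λ u v w → mk⇔
        (λ s → ∼⇐ {fromGalois (toGalois u Galois.∙ toGalois v)} {w}
          (Galois.trans {toGalois (fromGalois (toGalois u Galois.∙ toGalois v))} {toGalois u Galois.∙ toGalois v} {toGalois w}
            (toGalois-fromGalois (toGalois u Galois.∙ toGalois v)) (mul⇒ u v w s)))
        (λ e → mul⇐ u v w
          (Galois.trans {toGalois u Galois.∙ toGalois v} {toGalois (fromGalois (toGalois u Galois.∙ toGalois v))} {toGalois w}
            (Galois.sym {toGalois (fromGalois (toGalois u Galois.∙ toGalois v))} {toGalois u Galois.∙ toGalois v}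
              (toGalois-fromGalois (toGalois u Galois.∙ toGalois v)))
            (∼⇒ {fromGalois (toGalois u Galois.∙ toGalois v)} {w} e)))
    ; iso = toGalois
    ; isGroupIsomorphism = isGroupIsomorphism
    }

theorem3p14 : (∀ {a} → ExcludedMiddle a) →
    ∀ {ℓ} (𝒜 : DifferentialField ℓ) (K L : DifferentialSubfield 𝒜) →
    let open DifferentialSubfield in
    CharZero 𝒜 →
    DifferentiallyClosed 𝒜 →
    Saturated 𝒜 →
    Mem K ⊆ Mem L →
    subsetSetoid 𝒜 (Mem L) ≺ DifferentialField.setoid 𝒜 →
    StronglyNormal 𝒜 K L →
    QFInterpretation (DifferentialField.commutativeRing (toField 𝒜 (C𝒜 𝒜)))
    (λ c → Mem (constants 𝒜 K) (proj₁ c))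
    (Gal 𝒜 K L)
theorem3p14 em 𝒜 K L charZero closed saturated K⊆L L-small normal =
  Interpretation.interpretation em 𝒜 K L charZero closed saturated K⊆L L-small normal
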